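{- Let $P$, $\zeta$ and, for $i\ge6$, the finite sequences $Q_i$ be as constructed in the context, and put $Q=Q_6^{l_6}Q_7^{l_7}Q_8^{l_8}\cdots$ (concatenation, where $Q_i^{l_i}$ is $Q_i$ repeated $l_i$ times), where $l_i=2^{4i^2}$. Then $Q$ is infinite in limit and fully divergent, and $$\psi_{P,Q}(\zeta)\in\left(RN(Q)\cap DN(Q)\right)\setminus N(Q).$$
   Context: General definitions. A basic sequence is a sequence $Q=(q_n)_{n\ge1}$ of integers $q_n\ge 2$. The $Q$-Cantor series expansion of $x\in\mathbb{R}$, abbreviated $x=E_0.E_1E_2\cdots$ w.r.t. $Q$, is the unique expansion $x=E_0+\sum_{n\ge1}\frac{E_n}{q_1\cdots q_n}$ with $E_0=\lfloor x\rfloor$, $E_n\in\{0,\ldots,q_n-1\}$ for $n\ge 1$, and $E_n\ne q_n-1$ infinitely often. For basic sequences $P,Q$ and $x=E_0.E_1E_2\cdots$ w.r.t. $P$, $\psi_{P,Q}(x)=\sum_{n\ge1}\frac{\min(E_n,q_n-1)}{q_1\cdots q_n}$. $Q$ is infinite in limit if $q_n\to\infty$. Put $Q_n^{(k)}=\sum_{j=1}^n\frac1{q_j\cdots q_{j+k-1}}$; $Q$ is fully divergent if $\lim_nQ_n^{(k)}=\infty$ for all $k\ge1$. A block of length $k$ is an ordered $k$-tuple of non-negative integers, and $N_n^Q(B,x)$ is the number of occurrences of $B$ starting at positions $\le n$ in the digits $E_1,E_2,\ldots$ of $x$ w.r.t. $Q$. $N(Q)$ is the set of $x$ with $\lim_nN_n^Q(B,x)/Q_n^{(k)}=1$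 for all $k\ge1$ and all blocks $B$ of length $k$; $RN(Q)$ is the set of $x$ with $\lim_nN_n^Q(B_1,x)/N_n^Q(B_2,x)=1$ for all $k\ge1$ and all blocks $B_1,B_2$ of length $k$; $DN(Q)$ is the set of $x$ such that $(q_1\cdots q_nx\bmod1)_{n\ge0}$ is uniformly distributed mod $1$. Construction of $P$ and $\zeta$. For a positive integer $b$ and a digit $j$ put $\nu_b((j))=2^{ -b}$ if $0\le j\le b-1$, $\nu_b((b))=\frac{2^b-b}{2^b}$, $\nu_b((j))=0$ if $j>b$; for a block $B=(b_1,\ldots,b_k)$ put $\nu_b(B)=\prod_{j=1}^k\nu_b((b_j))$. For positive integers $b,w$ let $V_1,\ldots,V_{(b+1)^w}$ be all blocks of length $w$ with digits in $\{0,1,\ldots,b\}$ in lexicographic order, and let $V_{b,w}$ be the concatenation $V_1^{2^{bw}\nu_b(V_1)}V_2^{2^{bw}\nu_b(V_2)}\cdots V_{(b+1)^w}^{2^{bw}\nu_b(V_{(b+1)^w})}$, where $V^m$ is $V$ repeated $m$ times. For $i\ge6$ let $W_i=V_{i,i^2}=(w_{i,t})_{t=1}^{|W_i|}$, which has length $|W_i|=i^22^{i^3}$, and $l_i=2^{4i^2}$. Let $(E_1,E_2,\ldots)=W_6^{l_6}W_7^{l_7}W_8^{l_8}\cdots$, let $P=(p_n)$ be the basic sequence with $p_n=2^i$ whenever position $n$ lies in the part $W_i^{l_i}$ of this concatenation, and let $\zeta=\sum_{n\ge1}\frac{E_n}{p_1\cdots p_n}$. Construction of $Q_i$. For $i\ge6$,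 $Q_i=(q_{i,t})_{t=1}^{|W_i|}$ is defined as follows. If $w_{i,t}\in\{0,\ldots,i-1\}$, set $q_{i,t}=i$. The remaining $i^22^{i^3}-i^32^{i^3-i}$ indices $t$ (those with $w_{i,t}=i$) are divided into $i$ classes, each of $i2^{i^3}-i^22^{i^3-i}$ elements; for $t$ in the first class set $q_{i,t}=i^3$, and for $t$ in the $j$-th class, $2\le j\le i$, set $q_{i,t}=\lfloor i^2/(j-1)\rfloor$. -}

module Defs where

open import Data.Bool.Base using (if_then_else_; true; false)
open import Data.Fin.Base as Fin using (Fin; toℕ)
import Data.Fin.Properties as Fin
open import Data.Fin.Subset as Subset using (Subset)
open import Data.Integer.Base as ℤ using (ℤ; +_)
import Data.Integer.Properties as ℤ
open import Data.List.Base as List using (List; []; _∷_; _++_)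
open import Data.List.NonEmpty.Base as List⁺ using (List⁺; _∷_)
open import Data.List.Membership.Propositional.Properties using (∈-lookup)
open import Data.List.Relation.Unary.All as All using (All; []; _∷_)
import Data.List.Relation.Unary.All.Properties as All
open import Data.Nat.Base
open import Data.Nat.DivMod using (_/_; /-monoʳ-≤; m*n/n≡m)
open import Data.Nat.Properties
open import Data.Product.Base using (Σ-syntax; ∃-syntax; _×_; _,_; proj₁; proj₂)
open import Data.Rational.Base as ℚ using (ℚ; 0ℚ; 1ℚ)
import Data.Rational.Properties as ℚ
open import Data.Rational.Solver using (module +-*-Solver)
import Data.Rational.Unnormalised.Base as ℚᵘ
import Data.Rational.Unnormalised.Properties as ℚᵘ
open import Data.Sum.Base using (inj₁; inj₂)
open import Data.Vec.Base as Vec using (Vec; []; _∷_)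
import Data.Vec.Properties as Vec
open import Data.Vec.Relation.Unary.All as VAll using ([]; _∷_)
import Data.Vec.Relation.Unary.All.Properties as VAllP
open import Function.Base using (_∘_; it)
open import Function.Bundles using (_⇔_)
open import Level using (0ℓ)
open import Relation.Binary.PropositionalEquality
open import Relation.Nullary using (does; contradiction)
open import Relation.Nullary.Decidable using (_×-dec_)
open import Relation.Unary using (Pred; _∈_)

fromℕ : ℕ → ℚ
fromℕ n = + n ℚ./ 1

sumℚ : (ℕ → ℚ) → ℕ → ℚ
sumℚ u zero    = 0ℚ
sumℚ u (suc n) = sumℚ u n ℚ.+ u n

toℚᵘ-/ : ∀ a d .{{_ : NonZero d}} → ℚ.toℚᵘ (+ a ℚ./ d) ℚᵘ.≃ (+ a ℚᵘ./ d)
toℚᵘ-/ a (suc d) = ℚ.toℚᵘ-fromℚᵘ (ℚᵘ.mkℚᵘ (+ a) d)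

/-≤ : ∀ {a b d e} .{{_ : NonZero d}} .{{_ : NonZero e}} →
      a * e ≤ b * d → + a ℚ./ d ℚ.≤ + b ℚ./ e
/-≤ {a} {b} {suc d} {suc e} h = ℚ.toℚᵘ-cancel-≤
  (ℚᵘ.≤-respˡ-≃ (ℚᵘ.≃-sym (toℚᵘ-/ a (suc d)))
    (ℚᵘ.≤-respʳ-≃ (ℚᵘ.≃-sym (toℚᵘ-/ b (suc e)))
      (ℚᵘ.*≤* (subst₂ ℤ._≤_ (ℤ.pos-* a (suc e)) (ℤ.pos-* b (suc d)) (ℤ.+≤+ h)))))

/-≡ : ∀ {a b d e} .{{_ : NonZero d}} .{{_ : NonZero e}} →
      a * e ≡ b * d → + a ℚ./ d ≡ + b ℚ./ e
/-≡ {a} {b} {d} {e} eq =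
  ℚ.≤-antisym (/-≤ {a} {b} {d} {e} (≤-reflexive eq)) (/-≤ {b} {a} {e} {d} (≤-reflexive (sym eq)))

/-+ : ∀ a b d .{{_ : NonZero d}} → + a ℚ./ d ℚ.+ + b ℚ./ d ≡ + (a + b) ℚ./ d
/-+ a b d@(suc _) = ℚ.toℚᵘ-injective
  (ℚᵘ.≃-trans (ℚ.toℚᵘ-homo-+ (+ a ℚ./ d) (+ b ℚ./ d))
  (ℚᵘ.≃-trans (ℚᵘ.+-cong (toℚᵘ-/ a d) (toℚᵘ-/ b d))
  (ℚᵘ.≃-trans (ℚᵘ.*≡* eq) (ℚᵘ.≃-sym (toℚᵘ-/ (a + b) d)))))
  where
  open import Data.Integer.Solver using () renaming (module +-*-Solver to ℤS)
  eq : (+ a ℤ.* + d ℤ.+ + b ℤ.* + d) ℤ.* + d ≡ + (a + b) ℤ.* (+ d ℤ.* + d)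
  eq = trans (ℤS.solve 3 (λ x y z → (x ℤS.:* z ℤS.:+ y ℤS.:* z) ℤS.:* z ℤS.:=
                                    (x ℤS.:+ y) ℤS.:* (z ℤS.:* z)) refl (+ a) (+ b) (+ d))
             (cong (ℤ._* (+ d ℤ.* + d)) (sym (ℤ.pos-+ a b)))

/-* : ∀ a b d e .{{_ : NonZero d}} .{{_ : NonZero e}} →
      + a ℚ./ d ℚ.* (+ b ℚ./ e) ≡ (+ (a * b) ℚ./ (d * e)) {{m*n≢0 d e}}
/-* a b d@(suc _) e@(suc _) = ℚ.toℚᵘ-injective
  (ℚᵘ.≃-trans (ℚ.toℚᵘ-homo-* (+ a ℚ./ d) (+ b ℚ./ e))
  (ℚᵘ.≃-trans (ℚᵘ.*-cong (toℚᵘ-/ a d) (toℚᵘ-/ b e))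
  (ℚᵘ.≃-trans (ℚᵘ.*≡* (cong₂ ℤ._*_ (sym (ℤ.pos-* a b)) refl))
              (ℚᵘ.≃-sym (toℚᵘ-/ (a * b) (d * e))))))

/-*-≡ : ∀ a b d e f .{{_ : NonZero d}} .{{_ : NonZero e}} .{{_ : NonZero f}} → d * e ≡ f →
        + a ℚ./ d ℚ.* (+ b ℚ./ e) ≡ + (a * b) ℚ./ f
/-*-≡ a b d e f eq = trans (/-* a b d e)
  (/-≡ {a * b} {a * b} {d * e} {f} {{m*n≢0 d e}} (cong (a * b *_) (sym eq)))

/-*-cancel : ∀ b d .{{_ : NonZero d}} → fromℕ d ℚ.* (+ b ℚ./ d) ≡ fromℕ b
/-*-cancel b d = trans (/-*-≡ d b 1 d d (*-identityˡ d))
  (/-≡ {d * b} {b} {d} {1} (trans (*-identityʳ _) (*-comm d b)))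

p≤p+q : ∀ p q → 0ℚ ℚ.≤ q → p ℚ.≤ p ℚ.+ q
p≤p+q p q 0≤q = subst (ℚ._≤ p ℚ.+ q) (ℚ.+-identityʳ p) (ℚ.+-monoʳ-≤ p 0≤q)

archimedean : ∀ ε → 0ℚ ℚ.< ε → ∃[ N ] + 1 ℚ./ suc N ℚ.< ε
archimedean (ℚ.mkℚ (ℤ.+ zero) d c) (ℚ.*<* h) = contradiction h (ℤ.<-irrefl (sym (ℤ.*-zeroˡ (+ 1))))
archimedean (ℚ.mkℚ (ℤ.-[1+ n ]) d c) (ℚ.*<* ())
archimedean ε@(ℚ.mkℚ (ℤ.+ (suc a)) d c) _ = suc d , ℚ.toℚᵘ-cancel-<
  (ℚᵘ.<-respˡ-≃ (ℚᵘ.≃-sym (toℚᵘ-/ 1 (suc (suc d))))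
    (ℚᵘ.*<* (ℤ.+<+ (subst (_≤ suc a * suc (suc d)) (cong (λ z → suc (suc z)) (sym (+-identityʳ d)))
       (m≤m+n (suc (suc d)) (a * suc (suc d)))))))

-- Real numbers, as Cauchy sequences of rationals up to _≃_

record ℝ : Set where
  field
    approx : ℕ → ℚ
    cauchy : ∀ ε → 0ℚ ℚ.< ε →
             ∃[ N ] (∀ m n → N ≤ m → N ≤ n → ℚ.∣ approx m ℚ.- approx n ∣ ℚ.< ε)

open ℝ public

infix  4 _≃_ _≤ᴿ_ _<ᴿ_
infixl 6 _+ᴿ_ _-ᴿ_
infixl 7 _·_
infix  8 -ᴿ_

_≃_ : ℝ → ℝ → Set
x ≃ y = ∀ ε → 0ℚ ℚ.< ε → ∃[ N ] (∀ n → N ≤ n → ℚ.∣ approx x n ℚ.- approx y n ∣ ℚ.< ε)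

_≤ᴿ_ : ℝ → ℝ → Set
x ≤ᴿ y = ∀ ε → 0ℚ ℚ.< ε → ∃[ N ] (∀ n → N ≤ n → approx x n ℚ.≤ approx y n ℚ.+ ε)

_<ᴿ_ : ℝ → ℝ → Set
x <ᴿ y = ∃[ ε ] 0ℚ ℚ.< ε × ∃[ N ] (∀ n → N ≤ n → approx x n ℚ.+ ε ℚ.≤ approx y n)

fromℚ : ℚ → ℝ
fromℚ q = record
  { approx = λ _ → q
  ; cauchy = λ ε 0<ε → 0 , λ _ _ _ _ → subst (λ z → ℚ.∣ z ∣ ℚ.< ε) (sym (ℚ.+-inverseʳ q)) 0<ε
  }

fromℤ : ℤ → ℝ
fromℤ z = fromℚ (z ℚ./ 1)

half : ∀ ε → 0ℚ ℚ.< ε → 0ℚ ℚ.< ℚ.½ ℚ.* ε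
half ε 0<ε = subst (ℚ._< ℚ.½ ℚ.* ε) (ℚ.*-zeroʳ ℚ.½) (ℚ.*-monoʳ-<-pos ℚ.½ 0<ε)

half+half : ∀ ε → ℚ.½ ℚ.* ε ℚ.+ ℚ.½ ℚ.* ε ≡ ε
half+half ε = trans (sym (ℚ.*-distribʳ-+ ε ℚ.½ ℚ.½)) (ℚ.*-identityˡ ε)

_+ᴿ_ : ℝ → ℝ → ℝ
x +ᴿ y = record
  { approx = λ n → approx x n ℚ.+ approx y n
  ; cauchy = λ ε 0<ε →
      let (M , hx) = cauchy x (ℚ.½ ℚ.* ε) (half ε 0<ε)
          (N , hy) = cauchy y (ℚ.½ ℚ.* ε) (half ε 0<ε)
      in M ⊔ N , λ m n le le′ →
           subst (λ z → ℚ.∣ z ∣ ℚ.< ε) (rearrange (approx x m) (approx x n) (approx y m) (approx y n))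
             (ℚ.≤-<-trans (ℚ.∣p+q∣≤∣p∣+∣q∣ (approx x m ℚ.- approx x n) (approx y m ℚ.- approx y n))
               (subst (_ ℚ.<_) (half+half ε)
                 (ℚ.+-mono-< (hx m n (m⊔n≤o⇒m≤o M N le) (m⊔n≤o⇒m≤o M N le′))
                             (hy m n (m⊔n≤o⇒n≤o M N le) (m⊔n≤o⇒n≤o M N le′)))))
  }
  where
  rearrange : ∀ a b c d → (a ℚ.- b) ℚ.+ (c ℚ.- d) ≡ (a ℚ.+ c) ℚ.- (b ℚ.+ d)
  rearrange = let open +-*-Solver in
    solve 4 (λ a b c d → (a :- b) :+ (c :- d) := (a :+ c) :- (b :+ d)) refl

-ᴿ_ : ℝ → ℝ
-ᴿ x = record
  { approx = λ n → ℚ.- approx x n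
  ; cauchy = λ ε 0<ε →
      let (N , h) = cauchy x ε 0<ε
      in N , λ m n le le′ →
           subst (λ z → ℚ.∣ z ∣ ℚ.< ε) (rearrange (approx x m) (approx x n)) (h n m le′ le)
  }
  where
  rearrange : ∀ a b → b ℚ.- a ≡ ℚ.- a ℚ.- ℚ.- b
  rearrange = let open +-*-Solver in solve 2 (λ a b → b :- a := :- a :- :- b) refl

_-ᴿ_ : ℝ → ℝ → ℝ
x -ᴿ y = x +ᴿ (-ᴿ y)

∣_∣ᴿ : ℝ → ℝ
∣ x ∣ᴿ = record
  { approx = λ n → ℚ.∣ approx x n ∣
  ; cauchy = λ ε 0<ε →
      let (N , h) = cauchy x ε 0<ε
      in N , λ m n le le′ → ℚ.≤-<-trans (reverse-triangle (approx x m) (approx x n)) (h m n le le′)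
  }
  where
  one-sided : ∀ p q → ℚ.∣ p ∣ ℚ.- ℚ.∣ q ∣ ℚ.≤ ℚ.∣ p ℚ.- q ∣
  one-sided p q = subst (ℚ.∣ p ∣ ℚ.- ℚ.∣ q ∣ ℚ.≤_) (cancel ℚ.∣ p ℚ.- q ∣ ℚ.∣ q ∣)
    (ℚ.+-monoˡ-≤ (ℚ.- ℚ.∣ q ∣)
      (subst (λ z → ℚ.∣ z ∣ ℚ.≤ ℚ.∣ p ℚ.- q ∣ ℚ.+ ℚ.∣ q ∣) (split p q) (ℚ.∣p+q∣≤∣p∣+∣q∣ (p ℚ.- q) q)))
    where
    open +-*-Solver
    split : ∀ a b → (a ℚ.- b) ℚ.+ b ≡ a
    split = solve 2 (λ a b → (a :- b) :+ b := a) refl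
    cancel : ∀ a b → (a ℚ.+ b) ℚ.- b ≡ a
    cancel = solve 2 (λ a b → (a :+ b) :- b := a) refl
  flip-sign : ∀ p q → ℚ.- (p ℚ.- q) ≡ q ℚ.- p
  flip-sign = let open +-*-Solver in solve 2 (λ a b → :- (a :- b) := b :- a) refl
  reverse-triangle : ∀ p q → ℚ.∣ ℚ.∣ p ∣ ℚ.- ℚ.∣ q ∣ ∣ ℚ.≤ ℚ.∣ p ℚ.- q ∣
  reverse-triangle p q with ℚ.∣p∣≡p∨∣p∣≡-p (ℚ.∣ p ∣ ℚ.- ℚ.∣ q ∣)
  ... | inj₁ eq = subst (ℚ._≤ ℚ.∣ p ℚ.- q ∣) (sym eq) (one-sided p q)
  ... | inj₂ eq = subst₂ ℚ._≤_ (sym (trans eq (flip-sign ℚ.∣ p ∣ ℚ.∣ q ∣)))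
                    (trans (cong ℚ.∣_∣ (sym (flip-sign p q))) (ℚ.∣-p∣≡∣p∣ (p ℚ.- q)))
                    (one-sided q p)

_·_ : ℕ → ℝ → ℝ
c · x = record
  { approx = λ n → fromℕ c ℚ.* approx x n
  ; cauchy = λ ε 0<ε →
      let (N , h) = cauchy x (1/c+1 ℚ.* ε) (δ-pos ε 0<ε)
      in N , λ m n le le′ → subst (ℚ._< ε) (sym (scaled (approx x m) (approx x n)))
           (ℚ.≤-<-trans (ℚ.*-monoʳ-≤-nonNeg _ {{ℚ.∣-∣-nonNeg (approx x m ℚ.- approx x n)}} c≤c+1)
             (subst (_ ℚ.<_) (c+1·δ ε) (ℚ.*-monoʳ-<-pos (fromℕ (suc c)) {{c+1-pos}} (h m n le le′))))
  }
  where
  1/c+1 = + 1 ℚ./ suc c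
  instance
    1/c+1-pos : ℚ.Positive 1/c+1
    1/c+1-pos = ℚ.normalize-pos 1 (suc c)
  c+1-pos : ℚ.Positive (fromℕ (suc c))
  c+1-pos = ℚ.normalize-pos (suc c) 1
  δ-pos : ∀ ε → 0ℚ ℚ.< ε → 0ℚ ℚ.< 1/c+1 ℚ.* ε
  δ-pos ε 0<ε = subst (ℚ._< 1/c+1 ℚ.* ε) (ℚ.*-zeroʳ 1/c+1) (ℚ.*-monoʳ-<-pos 1/c+1 0<ε)
  c+1·δ : ∀ ε → fromℕ (suc c) ℚ.* (1/c+1 ℚ.* ε) ≡ ε
  c+1·δ ε = trans (sym (ℚ.*-assoc (fromℕ (suc c)) 1/c+1 ε))
           (trans (cong (ℚ._* ε) unit) (ℚ.*-identityˡ ε))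
    where
    unit : fromℕ (suc c) ℚ.* 1/c+1 ≡ 1ℚ
    unit = /-*-cancel 1 (suc c)
  c≤c+1 : fromℕ c ℚ.≤ fromℕ (suc c)
  c≤c+1 = /-≤ {c} {suc c} {1} {1} (*-monoˡ-≤ 1 (n≤1+n c))
  scaled : ∀ a b → ℚ.∣ fromℕ c ℚ.* a ℚ.- fromℕ c ℚ.* b ∣ ≡ fromℕ c ℚ.* ℚ.∣ a ℚ.- b ∣
  scaled a b = trans (cong ℚ.∣_∣ (factor (fromℕ c) a b))
    (trans (ℚ.∣p*q∣≡∣p∣*∣q∣ (fromℕ c) (a ℚ.- b))
      (cong (ℚ._* ℚ.∣ a ℚ.- b ∣) (ℚ.0≤p⇒∣p∣≡p (ℚ.nonNegative⁻¹ (fromℕ c) {{ℚ.normalize-nonNeg c 1}}))))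
    where
    factor : ∀ c a b → c ℚ.* a ℚ.- c ℚ.* b ≡ c ℚ.* (a ℚ.- b)
    factor = let open +-*-Solver in solve 3 (λ c a b → c :* a :- c :* b := c :* (a :- b)) refl

IsFloor : ℝ → ℤ → Set
IsFloor x z = fromℤ z ≤ᴿ x × x <ᴿ fromℤ z +ᴿ fromℚ 1ℚ

-- Basic sequences and Cantor series.  Sequences are indexed from 0, so
-- index n stands for position n + 1.

record BasicSequence : Set where
  field
    base   : ℕ → ℕ
    base≥2 : ∀ n → 2 ≤ base n

open BasicSequence public

-- ∏[ u from m , k ] = u m * u (m + 1) * ⋯ * u (m + k - 1)
∏[_from_,_] : (ℕ → ℕ) → ℕ → ℕ → ℕ
∏[ u from m , zero  ] = 1
∏[ u from m , suc k ] = ∏[ u from m , k ] * u (m + k)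

base-nonZero : ∀ Q n → NonZero (base Q n)
base-nonZero Q n = >-nonZero (≤-trans (s≤s z≤n) (base≥2 Q n))

∏-nonZero : ∀ Q m k → NonZero ∏[ base Q from m , k ]
∏-nonZero Q m zero    = _
∏-nonZero Q m (suc k) = m*n≢0 _ _ {{∏-nonZero Q m k}} {{base-nonZero Q (m + k)}}

-- a / (q_{m+1} ⋯ q_{m+k}), in the 1-based indexing
_over_from_,_ : ℕ → BasicSequence → ℕ → ℕ → ℚ
a over Q from m , k = (+ a ℚ./ ∏[ base Q from m , k ]) {{∏-nonZero Q m k}}

partialSum : BasicSequence → (ℕ → ℕ) → ℕ → ℚ
partialSum Q a = sumℚ (λ n → a n over Q from 0 , suc n)

module SeriesBounds (Q : BasicSequence) (a : ℕ → ℕ) (a<q : ∀ n → a n < base Q n) where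

  private
    1/Π : ℕ → ℚ
    1/Π n = 1 over Q from 0 , n

  step : ∀ n b → a n + b ≤ base Q n →
         partialSum Q a (suc n) ℚ.+ (b over Q from 0 , suc n) ℚ.≤ partialSum Q a n ℚ.+ 1/Π n
  step n b le = subst (ℚ._≤ partialSum Q a n ℚ.+ 1/Π n)
    (sym (trans (ℚ.+-assoc (partialSum Q a n) _ _)
                (cong (partialSum Q a n ℚ.+_) (/-+ (a n) b ∏[ base Q from 0 , suc n ] {{∏-nonZero Q 0 (suc n)}}))))
    (ℚ.+-monoʳ-≤ (partialSum Q a n)
      (/-≤ {a n + b} {1} {{∏-nonZero Q 0 (suc n)}} {{∏-nonZero Q 0 n}} bound))
    where
    bound : (a n + b) * ∏[ base Q from 0 , n ] ≤ 1 * (∏[ base Q from 0 , n ] * base Q n)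
    bound = ≤-trans (*-monoˡ-≤ ∏[ base Q from 0 , n ] le)
      (≤-reflexive (trans (*-comm (base Q n) _) (sym (*-identityˡ _))))

  over-nonNeg : ∀ b n → 0ℚ ℚ.≤ (b over Q from 0 , n)
  over-nonNeg b n = ℚ.nonNegative⁻¹ (b over Q from 0 , n)
    {{ℚ.normalize-nonNeg b ∏[ base Q from 0 , n ] {{∏-nonZero Q 0 n}}}}

  sum-mono′ : ∀ m d → partialSum Q a m ℚ.≤ partialSum Q a (d + m)
  sum-mono′ m zero    = ℚ.≤-refl
  sum-mono′ m (suc d) = ℚ.≤-trans (sum-mono′ m d)
    (p≤p+q (partialSum Q a (d + m)) (a (d + m) over Q from 0 , suc (d + m))
      (over-nonNeg (a (d + m)) (suc (d + m))))

  sum-mono : ∀ {m n} → m ≤ n → partialSum Q a m ℚ.≤ partialSum Q a n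
  sum-mono {m} {n} m≤n =
    subst (λ z → partialSum Q a m ℚ.≤ partialSum Q a z) (m∸n+n≡m m≤n) (sum-mono′ m (n ∸ m))

  upper-anti′ : ∀ m d → partialSum Q a (d + m) ℚ.+ 1/Π (d + m) ℚ.≤ partialSum Q a m ℚ.+ 1/Π m
  upper-anti′ m zero    = ℚ.≤-refl
  upper-anti′ m (suc d) = ℚ.≤-trans
    (step (d + m) 1 (subst (_≤ base Q (d + m)) (+-comm 1 (a (d + m))) (a<q (d + m))))
    (upper-anti′ m d)

  upper-anti : ∀ {m n} → m ≤ n → partialSum Q a n ℚ.+ 1/Π n ℚ.≤ partialSum Q a m ℚ.+ 1/Π m
  upper-anti {m} {n} m≤n =
    subst (λ z → partialSum Q a z ℚ.+ 1/Π z ℚ.≤ partialSum Q a m ℚ.+ 1/Π m) (m∸n+n≡m m≤n)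
          (upper-anti′ m (n ∸ m))

  sum≤upper : ∀ n → partialSum Q a n ℚ.≤ partialSum Q a n ℚ.+ 1/Π n
  sum≤upper n = p≤p+q (partialSum Q a n) (1/Π n) (over-nonNeg 1 n)

  n<∏ : ∀ n → n < ∏[ base Q from 0 , n ]
  n<∏ zero    = s≤s z≤n
  n<∏ (suc n) = ≤-trans (s≤s (n<∏ n)) (≤-trans
    (subst (suc Π ≤_) (trans (cong (_+_ Π) (sym (+-identityʳ Π))) (*-comm 2 Π))
      (+-monoˡ-≤ Π (≤-trans (s≤s z≤n) (n<∏ n))))
    (*-monoʳ-≤ Π (base≥2 Q n)))
    where Π = ∏[ base Q from 0 , n ]

  close : ∀ {m n} → m ≤ n → ℚ.∣ partialSum Q a n ℚ.- partialSum Q a m ∣ ℚ.≤ 1/Π m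
  close {m} {n} m≤n = subst (ℚ._≤ 1/Π m) (sym (ℚ.0≤p⇒∣p∣≡p lower)) upper
    where
    open +-*-Solver
    lower : 0ℚ ℚ.≤ partialSum Q a n ℚ.- partialSum Q a m
    lower = subst (ℚ._≤ partialSum Q a n ℚ.- partialSum Q a m) (ℚ.+-inverseʳ (partialSum Q a m))
                  (ℚ.+-monoˡ-≤ (ℚ.- partialSum Q a m) (sum-mono m≤n))
    cancel : ∀ s t → (s ℚ.+ t) ℚ.- s ≡ t
    cancel = solve 2 (λ s t → (s :+ t) :- s := t) refl
    upper : partialSum Q a n ℚ.- partialSum Q a m ℚ.≤ 1/Π m
    upper = subst (partialSum Q a n ℚ.- partialSum Q a m ℚ.≤_) (cancel (partialSum Q a m) (1/Π m))
      (ℚ.+-monoˡ-≤ (ℚ.- partialSum Q a m) (ℚ.≤-trans (sum≤upper n) (upper-anti m≤n)))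

  isCauchy : ∀ ε → 0ℚ ℚ.< ε → ∃[ N ] (∀ m n → N ≤ m → N ≤ n →
             ℚ.∣ partialSum Q a m ℚ.- partialSum Q a n ∣ ℚ.< ε)
  isCauchy ε 0<ε with archimedean ε 0<ε
  ... | N , 1/N<ε = N , go
    where
    small : ∀ {n} → N ≤ n → 1/Π n ℚ.< ε
    small {n} le = ℚ.≤-<-trans
      (/-≤ {1} {1} {∏[ base Q from 0 , n ]} {suc N} {{∏-nonZero Q 0 n}}
        (*-monoʳ-≤ 1 (≤-trans (s≤s le) (n<∏ n)))) 1/N<ε
    swap : ∀ p q → ℚ.∣ p ℚ.- q ∣ ≡ ℚ.∣ q ℚ.- p ∣
    swap p q = trans (sym (ℚ.∣-p∣≡∣p∣ (p ℚ.- q)))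
      (cong ℚ.∣_∣ (let open +-*-Solver in solve 2 (λ p q → :- (p :- q) := q :- p) refl p q))
    go : ∀ m n → N ≤ m → N ≤ n → ℚ.∣ partialSum Q a m ℚ.- partialSum Q a n ∣ ℚ.< ε
    go m n le le′ with ≤-total m n
    ... | inj₁ m≤n = subst (ℚ._< ε) (swap (partialSum Q a n) (partialSum Q a m))
                       (ℚ.≤-<-trans (close m≤n) (small le))
    ... | inj₂ n≤m = ℚ.≤-<-trans (close n≤m) (small le′)

series : (Q : BasicSequence) (a : ℕ → ℕ) → (∀ n → a n < base Q n) → ℝ
series Q a a<q = record { approx = partialSum Q a ; cauchy = SeriesBounds.isCauchy Q a a<q }

record Expansion (Q : BasicSequence) (x : ℝ) : Set where
  field
    intPart      : ℤ
    intPart-⌊⌋   : IsFloor x intPart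
    digit        : ℕ → ℕ
    digit<base   : ∀ n → digit n < base Q n
    infOften     : ∀ N → ∃[ n ] N ≤ n × digit n ≢ base Q n ∸ 1
    expands      : x ≃ fromℤ intPart +ᴿ series Q digit digit<base

open Expansion public

seriesExpansion : ∀ Q a (a<q : ∀ n → a n < base Q n) →
                  (∀ N → ∃[ n ] N ≤ n × a n ≢ base Q n ∸ 1) → Expansion Q (series Q a a<q)
seriesExpansion Q a a<q inf = record
  { intPart    = + 0
  ; intPart-⌊⌋ = (λ ε 0<ε → 0 , λ n _ → ℚ.≤-trans (sum-mono {0} {n} z≤n)
                    (p≤p+q (partialSum Q a n) ε (ℚ.<⇒≤ 0<ε)))
                , below-one (inf 0)
  ; digit      = a
  ; digit<base = a<q
  ; infOften   = inf
  ; expands    = λ ε 0<ε → 0 , λ n _ → subst (λ z → ℚ.∣ z ∣ ℚ.< ε)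
                    (sym (vanish (partialSum Q a n))) 0<ε
  }
  where
  open SeriesBounds Q a a<q
  vanish : ∀ s → s ℚ.- (0ℚ ℚ.+ s) ≡ 0ℚ
  vanish s = trans (cong (λ z → s ℚ.- z) (ℚ.+-identityˡ s)) (ℚ.+-inverseʳ s)
  below-one : (∃[ m ] 0 ≤ m × a m ≢ base Q m ∸ 1) →
              series Q a a<q <ᴿ fromℤ (+ 0) +ᴿ fromℚ 1ℚ
  below-one (m , _ , a≢) = δ , 0<δ , suc m , λ n le →
    subst (partialSum Q a n ℚ.+ δ ℚ.≤_) (sym (ℚ.+-identityˡ 1ℚ))
      (ℚ.≤-trans (ℚ.+-monoˡ-≤ δ (ℚ.≤-trans (sum≤upper n) (upper-anti le)))
        (subst (ℚ._≤ 1ℚ) (sym (trans (ℚ.+-assoc (partialSum Q a (suc m)) δ δ) (cong (partialSum Q a (suc m) ℚ.+_)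
                                       (/-+ 1 1 ∏[ base Q from 0 , suc m ] {{∏-nonZero Q 0 (suc m)}}))))
          (ℚ.≤-trans (step m 2 a+2≤q) (upper-anti {0} {m} z≤n))))
    where
    δ = 1 over Q from 0 , suc m
    0<δ : 0ℚ ℚ.< δ
    0<δ = ℚ.positive⁻¹ δ {{ℚ.normalize-pos 1 ∏[ base Q from 0 , suc m ] {{∏-nonZero Q 0 (suc m)}}}}
    a+2≤q : a m + 2 ≤ base Q m
    a+2≤q = subst (_≤ base Q m) (+-comm 2 (a m))
      (≤∧≢⇒< (a<q m) λ eq → a≢ (cong (_∸ 1) eq))

ψ : (P Q : BasicSequence) (x : ℝ) → Expansion P x → ℝ
ψ P Q x e = series Q (λ n → digit e n ⊓ (base Q n ∸ 1)) λ n →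
  ≤-<-trans (m⊓n≤n (digit e n) (base Q n ∸ 1))
            (subst (base Q n ∸ 1 <_) (m+[n∸m]≡n {1} (≤-trans (s≤s z≤n) (base≥2 Q n))) ≤-refl)

Diverges : (ℕ → ℚ) → Set
Diverges u = ∀ M → ∃[ N ] (∀ n → N ≤ n → M ℚ.≤ u n)

-- u n / v n → 1; that v n is eventually nonzero is part of the claim.
Ratio→1 : (ℕ → ℚ) → (ℕ → ℚ) → Set
Ratio→1 u v = ∀ ε → 0ℚ ℚ.< ε → ∃[ N ] (∀ n → N ≤ n →
  Σ[ v≢0 ∈ ℚ.NonZero (v n) ] ℚ.∣ (u n ℚ.÷ v n) {{v≢0}} ℚ.- 1ℚ ∣ ℚ.< ε)

InfiniteInLimit : BasicSequence → Set
InfiniteInLimit Q = Diverges (λ n → fromℕ (base Q n))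

-- Q_n^{(k)}
expected : BasicSequence → (k n : ℕ) → ℚ
expected Q k = sumℚ (λ j → 1 over Q from j , k)

FullyDivergent : BasicSequence → Set
FullyDivergent Q = ∀ k → 1 ≤ k → Diverges (expected Q k)

window : (ℕ → ℕ) → (k j : ℕ) → Vec ℕ k
window E k j = Vec.tabulate (λ t → E (j + toℕ t))

occurrences : ∀ {k} → Vec ℕ k → (ℕ → ℕ) → ℕ → ℕ
occurrences {k} B E n =
  List.length (List.filter (λ j → Vec.≡-dec _≟_ (window E k j) B) (List.upTo n))

N : BasicSequence → Pred ℝ 0ℓ
N Q x = Σ[ e ∈ Expansion Q x ] (∀ k → 1 ≤ k → (B : Vec ℕ k) →
  Ratio→1 (λ n → fromℕ (occurrences B (digit e) n)) (expected Q k))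

RN : BasicSequence → Pred ℝ 0ℓ
RN Q x = Σ[ e ∈ Expansion Q x ] (∀ k → 1 ≤ k → (B₁ B₂ : Vec ℕ k) →
  Ratio→1 (λ n → fromℕ (occurrences B₁ (digit e) n))
          (λ n → fromℕ (occurrences B₂ (digit e) n)))

FracIn[_,_⟩ : ℝ → ℝ → Pred ℝ 0ℓ
FracIn[ a , b ⟩ y = Σ[ z ∈ ℤ ] IsFloor y z × a ≤ᴿ y -ᴿ fromℤ z × y -ᴿ fromℤ z <ᴿ b

-- Membership of a real in an interval is not decidable, so the number of
-- n < m whose fractional part lies in [a , b) is not given by a
-- function; instead S ranges over the subsets of Fin m consisting of
-- exactly these n.  Classically there is one such S for each m.
UniformlyDistributedMod1 : (ℕ → ℝ) → Set
UniformlyDistributedMod1 u =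
  ∀ a b → fromℚ 0ℚ ≤ᴿ a → a <ᴿ b → b ≤ᴿ fromℚ 1ℚ →
  ∀ ε → 0ℚ ℚ.< ε → ∃[ M ] (∀ m → .{{_ : NonZero m}} → M ≤ m →
  (S : Subset m) → (∀ n → (n Subset.∈ S) ⇔ (u (toℕ n) ∈ FracIn[ a , b ⟩)) →
  ∣ fromℚ (+ Subset.∣ S ∣ ℚ./ m) -ᴿ (b -ᴿ a) ∣ᴿ <ᴿ fromℚ ε)

DN : BasicSequence → Pred ℝ 0ℓ
DN Q x = UniformlyDistributedMod1 (λ n → ∏[ base Q from 0 , n ] · x)

-- 2^b ν_b((j))
νNum : ℕ → ℕ → ℕ
νNum b j = if does (j <? b) then 1 else (if does (j ≟ b) then 2 ^ b ∸ b else 0)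

ν : ∀ {k} → ℕ → Vec ℕ k → ℚ
ν b []      = 1ℚ
ν b (j ∷ B) = (+ νNum b j ℚ./ 2 ^ b) {{m^n≢0 2 b}} ℚ.* ν b B

-- 2^{bk} ν_b(B), a natural number by copies-ν
copies : ∀ {k} → ℕ → Vec ℕ k → ℕ
copies b []      = 1
copies b (j ∷ B) = νNum b j * copies b B

copies-ν : ∀ {k} b (B : Vec ℕ k) → fromℕ (copies b B) ≡ fromℕ (2 ^ (b * k)) ℚ.* ν b B
copies-ν {k} b B = sym (trans (cong (fromℕ (2 ^ (b * k)) ℚ.*_) (ν-/ B))
  (/-*-cancel (copies b B) (2 ^ (b * k)) {{m^n≢0 2 (b * k)}}))
  where
  ν-/ : ∀ {k} (B : Vec ℕ k) → ν b B ≡ (+ copies b B ℚ./ 2 ^ (b * k)) {{m^n≢0 2 (b * k)}}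
  ν-/ []                = /-≡ {1} {1} {1} {2 ^ (b * 0)} {{_}} {{m^n≢0 2 (b * 0)}}
                            (cong (λ z → 1 * 2 ^ z) (*-zeroʳ b))
  ν-/ (_∷_ {n = k} j B) =
    trans (cong ((+ νNum b j ℚ./ 2 ^ b) {{m^n≢0 2 b}} ℚ.*_) (ν-/ B))
      (/-*-≡ (νNum b j) (copies b B) (2 ^ b) (2 ^ (b * k)) (2 ^ (b * suc k))
        {{m^n≢0 2 b}} {{m^n≢0 2 (b * k)}} {{m^n≢0 2 (b * suc k)}}
        (sym (trans (cong (2 ^_) (*-suc b k)) (^-distribˡ-+-* 2 b (b * k)))))

-- The blocks of length w over {0,…,b} in lexicographic order
words : (b w : ℕ) → List (Vec ℕ w)
words b zero    = [] ∷ []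
words b (suc w) = List.concatMap (λ d → List.map (d ∷_) (words b w)) (List.upTo (suc b))

V : (b w : ℕ) → List ℕ
V b w = List.concatMap (λ B → List.concat (List.replicate (copies b B) (Vec.toList B))) (words b w)

words-≤ : ∀ b w → All (VAll.All (_≤ b)) (words b w)
words-≤ b zero    = [] ∷ []
words-≤ b (suc w) = All.concat⁺ (All.map⁺ (All.map
  (λ d<1+b → All.map⁺ (All.map (s≤s⁻¹ d<1+b ∷_) (words-≤ b w))) (All.all-upTo (suc b))))

V-≤ : ∀ b w → All (_≤ b) (V b w)
V-≤ b w = All.concat⁺ (All.map⁺ (All.map
  (λ {B} h → All.concat⁺ (All.replicate⁺ (copies b B) (VAllP.toList⁺ h))) (words-≤ b w)))

V-nonEmpty : ∀ b w .{{_ : NonZero b}} .{{_ : NonZero w}} → V b w ≢ []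
V-nonEmpty b@(suc _) w@(suc _) V≡[] =
  contradiction (trans (cong copied (sym (copies-0 w)))
                  (trans (sym (cong (List.concatMap block) (proj₂ (words-head w)))) V≡[])) λ ()
  where
  block : ∀ {w} → Vec ℕ w → List ℕ
  block B = List.concat (List.replicate (copies b B) (Vec.toList B))
  words-head : ∀ w → ∃[ Bs ] words b w ≡ Vec.replicate w 0 ∷ Bs
  words-head zero    = [] , refl
  words-head (suc w) with words b w | words-head w
  ... | _ | _ , refl = _ , refl
  copies-0 : ∀ w → copies b (Vec.replicate w 0) ≡ 1
  copies-0 zero    = refl
  copies-0 (suc w) = trans (*-identityˡ _) (copies-0 w)
  copied : ℕ → List ℕ
  copied m = List.concat (List.replicate m (Vec.toList (Vec.replicate w 0))) ++
    List.concatMap block (proj₁ (words-head w))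

toList⁺ : ∀ {A : Set} (xs : List A) → xs ≢ [] → List⁺ A
toList⁺ []       ne = contradiction refl ne
toList⁺ (x ∷ xs) _  = x ∷ xs

toList-toList⁺ : ∀ {A : Set} (xs : List A) (ne : xs ≢ []) → List⁺.toList (toList⁺ xs ne) ≡ xs
toList-toList⁺ []       ne = contradiction refl ne
toList-toList⁺ (x ∷ xs) _  = refl

W : ∀ i .{{_ : NonZero i}} → List⁺ ℕ
W i = toList⁺ (V i (i ^ 2)) (V-nonEmpty i (i ^ 2) {{it}} {{m^n≢0 i 2}})

∣W∣ : ∀ i .{{_ : NonZero i}} → ℕ
∣W∣ i = List⁺.length (W i)

letter : ∀ i .{{_ : NonZero i}} → Fin (∣W∣ i) → ℕ
letter i = List.lookup (List⁺.toList (W i))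

letter≤ : ∀ i .{{_ : NonZero i}} t → letter i t ≤ i
letter≤ i t = All.lookup
  (subst (All (_≤ i)) (sym (toList-toList⁺ (V i (i ^ 2)) _)) (V-≤ i (i ^ 2)))
  (∈-lookup t)

-- l_i
reps : ℕ → ℕ
reps i = 2 ^ (4 * i ^ 2)

-- xs^m
power : ∀ {A : Set} (m : ℕ) → m ≢ 0 → List⁺ A → List⁺ A
power m m≢0 xs = List⁺.concat (List⁺.replicate m m≢0 xs)

concat∞ : ∀ {A : Set} → (ℕ → List⁺ A) → ℕ → A
concat∞ B = from (B 0) (B ∘ suc)
  where
  from : ∀ {A : Set} → List⁺ A → (ℕ → List⁺ A) → ℕ → A
  from (x ∷ _)      B zero    = x
  from (_ ∷ [])     B (suc n) = from (B 0) (B ∘ suc) n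
  from (_ ∷ y ∷ ys) B (suc n) = from (y ∷ ys) B n

-- A place (k , t) is the t-th position of W_i, where i = 6 + k.  The
-- digits E, the bases p and the bases q are all images of one sequence
-- of places, the concatenation of ((i,1) … (i,|W_i|))^{l_i} over i ≥ 6.
Place : Set
Place = Σ[ k ∈ ℕ ] Fin (∣W∣ (6 + k))

places : ℕ → List⁺ Place
places k = List⁺.map (k ,_) (List⁺.fromVec (Vec.allFin (∣W∣ (6 + k))))

place : ℕ → Place
place = concat∞ λ k → power (reps (6 + k)) (≢-nonZero⁻¹ _ {{m^n≢0 2 (4 * (6 + k) ^ 2)}}) (places k)

E : ℕ → ℕ
E n = let (k , t) = place n in letter (6 + k) t

P : BasicSequence
P = record
  { base   = λ n → 2 ^ (6 + proj₁ (place n))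
  ; base≥2 = λ n → ^-monoʳ-≤ 2 {1} {6 + proj₁ (place n)} (s≤s z≤n)
  }

2+i≤2^i : ∀ k → 2 + (6 + k) ≤ 2 ^ (6 + k)
2+i≤2^i zero    = m≤m+n 8 56
2+i≤2^i (suc k) = ≤-trans (+-mono-≤ {1} (>-nonZero⁻¹ _ {{m^n≢0 2 (6 + k)}}) (2+i≤2^i k))
  (≤-reflexive (cong (_+_ (2 ^ (6 + k))) (sym (+-identityʳ _))))

2+E≤p : ∀ n → 2 + E n ≤ base P n
2+E≤p n = let (k , t) = place n in
  ≤-trans (s≤s (s≤s (letter≤ (6 + k) t))) (2+i≤2^i k)

E<p : ∀ n → E n < base P n
E<p n = ≤-trans (n≤1+n _) (2+E≤p n)

ζ : ℝ
ζ = series P E E<p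

ζ-expansion : Expansion P ζ
ζ-expansion = seriesExpansion P E E<p λ n → n , ≤-refl , <⇒≢ (∸-monoˡ-≤ 1 (2+E≤p n))

-- A division into i classes of the t with w_{i,t} = i; the values of
-- class at other t are irrelevant.
record ClassDivision (i : ℕ) .{{_ : NonZero i}} : Set where
  field
    class      : Fin (∣W∣ i) → Fin i
    class-size : ∀ j →
      List.length (List.filter (λ t → (letter i t ≟ i) ×-dec (class t Fin.≟ j)) (List.allFin (∣W∣ i)))
      ≡ i * 2 ^ (i ^ 3) ∸ i ^ 2 * 2 ^ (i ^ 3 ∸ i)

open ClassDivision public

-- Fin i counts from 0, so suc j is the class numbered toℕ j + 2.
classBase : ∀ {i} → Fin i → ℕ
classBase {i} Fin.zero    = i ^ 3
classBase {i} (Fin.suc j) = i ^ 2 / suc (toℕ j)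

q : ∀ i .{{_ : NonZero i}} → ClassDivision i → Fin (∣W∣ i) → ℕ
q i c t = if does (letter i t <? i) then i else classBase (class c t)

classBase≥ : ∀ {i} (j : Fin i) → i ≤ classBase j
classBase≥ {i@(suc _)} Fin.zero    = m≤m*n i (i ^ 2) {{m^n≢0 i 2}}
classBase≥ {i@(suc _)} (Fin.suc j) = subst (_≤ i ^ 2 / suc (toℕ j)) i²/i≡i
  (/-monoʳ-≤ (i ^ 2) (s≤s (<⇒≤ (Fin.toℕ<n j))))
  where
  i²/i≡i : i ^ 2 / i ≡ i
  i²/i≡i = trans (cong (λ z → i * z / i) (*-identityʳ i)) (m*n/n≡m i i)

q≥i : ∀ i .{{_ : NonZero i}} c t → i ≤ q i c t
q≥i i c t with does (letter i t <? i)
... | true  = ≤-refl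
... | false = classBase≥ (class c t)

Q[_] : (∀ k → ClassDivision (6 + k)) → BasicSequence
Q[ c ] = record
  { base   = λ n → let (k , t) = place n in q (6 + k) (c k) t
  ; base≥2 = λ n → let (k , t) = place n in
      ≤-trans (s≤s (s≤s z≤n)) (q≥i (6 + k) (c k) t)
  }

{-# OPTIONS --safe #-}

-- ψ does not change the digits of ζ: in stage i all digits are at most i, and q > i wherever
-- the digit is i.  All three claims are then comparisons of sums over single copies of W_i,
-- since the l_i copies of stage i outweigh one copy of W_{i+1} by any factor 2^(iκ).
--
-- Ratio normality: read cyclically, the words of V_{i,i²} with multiplicities contain each block
-- of κ digits < i exactly i² 2^(i³-iκ) times, because the weights are invariant under rotation.
-- W_i differs from this only where one word is followed by a different one, at most (i+1)^(i²)
-- times, which is negligible.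
--
-- Not normal: the digit 0 has i² 2^(i³-i) occurrences in a copy of W_i, but 1/q ≥ i⁻³ contributes at
-- least i⁻¹ 2^(i³) to the expected number.
--
-- Equidistribution: almost all digits are i, and there the fractional part of q_1 ⋯ q_n x lies in
-- [j/i , (j+2)/i], where j runs through the i equally large classes.
module Submission where

open import Data.Bool.Base using (if_then_else_; true; false)
open import Data.Empty using (⊥)
open import Data.Fin.Base as Fin using (Fin; toℕ)
import Data.Fin.Properties as Fin
open import Data.Fin.Subset as Subset using (Subset; ∁; inside; outside)
import Data.Fin.Subset.Properties as Subset
open import Data.Integer.Base as ℤ using (+_)
import Data.Integer.Properties as ℤ
open import Data.List.Base as List using (List; []; _∷_; _++_)
open import Data.List.NonEmpty.Base as List⁺ using (List⁺; _∷_)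
import Data.List.Properties as List
open import Data.Nat.Base
open import Data.Nat.DivMod using (_/_; _%_; m≡m%n+[m/n]*n; m%n<n; m/n*n≤m; m/n≤m; m*n/n≡m; /-monoˡ-≤)
open import Data.Nat.ListAction using (sum)
open import Data.Nat.ListAction.Properties using (sum-++)
open import Data.Nat.Properties
open import Data.Nat.Tactic.RingSolver using (solve-∀)
open import Data.Product.Base using (Σ-syntax; ∃-syntax; _×_; _,_; proj₁; proj₂)
open import Data.Rational.Base as ℚ using (ℚ; 0ℚ; 1ℚ; mkℚ)
import Data.Rational.Properties as ℚ
open import Data.Rational.Solver using (module +-*-Solver)
import Data.Rational.Unnormalised.Base as ℚᵘ
import Data.Rational.Unnormalised.Properties as ℚᵘ
open import Data.Sum.Base using (_⊎_; inj₁; inj₂; [_,_]′)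
open import Data.Vec.Base as Vec using (Vec; []; _∷_)
import Data.Vec.Properties as Vec
open import Data.Vec.Relation.Unary.All as VAll using ([]; _∷_)
open import Defs
open import Function.Base using (_∘_; it)
open import Function.Bundles using (_⇔_; module Equivalence)
open import Relation.Binary.Definitions using (tri<; tri≈; tri>)
open import Relation.Binary.PropositionalEquality
open import Relation.Nullary using (Dec; yes; no; does; ¬_; contradiction)
open import Relation.Nullary.Decidable using (_×-dec_; dec-true; dec-false)
open import Relation.Unary using (_∈_; _∩_; _∖_)

-- Eventual properties, finite sums and growth

-- Limits are handled without division: `N * f ≤ suc N * g` eventually, for every `N`, expresses
-- limsup f/g ≤ 1, and two such statements give f/g → 1. An estimate is proved for one copy of W_i
-- and carried to all n; the cost is an initial segment and one unfinished copy, a constant multiple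
-- of |W_(i+1)| to be weighed against l_i |W_i|. As (i+1)³ - i³ is about 3i², the exponent 4i² of
-- l_i leaves i² for a factor 2^(iκ). Two obstacles come from the reals. Membership in N(Q) may be
-- witnessed by any expansion of the number, so its refutation requires that expansions be unique.
-- And neither the order of reals nor membership in [a , b) is decidable: the endpoints are known
-- only to within a few steps of a grid of mesh 1/D, and the orbit points in the interval are not
-- counted exactly. Integer tallies bound from above the points inside and the points outside, and
-- the second bound yields the lower estimate. All losses together amount to 11 grid steps.

Eventually : (ℕ → Set) → Set
Eventually P = ∃[ K ] (∀ k → K ≤ k → P k)

ev-map : ∀ {P Q : ℕ → Set} → (∀ k → P k → Q k) → Eventually P → Eventually Q
ev-map f (K , p) = K , λ k le → f k (p k le)

ev-map₂ : ∀ {P Q R : ℕ → Set} → (∀ k → P k → Q k → R k) →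
          Eventually P → Eventually Q → Eventually R
ev-map₂ f (K , p) (L , q) = K ⊔ L , λ k le →
  f k (p k (m⊔n≤o⇒m≤o K L le)) (q k (m⊔n≤o⇒n≤o K L le))

ev-≥ : ∀ n → Eventually (n ≤_)
ev-≥ n = n , λ _ le → le

ev-shift : ∀ {P : ℕ → Set} d → Eventually P → Eventually (λ k → P (d + k))
ev-shift d (K , p) = K , λ k le → p (d + k) (≤-trans le (m≤n+m k d))

ev-pred : ∀ {P : ℕ → Set} → Eventually (λ k → P (suc k)) → Eventually P
ev-pred {P} (K , p) = suc K , go
  where
  go : ∀ k → suc K ≤ k → P k
  go (suc k) (s≤s le) = p k le

𝟙 : ∀ {A : Set} → Dec A → ℕ
𝟙 d = if does d then 1 else 0

𝟙-yes : ∀ {A : Set} (d : Dec A) → A → 𝟙 d ≡ 1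
𝟙-yes (yes _) _ = refl
𝟙-yes (no ¬a) a = contradiction a ¬a

𝟙-no : ∀ {A : Set} (d : Dec A) → ¬ A → 𝟙 d ≡ 0
𝟙-no (yes a) ¬a = contradiction a ¬a
𝟙-no (no _)  _  = refl

𝟙≤1 : ∀ {A : Set} (d : Dec A) → 𝟙 d ≤ 1
𝟙≤1 (yes _) = ≤-refl
𝟙≤1 (no _)  = z≤n

sumℕ : (ℕ → ℕ) → ℕ → ℕ
sumℕ f zero    = 0
sumℕ f (suc n) = sumℕ f n + f n

sumℕ-cong : ∀ {f g : ℕ → ℕ} n → (∀ j → j < n → f j ≡ g j) → sumℕ f n ≡ sumℕ g n
sumℕ-cong zero    h = refl
sumℕ-cong (suc n) h = cong₂ _+_ (sumℕ-cong n (λ j j<n → h j (m<n⇒m<1+n j<n))) (h n ≤-refl)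

sumℕ-mono : ∀ {f g : ℕ → ℕ} n → (∀ j → j < n → f j ≤ g j) → sumℕ f n ≤ sumℕ g n
sumℕ-mono zero    h = z≤n
sumℕ-mono (suc n) h = +-mono-≤ (sumℕ-mono n (λ j j<n → h j (m<n⇒m<1+n j<n))) (h n ≤-refl)

sumℕ-+ : ∀ (f g : ℕ → ℕ) n → sumℕ (λ j → f j + g j) n ≡ sumℕ f n + sumℕ g n
sumℕ-+ f g zero    = refl
sumℕ-+ f g (suc n) = trans (cong (_+ (f n + g n)) (sumℕ-+ f g n))
  (shuffle (sumℕ f n) (sumℕ g n) (f n) (g n))
  where
  shuffle : ∀ a b c d → (a + b) + (c + d) ≡ (a + c) + (b + d)
  shuffle = solve-∀

sumℕ-* : ∀ c (f : ℕ → ℕ) n → sumℕ (λ j → c * f j) n ≡ c * sumℕ f n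
sumℕ-* c f zero    = sym (*-zeroʳ c)
sumℕ-* c f (suc n) = trans (cong (_+ c * f n) (sumℕ-* c f n)) (sym (*-distribˡ-+ c (sumℕ f n) (f n)))

sumℕ-const : ∀ c n → sumℕ (λ _ → c) n ≡ n * c
sumℕ-const c zero    = refl
sumℕ-const c (suc n) = trans (cong (_+ c) (sumℕ-const c n)) (+-comm (n * c) c)

sumℕ-0 : ∀ n → sumℕ (λ _ → 0) n ≡ 0
sumℕ-0 n = trans (sumℕ-const 0 n) (*-zeroʳ n)

sumℕ-swap : ∀ (f : ℕ → ℕ → ℕ) m n →
            sumℕ (λ i → sumℕ (f i) n) m ≡ sumℕ (λ j → sumℕ (λ i → f i j) m) n
sumℕ-swap f zero    n = sym (sumℕ-0 n)
sumℕ-swap f (suc m) n = trans (cong (_+ sumℕ (f m) n) (sumℕ-swap f m n))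
  (sym (sumℕ-+ (λ j → sumℕ (λ i → f i j) m) (f m) n))

sumℕ-++ : ∀ (f : ℕ → ℕ) n l → sumℕ f (n + l) ≡ sumℕ f n + sumℕ (λ t → f (n + t)) l
sumℕ-++ f n zero    = trans (cong (sumℕ f) (+-identityʳ n)) (sym (+-identityʳ (sumℕ f n)))
sumℕ-++ f n (suc l) = trans (cong (sumℕ f) (+-suc n l))
  (trans (cong (_+ f (n + l)) (sumℕ-++ f n l)) (+-assoc (sumℕ f n) _ _))

sumℕ-head : ∀ (f : ℕ → ℕ) n → sumℕ f (suc n) ≡ f 0 + sumℕ (f ∘ suc) n
sumℕ-head f n = sumℕ-++ f 1 n

sumℕ-monoʳ : ∀ (f : ℕ → ℕ) {m n} → m ≤ n → sumℕ f m ≤ sumℕ f n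
sumℕ-monoʳ f {m} {n} m≤n = subst (λ z → sumℕ f m ≤ sumℕ f z) (m+[n∸m]≡n m≤n)
  (≤-trans (m≤m+n _ _) (≤-reflexive (sym (sumℕ-++ f m (n ∸ m)))))

sumℕ-pick : ∀ (f : ℕ → ℕ) j n → j < n → sumℕ (λ d → f d * 𝟙 (d ≟ j)) n ≡ f j
sumℕ-pick f j (suc n) j<1+n with n ≟ j
... | yes refl = cong₂ _+_
  (trans (sumℕ-cong n λ d d<n → trans (cong (f d *_) (𝟙-no (d ≟ n) (<⇒≢ d<n))) (*-zeroʳ (f d)))
         (sumℕ-0 n)) (trans (cong (f n *_) (𝟙-yes (n ≟ n) refl)) (*-identityʳ (f n)))
... | no n≢j = trans (cong₂ _+_ (sumℕ-pick f j n (≤∧≢⇒< (s≤s⁻¹ j<1+n) (n≢j ∘ sym)))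
                         (trans (cong (f n *_) (𝟙-no (n ≟ j) n≢j)) (*-zeroʳ (f n))))
  (+-identityʳ (f j))

-- Growth: powers of 2 against the error terms.

n<2^n : ∀ n → n < 2 ^ n
n<2^n zero    = s≤s z≤n
n<2^n (suc n) = ≤-trans (+-mono-≤ (m^n>0 2 n) (n<2^n n))
  (≤-reflexive (cong (λ z → 2 ^ n + z) (sym (+-identityʳ (2 ^ n)))))

n≤2^n : ∀ n → n ≤ 2 ^ n
n≤2^n n = <⇒≤ (n<2^n n)

*-distrib-^ : ∀ a b n → (a * b) ^ n ≡ a ^ n * b ^ n
*-distrib-^ a b zero    = refl
*-distrib-^ a b (suc n) = trans (cong (a * b *_) (*-distrib-^ a b n)) (swap a b (a ^ n) (b ^ n))
  where
  swap : ∀ a b c d → a * b * (c * d) ≡ a * c * (b * d)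
  swap = solve-∀

2^-mono : ∀ {m n} → m ≤ n → 2 ^ m ≤ 2 ^ n
2^-mono = ^-monoʳ-≤ 2

2^-+ : ∀ m n → 2 ^ m * 2 ^ n ≡ 2 ^ (m + n)
2^-+ m n = sym (^-distribˡ-+-* 2 m n)

-- With h = ⌊i/(c+1)⌋ one has i ≤ (c+1) 2^h while 2^i ≥ 2^h (2^h)^c.
poly≤2^ : ∀ M c → Eventually (λ i → M * i ^ c ≤ 2 ^ i)
poly≤2^ M c = suc c * X , go
  where
  X = M * suc c ^ c
  go : ∀ i → suc c * X ≤ i → M * i ^ c ≤ 2 ^ i
  go i le = begin
    M * i ^ c                              ≤⟨ *-monoʳ-≤ M (^-monoˡ-≤ c i≤) ⟩
    M * (suc c * 2 ^ h) ^ c                ≡⟨ cong (M *_) (*-distrib-^ (suc c) (2 ^ h) c) ⟩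
    M * (suc c ^ c * (2 ^ h) ^ c)          ≡⟨ *-assoc M (suc c ^ c) ((2 ^ h) ^ c) ⟨
    X * (2 ^ h) ^ c                        ≤⟨ *-monoˡ-≤ ((2 ^ h) ^ c) X≤ ⟩
    2 ^ h * (2 ^ h) ^ c                    ≡⟨ ^-*-assoc 2 h (suc c) ⟩
    2 ^ (h * suc c)                        ≤⟨ 2^-mono h*≤i ⟩
    2 ^ i ∎
    where
    open ≤-Reasoning
    h = i / suc c
    h*≤i : h * suc c ≤ i
    h*≤i = ≤-trans (m≤n+m (h * suc c) _) (≤-reflexive (sym (m≡m%n+[m/n]*n i (suc c))))
    i< : i < suc h * suc c
    i< = subst (_< suc h * suc c) (sym (m≡m%n+[m/n]*n i (suc c)))
      (+-monoˡ-< (h * suc c) (m%n<n i (suc c)))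
    i≤ : i ≤ suc c * 2 ^ h
    i≤ = ≤-trans (<⇒≤ i<) (≤-trans (≤-reflexive (*-comm (suc h) (suc c))) (*-monoʳ-≤ (suc c) (n<2^n h)))
    X≤h : X ≤ h
    X≤h = s≤s⁻¹ (*-cancelʳ-< (suc c) X (suc h) (≤-<-trans (≤-trans (≤-reflexive (*-comm X (suc c))) le) i<))
    X≤ : X ≤ 2 ^ h
    X≤ = ≤-trans X≤h (n≤2^n h)

suc-suc≤2^ : Eventually (λ p → 2 + p ≤ 2 ^ p)
suc-suc≤2^ = ev-map₂ step (poly≤2^ 2 1) (ev-≥ 2)
  where
  step : ∀ p → 2 * p ^ 1 ≤ 2 ^ p → 2 ≤ p → 2 + p ≤ 2 ^ p
  step p h 2≤p = ≤-trans (≤-trans (+-monoˡ-≤ p 2≤p) (≤-reflexive (double p))) h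
    where
    double : ∀ p → p + p ≡ 2 * (p * 1)
    double = solve-∀

-- As i + 1 ≤ 2^(i-1), the left-hand side loses a factor 2^(i²) against the right.
words≪length : ∀ M k → Eventually (λ i →
  M * (2 ^ (i * k) * (i ^ 2 * suc i ^ (i ^ 2))) ≤ i ^ 2 * 2 ^ (i * i ^ 2))
words≪length M k = ev-pred (ev-map₂ step suc-suc≤2^ (ev-≥ (M + k)))
  where
  step : ∀ p → 2 + p ≤ 2 ^ p → M + k ≤ p → let i = suc p in
    M * (2 ^ (i * k) * (i ^ 2 * suc i ^ (i ^ 2))) ≤ i ^ 2 * 2 ^ (i * i ^ 2)
  step p 2+p≤ M+k≤p = begin
    M * (2 ^ (i * k) * (w * suc i ^ w))              ≤⟨ *-mono-≤ M≤ (*-monoʳ-≤ (2 ^ (i * k)) (*-monoʳ-≤ w (^-monoˡ-≤ w 2+p≤))) ⟩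
    2 ^ i * (2 ^ (i * k) * (w * (2 ^ p) ^ w))        ≡⟨ rearrange (2 ^ i) (2 ^ (i * k)) w ((2 ^ p) ^ w) ⟩
    w * (2 ^ i * 2 ^ (i * k) * (2 ^ p) ^ w)          ≡⟨ cong₂ (λ a b → w * (a * b)) (2^-+ i (i * k)) (^-*-assoc 2 p w) ⟩
    w * (2 ^ (i + i * k) * 2 ^ (p * w))              ≡⟨ cong (w *_) (2^-+ (i + i * k) (p * w)) ⟩
    w * 2 ^ (i + i * k + p * w)                      ≤⟨ *-monoʳ-≤ w (2^-mono exponent) ⟩
    w * 2 ^ (i * w) ∎
    where
    open ≤-Reasoning
    i = suc p
    w = i ^ 2
    M≤ : M ≤ 2 ^ i
    M≤ = ≤-trans (≤-trans (m≤m+n M k) (m≤n⇒m≤1+n M+k≤p)) (n≤2^n i)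
    rearrange : ∀ a b c d → a * (b * (c * d)) ≡ c * (a * b * d)
    rearrange = solve-∀
    exponent : i + i * k + p * w ≤ i * w
    exponent = +-monoˡ-≤ (p * w) (≤-trans (≤-reflexive (sym (*-suc i k)))
      (*-monoʳ-≤ i (≤-trans (s≤s (≤-trans (m≤n+m k M) M+k≤p)) (≤-reflexive (sym (*-identityʳ i))))))

-- This fixes the exponent in l_i = 2^(4i²): passing from |W_i| to |W_(i+1)| raises the exponent i³
-- by 3i² + 3i + 1, and of the 4i² supplied by l_i the remaining i² absorbs the linear terms, at
-- most i(k+7), once i ≥ k + 7.
length≪stage : ∀ M k → Eventually (λ i →
  M * (2 ^ (i * k) * (suc i ^ 2 * 2 ^ (suc i * suc i ^ 2))) ≤ 2 ^ (4 * i ^ 2) * (i ^ 2 * 2 ^ (i * i ^ 2)))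
length≪stage M k = ev-map step (ev-≥ (M + (k + 7)))
  where
  step : ∀ i → M + (k + 7) ≤ i →
    M * (2 ^ (i * k) * (suc i ^ 2 * 2 ^ (suc i * suc i ^ 2))) ≤ 2 ^ (4 * i ^ 2) * (i ^ 2 * 2 ^ (i * i ^ 2))
  step i le = begin
    M * (2 ^ (i * k) * (suc i ^ 2 * 2 ^ (suc i * suc i ^ 2)))
      ≤⟨ *-mono-≤ M≤ (*-monoʳ-≤ (2 ^ (i * k)) (*-monoˡ-≤ (2 ^ (suc i * suc i ^ 2)) square≤)) ⟩
    2 ^ i * (2 ^ (i * k) * (2 ^ 2 * i ^ 2 * 2 ^ (suc i * suc i ^ 2)))
      ≡⟨ rearrange (2 ^ i) (2 ^ (i * k)) (2 ^ 2) (i ^ 2) (2 ^ (suc i * suc i ^ 2)) ⟩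
    2 ^ i * 2 ^ (i * k) * 2 ^ 2 * 2 ^ (suc i * suc i ^ 2) * i ^ 2
      ≡⟨ cong (_* i ^ 2) powers ⟩
    2 ^ (i + i * k + 2 + suc i * suc i ^ 2) * i ^ 2
      ≤⟨ *-monoˡ-≤ (i ^ 2) (2^-mono exponent) ⟩
    2 ^ (4 * i ^ 2 + i * i ^ 2) * i ^ 2
      ≡⟨ cong (_* i ^ 2) (^-distribˡ-+-* 2 (4 * i ^ 2) (i * i ^ 2)) ⟩
    2 ^ (4 * i ^ 2) * 2 ^ (i * i ^ 2) * i ^ 2
      ≡⟨ last (2 ^ (4 * i ^ 2)) (2 ^ (i * i ^ 2)) (i ^ 2) ⟩
    2 ^ (4 * i ^ 2) * (i ^ 2 * 2 ^ (i * i ^ 2)) ∎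
    where
    open ≤-Reasoning
    M≤ : M ≤ 2 ^ i
    M≤ = ≤-trans (≤-trans (m≤m+n M (k + 7)) le) (n≤2^n i)
    k+7≤i : k + 7 ≤ i
    k+7≤i = ≤-trans (m≤n+m (k + 7) M) le
    1≤i : 1 ≤ i
    1≤i = ≤-trans (m≤n+m 1 (k + 6)) (≤-trans (≤-reflexive (+-assoc k 6 1)) k+7≤i)
    square≤ : suc i ^ 2 ≤ 2 ^ 2 * i ^ 2
    square≤ = ≤-trans (^-monoˡ-≤ 2 {suc i} {2 * i} (≤-trans (+-monoˡ-≤ i 1≤i) (≤-reflexive (cong (λ z → i + z) (sym (+-identityʳ i))))))
      (≤-reflexive (*-distrib-^ 2 i 2))
    rearrange : ∀ a b c d e → a * (b * (c * d * e)) ≡ a * b * c * e * d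
    rearrange = solve-∀
    last : ∀ a b c → a * b * c ≡ a * (c * b)
    last = solve-∀
    powers : 2 ^ i * 2 ^ (i * k) * 2 ^ 2 * 2 ^ (suc i * suc i ^ 2) ≡ 2 ^ (i + i * k + 2 + suc i * suc i ^ 2)
    powers = trans (cong (_* 2 ^ (suc i * suc i ^ 2))
        (trans (cong (_* 2 ^ 2) (2^-+ i (i * k))) (2^-+ (i + i * k) 2)))
      (2^-+ (i + i * k + 2) (suc i * suc i ^ 2))
    expand : ∀ i k → i + i * k + 2 + suc i * (suc i * (suc i * 1)) ≡
                     i * (k + 4) + 3 * 1 + (3 * (i * (i * 1)) + i * (i * (i * 1)))
    expand = solve-∀
    collect : ∀ i → i * i + (3 * (i * (i * 1)) + i * (i * (i * 1))) ≡ 4 * (i * (i * 1)) + i * (i * (i * 1))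
    collect = solve-∀
    seven : ∀ i k → i * (k + 4) + 3 * i ≡ i * (k + 7)
    seven = solve-∀
    exponent : i + i * k + 2 + suc i * suc i ^ 2 ≤ 4 * i ^ 2 + i * i ^ 2
    exponent = begin
      i + i * k + 2 + suc i * suc i ^ 2                ≡⟨ expand i k ⟩
      i * (k + 4) + 3 * 1 + (3 * i ^ 2 + i * i ^ 2)    ≤⟨ +-monoˡ-≤ _ (+-monoʳ-≤ (i * (k + 4)) (*-monoʳ-≤ 3 1≤i)) ⟩
      i * (k + 4) + 3 * i + (3 * i ^ 2 + i * i ^ 2)    ≡⟨ cong (_+ (3 * i ^ 2 + i * i ^ 2)) (seven i k) ⟩
      i * (k + 7) + (3 * i ^ 2 + i * i ^ 2)            ≤⟨ +-monoˡ-≤ _ (*-monoʳ-≤ i k+7≤i) ⟩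
      i * i + (3 * i ^ 2 + i * i ^ 2)                  ≡⟨ collect i ⟩
      4 * i ^ 2 + i * i ^ 2 ∎

-- Meant for products of bases over a window; the shift d allows for a window that runs on into
-- later stages.
poly≤length : ∀ M d c → Eventually (λ i → M * (i + d) ^ c ≤ i ^ 2 * 2 ^ (i * i ^ 2))
poly≤length M d c = ev-map step (ev-≥ (1 + (M + d + 2 * c)))
  where
  step : ∀ i → 1 + (M + d + 2 * c) ≤ i → M * (i + d) ^ c ≤ i ^ 2 * 2 ^ (i * i ^ 2)
  step i le = begin
    M * (i + d) ^ c            ≤⟨ *-mono-≤ M≤ (^-monoˡ-≤ c i+d≤) ⟩
    2 ^ i * (2 ^ (i * 2)) ^ c  ≡⟨ cong (2 ^ i *_) (^-*-assoc 2 (i * 2) c) ⟩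
    2 ^ i * 2 ^ (i * 2 * c)    ≡⟨ 2^-+ i (i * 2 * c) ⟩
    2 ^ (i + i * 2 * c)        ≤⟨ 2^-mono exponent ⟩
    2 ^ (i * i ^ 2)            ≤⟨ m≤n*m _ (i ^ 2) ⟩
    i ^ 2 * 2 ^ (i * i ^ 2) ∎
    where
    open ≤-Reasoning
    instance
      i≢0 : NonZero i
      i≢0 = >-nonZero (≤-trans (s≤s z≤n) le)
      i²≢0 : NonZero (i ^ 2)
      i²≢0 = m^n≢0 i 2
    M+d≤i : M + d ≤ i
    M+d≤i = ≤-trans (m≤m+n (M + d) (2 * c)) (≤-trans (n≤1+n _) le)
    M≤ : M ≤ 2 ^ i
    M≤ = ≤-trans (≤-trans (m≤m+n M d) M+d≤i) (n≤2^n i)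
    i+d≤ : i + d ≤ 2 ^ (i * 2)
    i+d≤ = ≤-trans (+-mono-≤ (n≤2^n i) (≤-trans (≤-trans (≤-trans (m≤n+m d M) M+d≤i) (n≤2^n i)) (m≤m+n _ 0)))
      (2^-mono {suc i} {i * 2} (≤-trans (+-monoˡ-≤ i (>-nonZero⁻¹ i)) (≤-reflexive (double i))))
      where
      double : ∀ i → i + i ≡ i * 2
      double = solve-∀
    exponent : i + i * 2 * c ≤ i * i ^ 2
    exponent = ≤-trans (≤-reflexive (factor i c)) (*-monoʳ-≤ i
      (≤-trans (≤-trans (s≤s (m≤n+m (2 * c) (M + d))) le) (≤-trans (m≤m*n i i) (≤-reflexive (cong (i *_) (sym (*-identityʳ i)))))))
      where
      factor : ∀ i c → i + i * 2 * c ≡ i * (1 + 2 * c)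
      factor = solve-∀

-- Stages and copies

module Copies (len rep : ℕ → ℕ) (len>0 : ∀ k → 0 < len k) (rep>0 : ∀ k → 0 < rep k) where

  stageStart : ℕ → ℕ
  stageStart = sumℕ (λ k → rep k * len k)

  -- `pos k (rep k)` is `stageStart (suc k)` by definition, so an induction over copies passes from
  -- one stage to the next without a conversion.
  pos : ℕ → ℕ → ℕ
  pos k m = stageStart k + m * len k

  copySum : (ℕ → ℕ) → ℕ → ℕ → ℕ
  copySum f k m = sumℕ (λ t → f (pos k m + t)) (len k)

  stageStart-mono : ∀ {j k} → j ≤ k → stageStart j ≤ stageStart k
  stageStart-mono = sumℕ-monoʳ _

  k≤stageStart : ∀ k → k ≤ stageStart k
  k≤stageStart zero    = z≤n
  k≤stageStart (suc k) = ≤-trans (≤-reflexive (+-comm 1 k))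
    (+-mono-≤ (k≤stageStart k) (*-mono-≤ (rep>0 k) (len>0 k)))

  pos-suc : ∀ k m → pos k (suc m) ≡ pos k m + len k
  pos-suc k m = trans (cong (λ z → stageStart k + z) (+-comm (len k) _)) (sym (+-assoc (stageStart k) _ _))

  pos≤stageStart : ∀ k {m} → m ≤ rep k → pos k m ≤ stageStart (suc k)
  pos≤stageStart k m≤ = +-monoʳ-≤ (stageStart k) (*-monoˡ-≤ (len k) m≤)

  sumℕ-pos : ∀ f k m → sumℕ f (pos k (suc m)) ≡ sumℕ f (pos k m) + copySum f k m
  sumℕ-pos f k m = trans (cong (sumℕ f) (pos-suc k m)) (sumℕ-++ f (pos k m) (len k))

  record Position (n : ℕ) : Set where
    constructor position
    field
      {stage copy offset} : ℕ
      copy<   : copy < rep stage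
      offset< : offset < len stage
      ≡pos    : n ≡ pos stage copy + offset

  open Position public

  -- An odometer: the offset overflows into the copy, and the copy into the stage.
  locate : ∀ n → Position n
  locate zero    = position (rep>0 0) (len>0 0) refl
  locate (suc n) with locate n
  ... | position {k} {m} {t} m< t< eq with suc t <? len k | suc m <? rep k
  ...   | yes t+1< | _        = position m< t+1< (trans (cong suc eq) (sym (+-suc (pos k m) t)))
  ...   | no  t+1≮ | yes m+1< = position {offset = 0} m+1< (len>0 k)
    (trans (trans (cong suc eq) (sym (+-suc (pos k m) t)))
      (trans (cong (λ z → pos k m + z) (≤-antisym t< (≮⇒≥ t+1≮)))
        (trans (sym (pos-suc k m)) (sym (+-identityʳ _)))))
  ...   | no  t+1≮ | no m+1≮  = position {stage = suc k} {copy = 0} {offset = 0} (rep>0 (suc k)) (len>0 (suc k))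
    (trans (trans (cong suc eq) (sym (+-suc (pos k m) t)))
      (trans (cong (λ z → pos k m + z) (≤-antisym t< (≮⇒≥ t+1≮)))
        (trans (sym (pos-suc k m))
          (trans (cong (pos k) (≤-antisym m< (≮⇒≥ m+1≮)))
            (sym (trans (+-identityʳ _) (+-identityʳ _)))))))

  pos<stageStart : ∀ {n} (p : Position n) → n < stageStart (suc (stage p))
  pos<stageStart {n} p = <-≤-trans
    (subst₂ _<_ (sym (≡pos p)) (sym (pos-suc (stage p) (copy p))) (+-monoʳ-< (pos (stage p) (copy p)) (offset< p)))
    (pos≤stageStart (stage p) (copy< p))

  stageStart≤ : ∀ {n} (p : Position n) → stageStart (stage p) ≤ n
  stageStart≤ p = subst (stageStart (stage p) ≤_) (sym (≡pos p)) (≤-trans (m≤m+n _ _) (m≤m+n _ _))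

  stage≥ : ∀ {n K} (p : Position n) → stageStart K ≤ n → K ≤ stage p
  stage≥ {n} {K} p h with K ≤? stage p
  ... | yes le = le
  ... | no  gt = contradiction (<-≤-trans (pos<stageStart p) (≤-trans (stageStart-mono (≰⇒> gt)) h)) (<-irrefl refl)

  stage< : ∀ {n k} (p : Position n) → n < stageStart k → stage p < k
  stage< {n} {k} p h with k ≤? stage p
  ... | yes le = contradiction (<-≤-trans h (≤-trans (stageStart-mono le) (stageStart≤ p))) (<-irrefl refl)
  ... | no  gt = ≰⇒> gt

  module _ (X : ℕ → Set) (K : ℕ) (base-case : X (stageStart K))
           (step : ∀ k m → K ≤ k → m < rep k → X (pos k m) → X (pos k (suc m))) where

    private
      within : ∀ k → K ≤ k → X (stageStart k) → ∀ m → m ≤ rep k → X (pos k m)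
      within k le x zero    _  = subst X (sym (+-identityʳ _)) x
      within k le x (suc m) m< = step k m le m< (within k le x m (<⇒≤ m<))

      at-start : ∀ d → X (stageStart (d + K))
      at-start zero    = base-case
      at-start (suc d) = within (d + K) (m≤n+m K d) (at-start d) (rep (d + K)) ≤-refl

    copies-induction : ∀ k m → K ≤ k → m ≤ rep k → X (pos k m)
    copies-induction k m le = within k le (subst (X ∘ stageStart) (m∸n+n≡m le) (at-start (k ∸ K))) m

  -- Three pieces: before stage K no comparison is available, so the sum of `f` is kept as a
  -- constant; complete copies are compared one at a time; each position of the unfinished copy
  -- costs at most c.
  sum-copies≤ : ∀ f g c K → (∀ n → f n ≤ c) →
    (∀ k m → K ≤ k → m < rep k → copySum f k m ≤ copySum g k m) →
    ∀ {n} (p : Position n) → K ≤ stage p →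
    sumℕ f n ≤ sumℕ f (stageStart K) + sumℕ g n + c * len (stage p)
  sum-copies≤ f g c K f≤c h {n} (position {k} {m} {t} m< t< eq) le =
    subst (λ n → sumℕ f n ≤ sumℕ f (stageStart K) + sumℕ g n + c * len k) (sym eq) (begin
      sumℕ f (pos k m + t)                                          ≡⟨ sumℕ-++ f (pos k m) t ⟩
      sumℕ f (pos k m) + sumℕ (λ j → f (pos k m + j)) t             ≤⟨ +-mono-≤ whole (sumℕ-mono t λ j _ → f≤c (pos k m + j)) ⟩
      sumℕ f (stageStart K) + sumℕ g (pos k m) + sumℕ (λ _ → c) t        ≤⟨ +-mono-≤ (+-monoʳ-≤ (sumℕ f (stageStart K)) (sumℕ-monoʳ g (m≤m+n (pos k m) t))) partial ⟩
      sumℕ f (stageStart K) + sumℕ g (pos k m + t) + c * len k ∎)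
    where
    open ≤-Reasoning
    partial : sumℕ (λ _ → c) t ≤ c * len k
    partial = ≤-trans (≤-reflexive (trans (sumℕ-const c t) (*-comm t c))) (*-monoʳ-≤ c (<⇒≤ t<))
    whole : sumℕ f (pos k m) ≤ sumℕ f (stageStart K) + sumℕ g (pos k m)
    whole = copies-induction (λ n → sumℕ f n ≤ sumℕ f (stageStart K) + sumℕ g n) K (m≤m+n _ _)
      (λ j l K≤j l< x → subst₂ _≤_ (sym (sumℕ-pos f j l))
        (trans (+-assoc (sumℕ f (stageStart K)) _ _) (cong (λ z → sumℕ f (stageStart K) + z) (sym (sumℕ-pos g j l))))
        (+-mono-≤ x (h j l K≤j l<))) k m le (<⇒≤ m<)

  copies≤sum : ∀ g k x → (∀ m → m < rep k → x ≤ copySum g k m) → rep k * x ≤ sumℕ g (stageStart (suc k))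
  copies≤sum g k x h = go (rep k) ≤-refl
    where
    go : ∀ m → m ≤ rep k → m * x ≤ sumℕ g (pos k m)
    go zero    _  = z≤n
    go (suc m) m< = ≤-trans (+-mono-≤ (h m m<) (go m (<⇒≤ m<)))
      (≤-reflexive (trans (+-comm (copySum g k m) _) (sym (sumℕ-pos g k m))))

  ev-stages : ∀ {P : ℕ → Set} → Eventually (λ k → ∀ {n} (p : Position n) → stage p ≡ k → P n) → Eventually P
  ev-stages (K , h) = stageStart K , λ n le → h (stage (locate n)) (stage≥ (locate n) le) (locate n) refl

  -- The initial segment and the unfinished copy contribute at most a constant multiple of `len k`,
  -- and by the growth hypothesis this is negligible against the sum of `g` over the stages before
  -- k.
  ≲-from-copies : ∀ f g c → (∀ n → f n ≤ c) →
    (∀ N → Eventually (λ k → ∀ m → m < rep k → N * copySum f k m ≤ suc N * copySum g k m)) →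
    (∀ M → Eventually (λ k → M * len (suc k) ≤ sumℕ g (stageStart (suc k)))) →
    ∀ N → Eventually (λ n → N * sumℕ f n ≤ suc N * sumℕ g n)
  ≲-from-copies f g c f≤c percopy growth N =
    -- Working with 2N splits the slack in two: the comparison of copies uses 2N + 1, the error
    -- terms one more sum of `g`, and 2N + 2 is twice N + 1.
    ev-stages (ev-map₂ conclude (ev-≥ K) (ev-pred (growth (2 * N * (C + c)))))
    where
    K = proj₁ (percopy (2 * N))
    C = sumℕ f (stageStart K)
    scaled : ∀ a (u : ℕ → ℕ) k m → copySum (λ n → a * u n) k m ≡ a * copySum u k m
    scaled a u k m = sumℕ-* a (λ t → u (pos k m + t)) (len k)
    conclude : ∀ k → K ≤ k → 2 * N * (C + c) * len k ≤ sumℕ g (stageStart k) →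
               ∀ {n} (p : Position n) → stage p ≡ k → N * sumℕ f n ≤ suc N * sumℕ g n
    conclude k K≤k grown {n} p refl = *-cancelˡ-≤ 2 (begin
      2 * (N * sumℕ f n)                                      ≡⟨ *-assoc 2 N (sumℕ f n) ⟨
      2 * N * sumℕ f n                                        ≡⟨ sumℕ-* (2 * N) f n ⟨
      sumℕ (λ j → 2 * N * f j) n
        ≤⟨ sum-copies≤ (λ j → 2 * N * f j) (λ j → suc (2 * N) * g j) (2 * N * c) K
             (λ j → *-monoʳ-≤ (2 * N) (f≤c j))
             (λ j m K≤j m< → subst₂ _≤_ (sym (scaled (2 * N) f j m)) (sym (scaled (suc (2 * N)) g j m))
               (proj₂ (percopy (2 * N)) j K≤j m m<))
             p K≤k ⟩
      sumℕ (λ j → 2 * N * f j) (stageStart K) + sumℕ (λ j → suc (2 * N) * g j) n + 2 * N * c * len k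
        ≡⟨ cong₂ (λ a b → a + b + 2 * N * c * len k) (sumℕ-* (2 * N) f (stageStart K)) (sumℕ-* (suc (2 * N)) g n) ⟩
      2 * N * C + suc (2 * N) * sumℕ g n + 2 * N * c * len k
        ≤⟨ +-monoˡ-≤ (2 * N * c * len k) (+-monoˡ-≤ (suc (2 * N) * sumℕ g n) (m≤m*n (2 * N * C) (len k) {{>-nonZero (len>0 k)}})) ⟩
      2 * N * C * len k + suc (2 * N) * sumℕ g n + 2 * N * c * len k
        ≡⟨ collect N C c (len k) (sumℕ g n) ⟩
      2 * N * (C + c) * len k + suc (2 * N) * sumℕ g n
        ≤⟨ +-monoˡ-≤ (suc (2 * N) * sumℕ g n) (≤-trans grown (sumℕ-monoʳ g (stageStart≤ p))) ⟩
      sumℕ g n + suc (2 * N) * sumℕ g n                       ≡⟨ double N (sumℕ g n) ⟩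
      2 * (suc N * sumℕ g n) ∎)
      where
      open ≤-Reasoning
      collect : ∀ N C c l s → 2 * N * C * l + suc (2 * N) * s + 2 * N * c * l ≡ 2 * N * (C + c) * l + suc (2 * N) * s
      collect = solve-∀
      double : ∀ N s → s + suc (2 * N) * s ≡ 2 * (suc N * s)
      double = solve-∀

-- Streams

infixr 5 _++ˢ_

-- A word together with what follows it, so that an occurrence of a block may begin in the word and
-- run past its end.
_++ˢ_ : ∀ {A : Set} → List A → (ℕ → A) → ℕ → A
([]       ++ˢ s) n       = s n
((x ∷ xs) ++ˢ s) zero    = x
((x ∷ xs) ++ˢ s) (suc n) = (xs ++ˢ s) n

++ˢ-cong : ∀ {A : Set} (xs : List A) {s s′ : ℕ → A} → s ≗ s′ → xs ++ˢ s ≗ xs ++ˢ s′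
++ˢ-cong []       eq n       = eq n
++ˢ-cong (x ∷ xs) eq zero    = refl
++ˢ-cong (x ∷ xs) eq (suc n) = ++ˢ-cong xs eq n

++ˢ-assoc : ∀ {A : Set} (xs ys : List A) (s : ℕ → A) → (xs ++ ys) ++ˢ s ≗ xs ++ˢ ys ++ˢ s
++ˢ-assoc []       ys s n       = refl
++ˢ-assoc (x ∷ xs) ys s zero    = refl
++ˢ-assoc (x ∷ xs) ys s (suc n) = ++ˢ-assoc xs ys s n

++ˢ-drop : ∀ {A : Set} (xs : List A) (s : ℕ → A) n → (xs ++ˢ s) (List.length xs + n) ≡ s n
++ˢ-drop []       s n = refl
++ˢ-drop (x ∷ xs) s n = ++ˢ-drop xs s n

++ˢ-local : ∀ {A : Set} (xs : List A) (s s′ : ℕ → A) n → n < List.length xs → (xs ++ˢ s) n ≡ (xs ++ˢ s′) n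
++ˢ-local (x ∷ xs) s s′ zero    _        = refl
++ˢ-local (x ∷ xs) s s′ (suc n) (s≤s lt) = ++ˢ-local xs s s′ n lt

≗-++ˢ : ∀ {A : Set} (xs : List A) (s : ℕ → A) → (∀ t → s (toℕ t) ≡ List.lookup xs t) →
        s ≗ xs ++ˢ (λ n → s (List.length xs + n))
≗-++ˢ []       s h n       = refl
≗-++ˢ (x ∷ xs) s h zero    = h Fin.zero
≗-++ˢ (x ∷ xs) s h (suc n) = ≗-++ˢ xs (s ∘ suc) (h ∘ Fin.suc) n

toList-++ˢ-map : ∀ {A B : Set} (f : A → B) {n} (v : Vec A n) (s : ℕ → B) t →
                 (List.map f (Vec.toList v) ++ˢ s) (toℕ t) ≡ f (Vec.lookup v t)
toList-++ˢ-map f (x ∷ v) s Fin.zero    = refl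
toList-++ˢ-map f (x ∷ v) s (Fin.suc t) = toList-++ˢ-map f v s t

infixr 5 _◂_

_◂_ : ∀ {A : Set} → A → (ℕ → A) → ℕ → A
(x ◂ s) zero    = x
(x ◂ s) (suc n) = s n

-- `concat∞` recurses through a local helper on the unread rest of the current list. Prepending `xs`
-- to the family makes that rest arbitrary, as the induction requires.
concat∞-◂ : ∀ {A : Set} (xs : List⁺ A) (B : ℕ → List⁺ A) →
            concat∞ (xs ◂ B) ≗ List⁺.toList xs ++ˢ concat∞ B
concat∞-◂ (x ∷ [])     B zero    = refl
concat∞-◂ (x ∷ [])     B (suc n) = refl
concat∞-◂ (x ∷ y ∷ ys) B zero    = refl
concat∞-◂ (x ∷ y ∷ ys) B (suc n) = concat∞-◂ (y ∷ ys) B n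

concat∞-++ˢ : ∀ {A : Set} (B : ℕ → List⁺ A) →
              concat∞ B ≗ List⁺.toList (B 0) ++ˢ concat∞ (B ∘ suc)
concat∞-++ˢ B = concat∞-◂ (B 0) (B ∘ suc)

concat∞-drop : ∀ {A : Set} (B : ℕ → List⁺ A) k n →
               concat∞ B (sumℕ (λ j → List⁺.length (B j)) k + n) ≡ concat∞ (λ j → B (k + j)) n
concat∞-drop B zero    n = refl
concat∞-drop B (suc k) n = begin
  concat∞ B (sumℕ (λ j → List⁺.length (B j)) (suc k) + n)
    ≡⟨ cong (λ z → concat∞ B (z + n)) (sumℕ-head (λ j → List⁺.length (B j)) k) ⟩
  concat∞ B (List⁺.length (B 0) + sumℕ (λ j → List⁺.length (B (suc j))) k + n)
    ≡⟨ cong (concat∞ B) (+-assoc (List⁺.length (B 0)) _ n) ⟩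
  concat∞ B (List⁺.length (B 0) + (sumℕ (λ j → List⁺.length (B (suc j))) k + n))
    ≡⟨ concat∞-++ˢ B (List⁺.length (B 0) + (sumℕ (λ j → List⁺.length (B (suc j))) k + n)) ⟩
  (List⁺.toList (B 0) ++ˢ concat∞ (B ∘ suc)) (List⁺.length (B 0) + (sumℕ (λ j → List⁺.length (B (suc j))) k + n))
    ≡⟨ ++ˢ-drop (List⁺.toList (B 0)) (concat∞ (B ∘ suc)) _ ⟩
  concat∞ (B ∘ suc) (sumℕ (λ j → List⁺.length (B (suc j))) k + n)
    ≡⟨ concat∞-drop (B ∘ suc) k n ⟩
  concat∞ (λ j → B (suc (k + j))) n ∎
  where open ≡-Reasoning

repeat : ∀ {A : Set} → ℕ → List A → List A
repeat m xs = List.concat (List.replicate m xs)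

length-repeat : ∀ {A : Set} m (xs : List A) → List.length (repeat m xs) ≡ m * List.length xs
length-repeat zero    xs = refl
length-repeat (suc m) xs = trans (List.length-++ xs) (cong (λ z → List.length xs + z) (length-repeat m xs))

repeat-++ˢ : ∀ {A : Set} m (xs : List A) (s : ℕ → A) j n → j < m → n < List.length xs →
             (repeat m xs ++ˢ s) (j * List.length xs + n) ≡ (xs ++ˢ s) n
repeat-++ˢ (suc m) xs s zero n _ n< = trans (++ˢ-assoc xs (repeat m xs) s n) (++ˢ-local xs _ _ n n<)
repeat-++ˢ (suc m) xs s (suc j) n (s≤s j<) n< =
  trans (cong (repeat (suc m) xs ++ˢ s) (+-assoc (List.length xs) _ n))
  (trans (++ˢ-assoc xs (repeat m xs) s _)
  (trans (++ˢ-drop xs (repeat m xs ++ˢ s) _) (repeat-++ˢ m xs s j n j< n<)))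

toList-power : ∀ {A : Set} m (m≢0 : m ≢ 0) (xs : List⁺ A) →
               List⁺.toList (power m m≢0 xs) ≡ repeat m (List⁺.toList xs)
toList-power zero    m≢0 xs with () ← m≢0 refl
toList-power (suc m) m≢0 xs = cong (λ z → List⁺.toList xs ++ List.concat z) (List.map-replicate List⁺.toList m xs)

length-power : ∀ {A : Set} m (m≢0 : m ≢ 0) (xs : List⁺ A) →
               List⁺.length (power m m≢0 xs) ≡ m * List⁺.length xs
length-power m m≢0 xs = trans (cong List.length (toList-power m m≢0 xs)) (length-repeat m (List⁺.toList xs))

-- The sequence of places, by stages i = 6 + k.

opaque
  len : ℕ → ℕ
  len k = ∣W∣ (6 + k)

  len≡∣W∣ : ∀ k → len k ≡ ∣W∣ (6 + k)
  len≡∣W∣ k = refl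

  len>0 : ∀ k → 0 < len k
  len>0 k = z<s

rep : ℕ → ℕ
rep k = reps (6 + k)

open Copies len rep len>0 (λ k → m^n>0 2 (4 * (6 + k) ^ 2))

length-map-fromVec : ∀ {A B : Set} (f : A → B) {n} (v : Vec A (suc n)) →
                     List⁺.length (List⁺.map f (List⁺.fromVec v)) ≡ suc n
length-map-fromVec f (x ∷ v) = cong suc (trans (List.length-map f (Vec.toList v)) (Vec.length-toList v))

length-places : ∀ k → List⁺.length (places k) ≡ len k
length-places k = trans (length-map-fromVec {B = Place} (k ,_) (Vec.allFin (∣W∣ (6 + k)))) (sym (len≡∣W∣ k))

toList-map-fromVec : ∀ {A B : Set} (f : A → B) {n} (v : Vec A (suc n)) →
                     List⁺.toList (List⁺.map f (List⁺.fromVec v)) ≡ List.map f (Vec.toList v)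
toList-map-fromVec f (x ∷ v) = refl

-- The continuation `s` stays unspecified: n lies inside the list, so the value does not depend on
-- it.
concat∞-power : ∀ {A : Set} (B : ℕ → List⁺ A) (r : ℕ → ℕ) (r≢0 : ∀ k → r k ≢ 0) k m n →
                m < r k → n < List⁺.length (B k) → ∃[ s ]
                concat∞ (λ j → power (r j) (r≢0 j) (B j))
                  (sumℕ (λ j → r j * List⁺.length (B j)) k + m * List⁺.length (B k) + n) ≡
                (List⁺.toList (B k) ++ˢ s) n
concat∞-power B r r≢0 k m n m< n< = rest , (begin
  concat∞ stageList (sumℕ (λ j → r j * List⁺.length (B j)) k + m * List⁺.length (B k) + n)
    ≡⟨ cong (concat∞ stageList) (+-assoc (sumℕ (λ j → r j * List⁺.length (B j)) k) _ _) ⟩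
  concat∞ stageList (sumℕ (λ j → r j * List⁺.length (B j)) k + p)
    ≡⟨ cong (λ z → concat∞ stageList (z + p)) (sumℕ-cong k λ j _ → sym (length-power (r j) (r≢0 j) (B j))) ⟩
  concat∞ stageList (sumℕ (λ j → List⁺.length (stageList j)) k + p)
    ≡⟨ concat∞-drop stageList k p ⟩
  concat∞ (λ j → stageList (k + j)) p
    ≡⟨ concat∞-++ˢ (λ j → stageList (k + j)) p ⟩
  (List⁺.toList (stageList (k + 0)) ++ˢ rest) p
    ≡⟨ cong (λ z → (List⁺.toList (stageList z) ++ˢ rest) p) (+-identityʳ k) ⟩
  (List⁺.toList (stageList k) ++ˢ rest) p
    ≡⟨ cong (λ z → (z ++ˢ rest) p) (toList-power (r k) (r≢0 k) (B k)) ⟩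
  (repeat (r k) (List⁺.toList (B k)) ++ˢ rest) p
    ≡⟨ repeat-++ˢ (r k) (List⁺.toList (B k)) rest m n m< n< ⟩
  (List⁺.toList (B k) ++ˢ rest) n ∎)
  where
  open ≡-Reasoning
  stageList = λ j → power (r j) (r≢0 j) (B j)
  p = m * List⁺.length (B k) + n
  rest = concat∞ (λ j → stageList (k + suc j))

stageList : ℕ → List⁺ Place
stageList k = power (reps (6 + k)) (≢-nonZero⁻¹ _ {{m^n≢0 2 (4 * (6 + k) ^ 2)}}) (places k)

place≡ : place ≡ concat∞ stageList
place≡ = refl

-- Opaque, since unfolding place at 6 + k expands the words W_i.
opaque
  placeAt : ℕ → Place
  placeAt = place

  placeAt≡ : ∀ n → placeAt n ≡ place n
  placeAt≡ n = refl

opaque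
  unfolding placeAt

  -- The bridge between the infinite concatenation and the arithmetic of `pos`; digits, bases and
  -- tallies are all read off through it.
  placeAt-pos : ∀ k m (t : Fin (∣W∣ (6 + k))) → m < rep k → placeAt (pos k m + toℕ t) ≡ (k , t)
  placeAt-pos k m t m< = begin
    place (pos k m + toℕ t)                      ≡⟨ cong-app place≡ (pos k m + toℕ t) ⟩
    concat∞ stageList (pos k m + toℕ t)              ≡⟨ cong (concat∞ stageList) position≡ ⟩
    concat∞ stageList p                              ≡⟨ proj₂ found ⟩
    (List⁺.toList (places k) ++ˢ proj₁ found) (toℕ t)
      ≡⟨ cong (λ xs → (xs ++ˢ proj₁ found) (toℕ t)) (toList-map-fromVec {B = Place} (k ,_) (Vec.allFin (∣W∣ (6 + k)))) ⟩
    (List.map (k ,_) (Vec.toList (Vec.allFin (∣W∣ (6 + k)))) ++ˢ proj₁ found) (toℕ t)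
      ≡⟨ toList-++ˢ-map {B = Place} (k ,_) (Vec.allFin (∣W∣ (6 + k))) (proj₁ found) t ⟩
    (k , Vec.lookup (Vec.allFin (∣W∣ (6 + k))) t)      ≡⟨ cong {B = Place} (k ,_) (Vec.lookup-allFin t) ⟩
    (k , t) ∎
    where
    open ≡-Reasoning
    p : ℕ
    p = sumℕ (λ j → reps (6 + j) * List⁺.length (places j)) k + m * List⁺.length (places k) + toℕ t
    found : ∃[ s ] concat∞ stageList p ≡ (List⁺.toList (places k) ++ˢ s) (toℕ t)
    found = concat∞-power places (λ j → reps (6 + j)) (λ j → ≢-nonZero⁻¹ _ {{m^n≢0 2 (4 * (6 + j) ^ 2)}}) k m (toℕ t) m<
      (subst (toℕ t <_) (sym (trans (length-places k) (len≡∣W∣ k))) (Fin.toℕ<n t))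
    position≡ : pos k m + toℕ t ≡ p
    position≡ = cong₂ (λ a b → a + m * b + toℕ t)
      (sumℕ-cong k λ j _ → cong (rep j *_) (sym (length-places j))) (sym (length-places k))

opaque
  letterAt : Place → ℕ
  letterAt (k , t) = letter (6 + k) t

  letterAt≡ : ∀ k t → letterAt (k , t) ≡ letter (6 + k) t
  letterAt≡ k t = refl

digits : ℕ → ℕ
digits n = letterAt (placeAt n)

opaque
  unfolding letterAt

  digits≡E : ∀ n → digits n ≡ E n
  digits≡E n = cong letterAt (placeAt≡ n)

-- Occurrences of a block in V b w

-- The indicator of an occurrence, written as a product so that weighted sums over words factor
-- letter by letter.
match : ∀ {k} → Vec ℕ k → (ℕ → ℕ) → ℕ
match []      s = 1
match (b ∷ B) s = 𝟙 (s 0 ≟ b) * match B (s ∘ suc)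

match-cong : ∀ {k} (B : Vec ℕ k) {s s′ : ℕ → ℕ} → s ≗ s′ → match B s ≡ match B s′
match-cong []      eq = refl
match-cong (b ∷ B) eq = cong₂ _*_ (cong (λ z → 𝟙 (z ≟ b)) (eq 0)) (match-cong B (eq ∘ suc))

match≤1 : ∀ {k} (B : Vec ℕ k) s → match B s ≤ 1
match≤1 []      s = ≤-refl
match≤1 (b ∷ B) s = *-mono-≤ (𝟙≤1 (s 0 ≟ b)) (match≤1 B (s ∘ suc))

match-local : ∀ {k} (B : Vec ℕ k) (xs : List ℕ) (s s′ : ℕ → ℕ) → k ≤ List.length xs →
              match B (xs ++ˢ s) ≡ match B (xs ++ˢ s′)
match-local []      xs       s s′ _        = refl
match-local (b ∷ B) (x ∷ xs) s s′ (s≤s le) = cong (𝟙 (x ≟ b) *_) (match-local B xs s s′ le)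

-- An occurrence belongs to the letter at which it begins; `s` supplies the letters beyond the end
-- of the word.
count : ∀ {k} → Vec ℕ k → List ℕ → (ℕ → ℕ) → ℕ
count B []       s = 0
count B (x ∷ xs) s = match B ((x ∷ xs) ++ˢ s) + count B xs s

count-cong : ∀ {k} (B : Vec ℕ k) xs {s s′ : ℕ → ℕ} → s ≗ s′ → count B xs s ≡ count B xs s′
count-cong B []       eq = refl
count-cong B (x ∷ xs) eq = cong₂ _+_ (match-cong B (++ˢ-cong (x ∷ xs) eq)) (count-cong B xs eq)

count≤length : ∀ {k} (B : Vec ℕ k) xs s → count B xs s ≤ List.length xs
count≤length B []       s = z≤n
count≤length B (x ∷ xs) s = +-mono-≤ (match≤1 B ((x ∷ xs) ++ˢ s)) (count≤length B xs s)

count-++ : ∀ {k} (B : Vec ℕ k) xs ys s → count B (xs ++ ys) s ≡ count B xs (ys ++ˢ s) + count B ys s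
count-++ B []       ys s = refl
count-++ B (x ∷ xs) ys s = trans
  (cong₂ _+_ (match-cong B (++ˢ-assoc (x ∷ xs) ys s)) (count-++ B xs ys s))
  (sym (+-assoc (match B ((x ∷ xs) ++ˢ ys ++ˢ s)) _ _))

count-local : ∀ {k} (B : Vec ℕ k) xs ys s s′ → k ≤ List.length ys →
              count B xs (ys ++ˢ s) ≡ count B xs (ys ++ˢ s′)
count-local B []       ys s s′ le = refl
count-local B (x ∷ xs) ys s s′ le = cong₂ _+_
  (begin
    match B ((x ∷ xs) ++ˢ ys ++ˢ s)   ≡⟨ match-cong B (++ˢ-assoc (x ∷ xs) ys s) ⟨
    match B ((x ∷ xs ++ ys) ++ˢ s)    ≡⟨ match-local B (x ∷ xs ++ ys) s s′ (≤-trans le length≥) ⟩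
    match B ((x ∷ xs ++ ys) ++ˢ s′)   ≡⟨ match-cong B (++ˢ-assoc (x ∷ xs) ys s′) ⟩
    match B ((x ∷ xs) ++ˢ ys ++ˢ s′) ∎)
  (count-local B xs ys s s′ le)
  where
  open ≡-Reasoning
  length≥ : List.length ys ≤ List.length (x ∷ xs ++ ys)
  length≥ = ≤-trans (m≤n+m _ (List.length (x ∷ xs))) (≤-reflexive (sym (List.length-++ (x ∷ xs))))

-- The number of occurrences of B in the periodic word xs xs xs ⋯, per period.
cyclicCount : ∀ {k} → Vec ℕ k → List ℕ → ℕ
cyclicCount B xs = count B xs (xs ++ˢ λ _ → 0)

-- Every copy except the last is followed by another copy of `xs` and so contributes exactly the
-- cyclic count. For the last one both counts lie between 0 and the length of `xs`.
count-repeat : ∀ {k} (B : Vec ℕ k) m xs s → k ≤ List.length xs →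
  count B (repeat m xs) s ≤ m * cyclicCount B xs + List.length xs ×
  m * cyclicCount B xs ≤ count B (repeat m xs) s + List.length xs
count-repeat B zero          xs s le = z≤n , z≤n
count-repeat B (suc zero)    xs s le =
  ≤-trans (≤-reflexive (cong (λ ys → count B ys s) (List.++-identityʳ xs)))
    (≤-trans (count≤length B xs s) (m≤n+m _ _)) ,
  ≤-trans (≤-reflexive (+-identityʳ _)) (≤-trans (count≤length B xs _) (m≤n+m _ _))
count-repeat B (suc (suc m)) xs s le =
  let (upper , lower) = count-repeat B (suc m) xs s le in
  ≤-trans (≤-reflexive split) (≤-trans (+-monoʳ-≤ c upper) (≤-reflexive (sym (+-assoc c _ _)))) ,
  ≤-trans (+-monoʳ-≤ c lower) (≤-reflexive (trans (sym (+-assoc c _ _)) (cong (_+ List.length xs) (sym split))))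
  where
  c = cyclicCount B xs
  split : count B (repeat (suc (suc m)) xs) s ≡ c + count B (repeat (suc m) xs) s
  split = trans (count-++ B xs (repeat (suc m) xs) s) (cong (_+ count B (repeat (suc m) xs) s)
    (trans (count-cong B xs (++ˢ-assoc xs (repeat m xs) s)) (count-local B xs xs _ _ le)))

-- Sums over words weighted by their multiplicities.

sum-map-concatMap : ∀ {A B : Set} (f : B → ℕ) (g : A → List B) xs →
  sum (List.map f (List.concatMap g xs)) ≡ sum (List.map (λ x → sum (List.map f (g x))) xs)
sum-map-concatMap f g []       = refl
sum-map-concatMap f g (x ∷ xs) = begin
  sum (List.map f (g x ++ List.concatMap g xs))
    ≡⟨ cong sum (List.map-++ f (g x) _) ⟩
  sum (List.map f (g x) ++ List.map f (List.concatMap g xs))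
    ≡⟨ sum-++ (List.map f (g x)) _ ⟩
  sum (List.map f (g x)) + sum (List.map f (List.concatMap g xs))
    ≡⟨ cong (λ z → sum (List.map f (g x)) + z) (sum-map-concatMap f g xs) ⟩
  sum (List.map f (g x)) + sum (List.map (λ x → sum (List.map f (g x))) xs) ∎
  where open ≡-Reasoning

sum-map-applyUpTo : ∀ (f : ℕ → ℕ) g n → sum (List.map f (List.applyUpTo g n)) ≡ sumℕ (f ∘ g) n
sum-map-applyUpTo f g zero    = refl
sum-map-applyUpTo f g (suc n) = trans (cong (λ z → f (g 0) + z) (sum-map-applyUpTo f (g ∘ suc) n))
  (sym (sumℕ-head (f ∘ g) n))

sum-map-* : ∀ {A : Set} c (f : A → ℕ) xs → sum (List.map (λ x → c * f x) xs) ≡ c * sum (List.map f xs)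
sum-map-* c f []       = sym (*-zeroʳ c)
sum-map-* c f (x ∷ xs) = trans (cong (λ z → c * f x + z) (sum-map-* c f xs)) (sym (*-distribˡ-+ c (f x) _))

νNum-< : ∀ b j → j < b → νNum b j ≡ 1
νNum-< b j j<b = cong (λ z → if z then 1 else (if does (j ≟ b) then 2 ^ b ∸ b else 0)) (dec-true (j <? b) j<b)

νNum-≡ : ∀ b → νNum b b ≡ 2 ^ b ∸ b
νNum-≡ b = trans (cong (λ z → if z then 1 else (if does (b ≟ b) then 2 ^ b ∸ b else 0)) (dec-false (b <? b) (<-irrefl refl)))
  (cong (λ z → if z then 2 ^ b ∸ b else 0) (dec-true (b ≟ b) refl))

sum-νNum : ∀ b → sumℕ (νNum b) (suc b) ≡ 2 ^ b
sum-νNum b = trans (cong₂ _+_ (trans (sumℕ-cong b (νNum-< b)) (trans (sumℕ-const 1 b) (*-identityʳ b))) (νNum-≡ b))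
  (m+[n∸m]≡n (n≤2^n b))

-- Summation over all words of length w, each weighted with its number of copies in V b w.
module WordSum (b : ℕ) where

  wsum : ∀ w → (Vec ℕ w → ℕ) → ℕ
  wsum zero    F = F []
  wsum (suc w) F = sumℕ (λ d → νNum b d * wsum w (λ v → F (d ∷ v))) (suc b)

  wsum-cong : ∀ w {F G : Vec ℕ w → ℕ} → F ≗ G → wsum w F ≡ wsum w G
  wsum-cong zero    h = h []
  wsum-cong (suc w) h = sumℕ-cong (suc b) λ d _ → cong (νNum b d *_) (wsum-cong w λ v → h (d ∷ v))

  wsum-+ : ∀ w (F G : Vec ℕ w → ℕ) → wsum w (λ v → F v + G v) ≡ wsum w F + wsum w G
  wsum-+ zero    F G = refl
  wsum-+ (suc w) F G = trans
    (sumℕ-cong (suc b) λ d _ → trans (cong (νNum b d *_) (wsum-+ w _ _)) (*-distribˡ-+ (νNum b d) _ _))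
    (sumℕ-+ _ _ (suc b))

  wsum-* : ∀ w c (F : Vec ℕ w → ℕ) → wsum w (λ v → c * F v) ≡ c * wsum w F
  wsum-* zero    c F = refl
  wsum-* (suc w) c F = trans
    (sumℕ-cong (suc b) λ d _ → trans (cong (νNum b d *_) (wsum-* w c _)) (swap (νNum b d) c _))
    (sumℕ-* c _ (suc b))
    where
    swap : ∀ x y z → x * (y * z) ≡ y * (x * z)
    swap = solve-∀

  wsum-0 : ∀ w → wsum w (λ _ → 0) ≡ 0
  wsum-0 w = wsum-* w 0 (λ _ → 0)

  wsum-sumℕ : ∀ w (F : ℕ → Vec ℕ w → ℕ) n → wsum w (λ v → sumℕ (λ d → F d v) n) ≡ sumℕ (λ d → wsum w (F d)) n
  wsum-sumℕ w F zero    = wsum-0 w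
  wsum-sumℕ w F (suc n) = trans (wsum-+ w _ _) (cong (_+ wsum w (F n)) (wsum-sumℕ w F n))

  wsum-const : ∀ w c → wsum w (λ _ → c) ≡ 2 ^ (b * w) * c
  wsum-const zero    c = trans (sym (*-identityˡ c)) (cong (λ z → 2 ^ z * c) (sym (*-zeroʳ b)))
  wsum-const (suc w) c = begin
    sumℕ (λ d → νNum b d * wsum w (λ _ → c)) (suc b)   ≡⟨ sumℕ-cong (suc b) (λ d _ → *-comm (νNum b d) _) ⟩
    sumℕ (λ d → wsum w (λ _ → c) * νNum b d) (suc b)   ≡⟨ sumℕ-* (wsum w (λ _ → c)) (νNum b) (suc b) ⟩
    wsum w (λ _ → c) * sumℕ (νNum b) (suc b)           ≡⟨ cong₂ _*_ (wsum-const w c) (sum-νNum b) ⟩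
    2 ^ (b * w) * c * 2 ^ b                            ≡⟨ swap (2 ^ (b * w)) c (2 ^ b) ⟩
    2 ^ b * 2 ^ (b * w) * c                            ≡⟨ cong (_* c) (trans (2^-+ b (b * w)) (cong (2 ^_) (sym (*-suc b w)))) ⟩
    2 ^ (b * suc w) * c ∎
    where
    open ≡-Reasoning
    swap : ∀ x y z → x * y * z ≡ z * x * y
    swap = solve-∀

  wsum-swap : ∀ t u (H : Vec ℕ t → Vec ℕ u → ℕ) →
              wsum t (λ x → wsum u (H x)) ≡ wsum u (λ y → wsum t (λ x → H x y))
  wsum-swap zero    u H = refl
  wsum-swap (suc t) u H = begin
    sumℕ (λ d → νNum b d * wsum t (λ x → wsum u (H (d ∷ x)))) (suc b)
      ≡⟨ sumℕ-cong (suc b) (λ d _ → trans (cong (νNum b d *_) (wsum-swap t u (λ x → H (d ∷ x)))) (sym (wsum-* u (νNum b d) _))) ⟩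
    sumℕ (λ d → wsum u (λ y → νNum b d * wsum t (λ x → H (d ∷ x) y))) (suc b)
      ≡⟨ wsum-sumℕ u _ (suc b) ⟨
    wsum u (λ y → sumℕ (λ d → νNum b d * wsum t (λ x → H (d ∷ x) y)) (suc b)) ∎
    where open ≡-Reasoning

  wsum-++ : ∀ u t (G : Vec ℕ (u + t) → ℕ) → wsum (u + t) G ≡ wsum u (λ y → wsum t (λ x → G (y Vec.++ x)))
  wsum-++ zero    t G = refl
  wsum-++ (suc u) t G = sumℕ-cong (suc b) λ d _ → cong (νNum b d *_) (wsum-++ u t (λ v → G (d ∷ v)))

  -- The weight of a word is a product over its letters, so the last letter may be split off in
  -- place of the first. This is the form in which rotation invariance is used.
  wsum-snoc : ∀ w (F : Vec ℕ (suc w) → ℕ) →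
              wsum (suc w) F ≡ sumℕ (λ d → νNum b d * wsum w (λ v → F (v Vec.∷ʳ d))) (suc b)
  wsum-snoc zero    F = refl
  wsum-snoc (suc w) F = begin
    sumℕ (λ d → νNum b d * wsum (suc w) (λ v → F (d ∷ v))) (suc b)
      ≡⟨ sumℕ-cong (suc b) (λ d _ → trans (cong (νNum b d *_) (wsum-snoc w (λ v → F (d ∷ v)))) (sym (sumℕ-* (νNum b d) _ (suc b)))) ⟩
    sumℕ (λ d → sumℕ (λ e → νNum b d * (νNum b e * wsum w (λ v → F (d ∷ (v Vec.∷ʳ e))))) (suc b)) (suc b)
      ≡⟨ sumℕ-swap _ (suc b) (suc b) ⟩
    sumℕ (λ e → sumℕ (λ d → νNum b d * (νNum b e * wsum w (λ v → F (d ∷ (v Vec.∷ʳ e))))) (suc b)) (suc b)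
      ≡⟨ sumℕ-cong (suc b) (λ e _ → trans (sumℕ-cong (suc b) λ d _ → exchange (νNum b d) (νNum b e) _) (sumℕ-* (νNum b e) _ (suc b))) ⟩
    sumℕ (λ e → νNum b e * wsum (suc w) (λ v → F (v Vec.∷ʳ e))) (suc b) ∎
    where
    open ≡-Reasoning
    exchange : ∀ x y z → x * (y * z) ≡ y * (x * z)
    exchange = solve-∀

  sum-words : ∀ w (F : Vec ℕ w → ℕ) → sum (List.map (λ v → copies b v * F v) (words b w)) ≡ wsum w F
  sum-words zero    F = trans (+-identityʳ _) (*-identityˡ (F []))
  sum-words (suc w) F = begin
    sum (List.map (λ v → copies b v * F v) (words b (suc w)))
      ≡⟨ sum-map-concatMap (λ v → copies b v * F v) (λ d → List.map (d ∷_) (words b w)) (List.upTo (suc b)) ⟩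
    sum (List.map (λ d → sum (List.map (λ v → copies b v * F v) (List.map (d ∷_) (words b w)))) (List.upTo (suc b)))
      ≡⟨ sum-map-applyUpTo _ (λ d → d) (suc b) ⟩
    sumℕ (λ d → sum (List.map (λ v → copies b v * F v) (List.map (d ∷_) (words b w)))) (suc b)
      ≡⟨ sumℕ-cong (suc b) (λ d _ → trans (cong sum (sym (List.map-∘ (words b w))))
           (trans (cong sum (List.map-cong (λ v → *-assoc (νNum b d) (copies b v) _) (words b w)))
           (trans (sum-map-* (νNum b d) _ (words b w)) (cong (νNum b d *_) (sum-words w (λ v → F (d ∷ v))))))) ⟩
    wsum (suc w) F ∎
    where open ≡-Reasoning

  -- A letter below b has weight 1 out of a total of 2^b, so prescribing the first k letters divides
  -- the total weight 2^(bw) by 2^(bk).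
  wsum-match : ∀ {k} (B : Vec ℕ k) w s → VAll.All (_< b) B → k ≤ w →
               2 ^ (b * k) * wsum w (λ v → match B (Vec.toList v ++ˢ s)) ≡ 2 ^ (b * w)
  wsum-match []      w s _ _ = trans (cong₂ _*_ (cong (2 ^_) (*-zeroʳ b)) (wsum-const w 1))
    (trans (*-identityˡ _) (*-identityʳ _))
  wsum-match {suc k} (j ∷ B) (suc w) s (j<b ∷ B<b) (s≤s le) = begin
    2 ^ (b * suc k) * sumℕ (λ d → νNum b d * wsum w (λ v → 𝟙 (d ≟ j) * match B (Vec.toList v ++ˢ s))) (suc b)
      ≡⟨ cong (2 ^ (b * suc k) *_) (sumℕ-cong (suc b) λ d _ → trans (cong (νNum b d *_) (wsum-* w (𝟙 (d ≟ j)) _)) (rotate (νNum b d) (𝟙 (d ≟ j)) X)) ⟩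
    2 ^ (b * suc k) * sumℕ (λ d → νNum b d * X * 𝟙 (d ≟ j)) (suc b)
      ≡⟨ cong (2 ^ (b * suc k) *_) (sumℕ-pick (λ d → νNum b d * X) j (suc b) (m<n⇒m<1+n j<b)) ⟩
    2 ^ (b * suc k) * (νNum b j * X)
      ≡⟨ cong₂ _*_ (trans (cong (2 ^_) (*-suc b k)) (sym (2^-+ b (b * k)))) (trans (cong (_* X) (νNum-< b j j<b)) (*-identityˡ X)) ⟩
    2 ^ b * 2 ^ (b * k) * X
      ≡⟨ trans (*-assoc (2 ^ b) _ _) (cong (2 ^ b *_) (wsum-match B w s B<b le)) ⟩
    2 ^ b * 2 ^ (b * w)
      ≡⟨ trans (2^-+ b (b * w)) (cong (2 ^_) (sym (*-suc b w))) ⟩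
    2 ^ (b * suc w) ∎
    where
    open ≡-Reasoning
    X = wsum w (λ v → match B (Vec.toList v ++ˢ s))
    rotate : ∀ x y z → x * (y * z) ≡ x * z * y
    rotate = solve-∀

  -- A word read as x y, with the occurrences beginning in x already
  -- counted; the weights are invariant under rotation of the word.
  wsum-count : ∀ {k} (B : Vec ℕ k) → VAll.All (_< b) B → ∀ u t s → k ≤ u + t →
    2 ^ (b * k) * wsum t (λ x → wsum u (λ y → count B (Vec.toList y) (Vec.toList x ++ˢ Vec.toList y ++ˢ s)))
    ≡ u * 2 ^ (b * (u + t))
  wsum-count B B<b zero    t s _ = trans (cong (2 ^ (b * _) *_) (wsum-0 t)) (*-zeroʳ (2 ^ (b * _)))
  wsum-count {k} B B<b (suc u) t s k≤ = begin
    2 ^ (b * k) * wsum t (λ x → wsum (suc u) (λ y → count B (Vec.toList y) (after x y)))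
      ≡⟨ cong (2 ^ (b * k) *_) (trans (wsum-cong t λ x → trans (wsum-cong (suc u) (count≡ x))
           (wsum-+ (suc u) (first x) (others x))) (wsum-+ t (λ x → wsum (suc u) (first x)) (λ x → wsum (suc u) (others x)))) ⟩
    2 ^ (b * k) * (wsum t (λ x → wsum (suc u) (first x)) + wsum t (λ x → wsum (suc u) (others x)))
      ≡⟨ *-distribˡ-+ (2 ^ (b * k)) _ _ ⟩
    2 ^ (b * k) * wsum t (λ x → wsum (suc u) (first x)) + 2 ^ (b * k) * wsum t (λ x → wsum (suc u) (others x))
      ≡⟨ cong₂ _+_ first-sum others-sum ⟩
    2 ^ (b * (suc u + t)) + u * 2 ^ (b * (suc u + t)) ∎
    where
    open ≡-Reasoning
    after : Vec ℕ t → Vec ℕ (suc u) → ℕ → ℕ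
    after x y = Vec.toList x ++ˢ Vec.toList y ++ˢ s
    -- `first` is the occurrence at the first letter of y; as k ≤ u + 1 + t it sees only the word y
    -- x. For the other occurrences the first letter of y is moved to the end of x.
    first others : Vec ℕ t → Vec ℕ (suc u) → ℕ
    first x y = match B (Vec.toList y ++ˢ after x y)
    others x y = count B (Vec.toList (Vec.tail y)) (after x y)
    count≡ : ∀ x y → count B (Vec.toList y) (after x y) ≡ first x y + others x y
    count≡ x (d ∷ y) = refl
    prefix : Vec ℕ (suc u + t) → ℕ
    prefix v = match B (Vec.toList v ++ˢ s)
    first≡ : ∀ x y → first x y ≡ match B (Vec.toList (y Vec.++ x) ++ˢ s)
    first≡ x y = begin
      match B (Vec.toList y ++ˢ Vec.toList x ++ˢ Vec.toList y ++ˢ s)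
        ≡⟨ match-cong B (++ˢ-assoc (Vec.toList y) (Vec.toList x) _) ⟨
      match B ((Vec.toList y ++ Vec.toList x) ++ˢ Vec.toList y ++ˢ s)
        ≡⟨ cong (λ z → match B (z ++ˢ Vec.toList y ++ˢ s)) (Vec.toList-++ y x) ⟨
      match B (Vec.toList (y Vec.++ x) ++ˢ Vec.toList y ++ˢ s)
        ≡⟨ match-local B (Vec.toList (y Vec.++ x)) _ s (subst (k ≤_) (sym (Vec.length-toList (y Vec.++ x))) k≤) ⟩
      match B (Vec.toList (y Vec.++ x) ++ˢ s) ∎
    first-sum : 2 ^ (b * k) * wsum t (λ x → wsum (suc u) (first x)) ≡ 2 ^ (b * (suc u + t))
    first-sum = trans (cong (2 ^ (b * k) *_)
      (trans (wsum-cong t λ x → wsum-cong (suc u) (first≡ x))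
      (trans (wsum-swap t (suc u) (λ x y → prefix (y Vec.++ x))) (sym (wsum-++ (suc u) t prefix)))))
      (wsum-match B (suc u + t) s B<b k≤)
    others≡ : ∀ d x y → others x (d ∷ y) ≡ count B (Vec.toList y) (Vec.toList (x Vec.∷ʳ d) ++ˢ Vec.toList y ++ˢ s)
    others≡ d x y = count-cong B (Vec.toList y) λ n → sym (trans
      (cong (λ z → (z ++ˢ Vec.toList y ++ˢ s) n) (Vec.toList-∷ʳ d x))
      (trans (++ˢ-assoc (Vec.toList x) (d ∷ []) (Vec.toList y ++ˢ s) n)
        (++ˢ-cong (Vec.toList x) (λ { zero → refl ; (suc _) → refl }) n)))
    others-sum : 2 ^ (b * k) * wsum t (λ x → wsum (suc u) (others x)) ≡ u * 2 ^ (b * (suc u + t))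
    others-sum = begin
      2 ^ (b * k) * wsum t (λ x → sumℕ (λ d → νNum b d * wsum u (λ y → others x (d ∷ y))) (suc b))
        ≡⟨ cong (2 ^ (b * k) *_) (wsum-sumℕ t _ (suc b)) ⟩
      2 ^ (b * k) * sumℕ (λ d → wsum t (λ x → νNum b d * wsum u (λ y → others x (d ∷ y)))) (suc b)
        ≡⟨ cong (2 ^ (b * k) *_) (sumℕ-cong (suc b) λ d _ → trans (wsum-* t (νNum b d) _)
             (cong (νNum b d *_) (wsum-cong t λ x → wsum-cong u (others≡ d x)))) ⟩
      2 ^ (b * k) * sumℕ (λ d → νNum b d * wsum t (λ x → wsum u (λ y → count B (Vec.toList y) (Vec.toList (x Vec.∷ʳ d) ++ˢ Vec.toList y ++ˢ s)))) (suc b)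
        ≡⟨ cong (2 ^ (b * k) *_) (wsum-snoc t (λ x → wsum u (λ y → count B (Vec.toList y) (Vec.toList x ++ˢ Vec.toList y ++ˢ s)))) ⟨
      2 ^ (b * k) * wsum (suc t) (λ x → wsum u (λ y → count B (Vec.toList y) (Vec.toList x ++ˢ Vec.toList y ++ˢ s)))
        ≡⟨ wsum-count B B<b u (suc t) s (subst (k ≤_) (sym (+-suc u t)) k≤) ⟩
      u * 2 ^ (b * (u + suc t))
        ≡⟨ cong (λ z → u * 2 ^ (b * z)) (+-suc u t) ⟩
      u * 2 ^ (b * (suc u + t)) ∎

block : ∀ {w} → ℕ → Vec ℕ w → List ℕ
block b v = repeat (copies b v) (Vec.toList v)

length-words : ∀ b w → List.length (words b w) ≡ suc b ^ w
length-words b zero    = refl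
length-words b (suc w) = go (List.upTo (suc b)) (List.length-upTo (suc b))
  where
  go : ∀ {n} ds → List.length ds ≡ n → List.length (List.concatMap (λ d → List.map (d ∷_) (words b w)) ds) ≡ n * suc b ^ w
  go []       refl = refl
  go (d ∷ ds) refl = trans (List.length-++ (List.map (d ∷_) (words b w)))
    (cong₂ _+_ (trans (List.length-map (d ∷_) (words b w)) (length-words b w)) (go ds refl))

length-blocks : ∀ {w} b (vs : List (Vec ℕ w)) →
  List.length (List.concatMap (block b) vs) ≡ sum (List.map (λ v → copies b v * w) vs)
length-blocks b []       = refl
length-blocks b (v ∷ vs) = trans (List.length-++ (block b v)) (cong₂ _+_
  (trans (length-repeat (copies b v) (Vec.toList v)) (cong (copies b v *_) (Vec.length-toList v)))
  (length-blocks b vs))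

length-V : ∀ b w → List.length (V b w) ≡ w * 2 ^ (b * w)
length-V b w = trans (length-blocks b (words b w))
  (trans (sum-words w (λ _ → w)) (trans (wsum-const w w) (*-comm _ w)))
  where open WordSum b

-- A block V_j^m costs an error of one word length whatever its multiplicity m, so the total error
-- grows with the number of distinct words and not with the number of letters.
count-blocks : ∀ {k w} (B : Vec ℕ k) b (vs : List (Vec ℕ w)) s → k ≤ w →
  let total = sum (List.map (λ v → copies b v * cyclicCount B (Vec.toList v)) vs) in
  count B (List.concatMap (block b) vs) s ≤ total + List.length vs * w ×
  total ≤ count B (List.concatMap (block b) vs) s + List.length vs * w
count-blocks B b []       s le = z≤n , z≤n
count-blocks {k} {w} B b (v ∷ vs) s le =
  (begin
    count B (List.concatMap (block b) (v ∷ vs)) s  ≡⟨ split ⟩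
    x + y                                          ≤⟨ +-mono-≤ x≤ y≤ ⟩
    (c + w) + (total + n * w)                      ≡⟨ regroup c w total (n * w) ⟩
    c + total + (w + n * w) ∎) ,
  (begin
    c + total                                      ≤⟨ +-mono-≤ ≤x ≤y ⟩
    (x + w) + (y + n * w)                          ≡⟨ regroup x w y (n * w) ⟩
    x + y + (w + n * w)                            ≡⟨ cong (_+ (w + n * w)) split ⟨
    count B (List.concatMap (block b) (v ∷ vs)) s + (w + n * w) ∎)
  where
  open ≤-Reasoning
  n = List.length vs
  c = copies b v * cyclicCount B (Vec.toList v)
  total = sum (List.map (λ v → copies b v * cyclicCount B (Vec.toList v)) vs)
  x = count B (block b v) (List.concatMap (block b) vs ++ˢ s)
  y = count B (List.concatMap (block b) vs) s
  split : count B (List.concatMap (block b) (v ∷ vs)) s ≡ x + y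
  split = count-++ B (block b v) (List.concatMap (block b) vs) s
  regroup : ∀ a b c d → (a + b) + (c + d) ≡ a + c + (b + d)
  regroup = solve-∀
  single : x ≤ c + List.length (Vec.toList v) × c ≤ x + List.length (Vec.toList v)
  single = count-repeat B (copies b v) (Vec.toList v) _ (subst (k ≤_) (sym (Vec.length-toList v)) le)
  x≤ : x ≤ c + w
  x≤ = subst (λ z → x ≤ c + z) (Vec.length-toList v) (proj₁ single)
  ≤x : c ≤ x + w
  ≤x = subst (λ z → c ≤ x + z) (Vec.length-toList v) (proj₂ single)
  y≤ : y ≤ total + n * w
  y≤ = proj₁ (count-blocks B b vs s le)
  ≤y : total ≤ y + n * w
  ≤y = proj₂ (count-blocks B b vs s le)

-- Only at the last letters of the blocks V_j^m does the count differ from the cyclic one.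
count-V : ∀ {k} (B : Vec ℕ k) b w s → VAll.All (_< b) B → k ≤ w →
  2 ^ (b * k) * count B (V b w) s ≤ w * 2 ^ (b * w) + 2 ^ (b * k) * (w * suc b ^ w) ×
  w * 2 ^ (b * w) ≤ 2 ^ (b * k) * count B (V b w) s + 2 ^ (b * k) * (w * suc b ^ w)
count-V {k} B b w s B<b k≤w =
  ≤-trans (*-monoʳ-≤ K upper) (≤-reflexive (trans (*-distribˡ-+ K total _) (cong₂ (λ x y → x + K * y) mean border))) ,
  ≤-trans (≤-reflexive (sym mean)) (≤-trans (*-monoʳ-≤ K lower)
    (≤-reflexive (trans (*-distribˡ-+ K (count B (V b w) s) _) (cong (λ y → K * count B (V b w) s + K * y) border))))
  where
  open WordSum b
  K = 2 ^ (b * k)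
  total = sum (List.map (λ v → copies b v * cyclicCount B (Vec.toList v)) (words b w))
  upper = proj₁ (count-blocks B b (words b w) s k≤w)
  lower = proj₂ (count-blocks B b (words b w) s k≤w)
  border : List.length (words b w) * w ≡ w * suc b ^ w
  border = trans (cong (_* w) (length-words b w)) (*-comm _ w)
  mean : K * total ≡ w * 2 ^ (b * w)
  mean = trans (cong (K *_) (sum-words w (λ v → cyclicCount B (Vec.toList v))))
    (trans (wsum-count B B<b w 0 (λ _ → 0) (subst (k ≤_) (sym (+-identityʳ w)) k≤w))
      (cong (λ z → w * 2 ^ (b * z)) (+-identityʳ w)))

-- Ratio normality

matchAt : ∀ {k} → Vec ℕ k → (ℕ → ℕ) → ℕ → ℕ
matchAt B s j = match B (λ n → s (j + n))

𝟙-window : ∀ {k} (B : Vec ℕ k) (s : ℕ → ℕ) → 𝟙 (Vec.≡-dec _≟_ (Vec.tabulate (s ∘ toℕ)) B) ≡ match B s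
𝟙-window []      s = refl
𝟙-window (b ∷ B) s with does (s 0 ≟ b)
... | true  = trans (𝟙-window B (s ∘ suc)) (sym (*-identityˡ _))
... | false = refl

length-filter-upTo : ∀ {P : ℕ → Set} (P? : ∀ j → Dec (P j)) n →
                     List.length (List.filter P? (List.upTo n)) ≡ sumℕ (λ j → 𝟙 (P? j)) n
length-filter-upTo P? zero    = refl
length-filter-upTo P? (suc n) = begin
  List.length (List.filter P? (List.upTo (suc n)))
    ≡⟨ cong (List.length ∘ List.filter P?) (List.upTo-∷ʳ n) ⟨
  List.length (List.filter P? (List.upTo n List.∷ʳ n))
    ≡⟨ cong List.length (List.filter-++ P? (List.upTo n) _) ⟩
  List.length (List.filter P? (List.upTo n) ++ List.filter P? List.[ n ])
    ≡⟨ List.length-++ (List.filter P? (List.upTo n)) ⟩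
  List.length (List.filter P? (List.upTo n)) + List.length (List.filter P? List.[ n ])
    ≡⟨ cong₂ _+_ (length-filter-upTo P? n) single ⟩
  sumℕ (λ j → 𝟙 (P? j)) n + 𝟙 (P? n) ∎
  where
  open ≡-Reasoning
  single : List.length (List.filter P? List.[ n ]) ≡ 𝟙 (P? n)
  single with does (P? n)
  ... | true  = refl
  ... | false = refl

occurrences≡ : ∀ {k} (B : Vec ℕ k) s n → occurrences B s n ≡ sumℕ (matchAt B s) n
occurrences≡ {k} B s n = trans (length-filter-upTo (λ j → Vec.≡-dec _≟_ (window s k j) B) n)
  (sumℕ-cong n λ j _ → 𝟙-window B (λ t → s (j + t)))

count≡sumℕ : ∀ {k} (B : Vec ℕ k) xs s → count B xs s ≡ sumℕ (matchAt B (xs ++ˢ s)) (List.length xs)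
count≡sumℕ B []       s = refl
count≡sumℕ B (x ∷ xs) s = trans (cong (λ z → match B ((x ∷ xs) ++ˢ s) + z) (count≡sumℕ B xs s))
  (sym (sumℕ-head (matchAt B ((x ∷ xs) ++ˢ s)) (List.length xs)))

lengthW : ℕ → ℕ
lengthW i = i ^ 2 * 2 ^ (i * i ^ 2)

length-W : ∀ i .{{_ : NonZero i}} → ∣W∣ i ≡ lengthW i
length-W i = trans (cong List.length (toList-toList⁺ (V i (i ^ 2)) _)) (length-V i (i ^ 2))

len≡ : ∀ k → len k ≡ lengthW (6 + k)
len≡ k = trans (len≡∣W∣ k) (length-W (6 + k))

≗-W : ∀ i .{{_ : NonZero i}} (e : ℕ → ℕ) → (∀ t → e (toℕ t) ≡ letter i t) →
      e ≗ V i (i ^ 2) ++ˢ λ n → e (∣W∣ i + n)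
≗-W i e h n = trans (≗-++ˢ (List⁺.toList (W i)) e h n)
  (cong (λ xs → (xs ++ˢ λ n → e (∣W∣ i + n)) n) (toList-toList⁺ (V i (i ^ 2)) _))

digits-copy : ∀ k m → m < rep k →
  (λ n → digits (pos k m + n)) ≗ V (6 + k) ((6 + k) ^ 2) ++ˢ λ n → digits (pos k m + (∣W∣ (6 + k) + n))
digits-copy k m m< = ≗-W (6 + k) (λ n → digits (pos k m + n)) (λ t → trans (cong letterAt (placeAt-pos k m t m<)) (letterAt≡ k t))

-- Nothing need be known about the digits `s` that follow the copy, since the bounds of `count-V`
-- hold for every continuation.
copySum-matchAt : ∀ {κ} (B : Vec ℕ κ) k m → m < rep k →
  ∃[ s ] copySum (matchAt B digits) k m ≡ count B (V (6 + k) ((6 + k) ^ 2)) s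
copySum-matchAt B k m m< = s , (begin
  copySum (matchAt B digits) k m
    ≡⟨ sumℕ-cong (len k) (λ t _ → match-cong B λ n → trans (cong digits (+-assoc (pos k m) t n)) (digits-copy k m m< (t + n))) ⟩
  sumℕ (matchAt B (xs ++ˢ s)) (len k)
    ≡⟨ cong (sumℕ (matchAt B (xs ++ˢ s))) (trans (len≡ k) (sym (length-V (6 + k) ((6 + k) ^ 2)))) ⟩
  sumℕ (matchAt B (xs ++ˢ s)) (List.length xs)
    ≡⟨ count≡sumℕ B xs s ⟨
  count B xs s ∎)
  where
  open ≡-Reasoning
  xs = V (6 + k) ((6 + k) ^ 2)
  s = λ n → digits (pos k m + (∣W∣ (6 + k) + n))

ev-digits< : ∀ {κ} (B : Vec ℕ κ) → Eventually (λ i → VAll.All (_< i) B)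
ev-digits< []      = 0 , λ _ _ → []
ev-digits< (b ∷ B) = ev-map₂ (λ _ → _∷_) (ev-≥ (suc b)) (ev-digits< B)

-- After scaling by 2^(iκ) the count is asymptotic to |W_i|, a quantity that no longer involves the
-- digits of `B`. This common mean is the source of ratio normality.
count-V-mean : ∀ {κ} (B : Vec ℕ κ) M → Eventually (λ i → ∀ s → let c = 2 ^ (i * κ) * count B (V i (i ^ 2)) s in
  M * c ≤ suc M * lengthW i × M * lengthW i ≤ suc M * c)
count-V-mean {κ} B M = ev-map₂ conclude (ev-map₂ (λ _ → _,_) (ev-digits< B) (ev-≥ κ)) (words≪length (suc M) κ)
  where
  conclude : ∀ i → VAll.All (_< i) B × κ ≤ i → suc M * (2 ^ (i * κ) * (i ^ 2 * suc i ^ (i ^ 2))) ≤ lengthW i →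
    ∀ s → let c = 2 ^ (i * κ) * count B (V i (i ^ 2)) s in M * c ≤ suc M * lengthW i × M * lengthW i ≤ suc M * c
  conclude i (B<i , κ≤i) small s =
    (begin
      M * c              ≤⟨ *-monoʳ-≤ M (proj₁ bounds) ⟩
      M * (L + e)        ≡⟨ *-distribˡ-+ M L e ⟩
      M * L + M * e      ≤⟨ +-monoʳ-≤ (M * L) (≤-trans (m≤n+m (M * e) e) small) ⟩
      M * L + L          ≡⟨ +-comm (M * L) L ⟩
      suc M * L ∎) ,
    +-cancelˡ-≤ L (M * L) (suc M * c) (begin
      suc M * L                ≤⟨ *-monoʳ-≤ (suc M) (proj₂ bounds) ⟩
      suc M * (c + e)          ≡⟨ *-distribˡ-+ (suc M) c e ⟩
      suc M * c + suc M * e    ≤⟨ +-monoʳ-≤ (suc M * c) small ⟩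
      suc M * c + L            ≡⟨ +-comm (suc M * c) L ⟩
      L + suc M * c ∎)
    where
    open ≤-Reasoning
    L = lengthW i
    c = 2 ^ (i * κ) * count B (V i (i ^ 2)) s
    e = 2 ^ (i * κ) * (i ^ 2 * suc i ^ (i ^ 2))
    n≤n² : ∀ n → n ≤ n ^ 2
    n≤n² zero    = z≤n
    n≤n² (suc n) = m≤m*n (suc n) (suc n * 1) {{m*n≢0 (suc n) 1}}
    bounds : c ≤ L + e × L ≤ c + e
    bounds = count-V B i (i ^ 2) s B<i (≤-trans κ≤i (n≤n² i))

-- The reciprocal of ν_i(B) for a block `B` of length κ with digits below i = 6 + k.
scale : ℕ → ℕ → ℕ
scale κ k = 2 ^ ((6 + k) * κ)

scale≢0 : ∀ κ k → NonZero (scale κ k)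
scale≢0 κ k = m^n≢0 2 ((6 + k) * κ)

copySum-mean : ∀ {κ} (B : Vec ℕ κ) M → Eventually (λ k → ∀ m → m < rep k →
  M * (scale κ k * copySum (matchAt B digits) k m) ≤ suc M * len k ×
  M * len k ≤ suc M * (scale κ k * copySum (matchAt B digits) k m))
copySum-mean {κ} B M = ev-map conclude (ev-shift 6 (count-V-mean B M))
  where
  conclude : ∀ k → (∀ s → let c = scale κ k * count B (V (6 + k) ((6 + k) ^ 2)) s in
      M * c ≤ suc M * lengthW (6 + k) × M * lengthW (6 + k) ≤ suc M * c) →
    ∀ m → m < rep k → M * (scale κ k * copySum (matchAt B digits) k m) ≤ suc M * len k ×
      M * len k ≤ suc M * (scale κ k * copySum (matchAt B digits) k m)
  conclude k h m m< = subst₂ (λ c l → M * (scale κ k * c) ≤ suc M * l × M * l ≤ suc M * (scale κ k * c))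
    (sym (proj₂ found)) (sym (len≡ k)) (h (proj₁ found))
    where found = copySum-matchAt B k m m<

length≪sum : ∀ κ M → Eventually (λ k → M * (scale κ k * len (suc k)) ≤ rep k * len k)
length≪sum κ M = ev-map (λ k → subst₂ (λ a b → M * (scale κ k * a) ≤ rep k * b) (sym (len≡ (suc k))) (sym (len≡ k)))
  (ev-shift 6 (length≪stage M κ))

-- The growth hypothesis of `≲-from-copies`. By the mean with M = 1, each copy of stage k contains
-- at least |W_i| / (2 · 2^(iκ)) occurrences, and the number of copies outweighs the loss 2^(iκ).
length≪occurrences : ∀ {κ} (B : Vec ℕ κ) M → Eventually (λ k → M * len (suc k) ≤ sumℕ (matchAt B digits) (stageStart (suc k)))
length≪occurrences {κ} B M = ev-map₂ conclude (copySum-mean B 1) (length≪sum κ (2 * M))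
  where
  conclude : ∀ k → (∀ m → m < rep k → 1 * (scale κ k * copySum (matchAt B digits) k m) ≤ 2 * len k ×
      1 * len k ≤ 2 * (scale κ k * copySum (matchAt B digits) k m)) →
    2 * M * (scale κ k * len (suc k)) ≤ rep k * len k → M * len (suc k) ≤ sumℕ (matchAt B digits) (stageStart (suc k))
  conclude k mean grown = *-cancelˡ-≤ (2 * scale κ k) {{m*n≢0 2 (scale κ k) {{_}} {{scale≢0 κ k}}}} (begin
    2 * scale κ k * (M * len (suc k))     ≡⟨ shuffle (scale κ k) M (len (suc k)) ⟩
    2 * M * (scale κ k * len (suc k))     ≤⟨ grown ⟩
    rep k * len k                         ≤⟨ copies≤sum g k (len k) (λ m m< → subst₂ _≤_ (*-identityˡ _) (sym (scaled m)) (proj₂ (mean m m<))) ⟩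
    sumℕ g (stageStart (suc k))           ≡⟨ sumℕ-* (2 * scale κ k) (matchAt B digits) (stageStart (suc k)) ⟩
    2 * scale κ k * sumℕ (matchAt B digits) (stageStart (suc k)) ∎)
    where
    open ≤-Reasoning
    g = λ n → 2 * scale κ k * matchAt B digits n
    scaled : ∀ m → copySum g k m ≡ 2 * (scale κ k * copySum (matchAt B digits) k m)
    scaled m = trans (sumℕ-* (2 * scale κ k) (λ t → matchAt B digits (pos k m + t)) (len k)) (*-assoc 2 (scale κ k) _)
    shuffle : ∀ s M l → 2 * s * (M * l) ≡ 2 * M * (s * l)
    shuffle = solve-∀

-- Two factors 1 + 1/(3N) multiply to at most 1 + 1/N, because 2/(3N) + 1/(9N²) ≤ 1/N.
≲-trans : ∀ N a b c → 3 * N * a ≤ suc (3 * N) * b → 3 * N * b ≤ suc (3 * N) * c → N * a ≤ suc N * c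
≲-trans zero    a b c _ _ = z≤n
≲-trans N@(suc n) a b c h h′ = *-cancelˡ-≤ (3 * N * (3 * N)) (begin
  3 * N * (3 * N) * (N * a)                ≡⟨ e₁ N a ⟩
  3 * N * N * (3 * N * a)                  ≤⟨ *-monoʳ-≤ (3 * N * N) h ⟩
  3 * N * N * (suc (3 * N) * b)            ≡⟨ e₂ N b ⟩
  N * suc (3 * N) * (3 * N * b)            ≤⟨ *-monoʳ-≤ (N * suc (3 * N)) h′ ⟩
  -- The exact gap 9N²(N+1) - N(3N+1)² = 3N² - N, written without subtraction by means of n = N - 1.
  N * suc (3 * N) * (suc (3 * N) * c)      ≤⟨ m≤m+n _ ((3 * (N * n) + 2 * N) * c) ⟩
  N * suc (3 * N) * (suc (3 * N) * c) + (3 * (N * n) + 2 * N) * c ≡⟨ e₃ n c ⟩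
  3 * N * (3 * N) * (suc N * c) ∎)
  where
  open ≤-Reasoning
  e₁ : ∀ N a → 3 * N * (3 * N) * (N * a) ≡ 3 * N * N * (3 * N * a)
  e₁ = solve-∀
  e₂ : ∀ N b → 3 * N * N * (suc (3 * N) * b) ≡ N * suc (3 * N) * (3 * N * b)
  e₂ = solve-∀
  e₃ : ∀ n c → suc n * suc (3 * suc n) * (suc (3 * suc n) * c) + (3 * (suc n * n) + 2 * suc n) * c ≡
               3 * suc n * (3 * suc n) * (suc (suc n) * c)
  e₃ = solve-∀

-- Within a copy both counts are compared with `len k` under the same scaling, which depends only on
-- the common block length κ; the scaling then cancels.
occurrences-≲ : ∀ {κ} (B₁ B₂ : Vec ℕ κ) N →
  Eventually (λ n → N * sumℕ (matchAt B₁ digits) n ≤ suc N * sumℕ (matchAt B₂ digits) n)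
occurrences-≲ {κ} B₁ B₂ = ≲-from-copies (matchAt B₁ digits) (matchAt B₂ digits) 1 (λ n → match≤1 B₁ (λ t → digits (n + t)))
  (λ N → ev-map₂ (percopy N) (copySum-mean B₁ (3 * N)) (copySum-mean B₂ (3 * N))) (length≪occurrences B₂)
  where
  percopy : ∀ N k →
    (∀ m → m < rep k → 3 * N * (scale κ k * copySum (matchAt B₁ digits) k m) ≤ suc (3 * N) * len k ×
      3 * N * len k ≤ suc (3 * N) * (scale κ k * copySum (matchAt B₁ digits) k m)) →
    (∀ m → m < rep k → 3 * N * (scale κ k * copySum (matchAt B₂ digits) k m) ≤ suc (3 * N) * len k ×
      3 * N * len k ≤ suc (3 * N) * (scale κ k * copySum (matchAt B₂ digits) k m)) →
    ∀ m → m < rep k → N * copySum (matchAt B₁ digits) k m ≤ suc N * copySum (matchAt B₂ digits) k m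
  percopy N k h₁ h₂ m m< = *-cancelˡ-≤ S {{scale≢0 κ k}} (subst₂ _≤_ (exchange N S _) (exchange (suc N) S _)
    (≲-trans N (S * copySum (matchAt B₁ digits) k m) (len k) (S * copySum (matchAt B₂ digits) k m) (proj₁ (h₁ m m<)) (proj₂ (h₂ m m<))))
    where
    S = scale κ k
    exchange : ∀ N S c → N * (S * c) ≡ S * (N * c)
    exchange = solve-∀

-- Makes the denominators of the ratios eventually nonzero.
occurrences→∞ : ∀ {κ} (B : Vec ℕ κ) → Eventually (λ n → 1 ≤ sumℕ (matchAt B digits) n)
occurrences→∞ B = ev-stages (ev-map conclude (ev-pred (length≪occurrences B 1)))
  where
  conclude : ∀ k → 1 * len k ≤ sumℕ (matchAt B digits) (stageStart k) → ∀ {n} (p : Position n) → stage p ≡ k →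
             1 ≤ sumℕ (matchAt B digits) n
  conclude k h p refl = ≤-trans (≤-trans (len>0 k) (≤-trans (≤-reflexive (sym (*-identityˡ (len k)))) h)) (sumℕ-monoʳ (matchAt B digits) (stageStart≤ p))

-- Rational numbers

fromℕ-+ : ∀ a b → fromℕ (a + b) ≡ fromℕ a ℚ.+ fromℕ b
fromℕ-+ a b = sym (/-+ a b 1)

fromℕ-* : ∀ a b → fromℕ (a * b) ≡ fromℕ a ℚ.* fromℕ b
fromℕ-* a b = sym (/-*-≡ a b 1 1 1 refl)

fromℕ-mono : ∀ {a b} → a ≤ b → fromℕ a ℚ.≤ fromℕ b
fromℕ-mono {a} {b} a≤b = /-≤ {a} {b} {1} {1} (*-monoˡ-≤ 1 a≤b)

fromℕ-pos : ∀ {n} → 1 ≤ n → ℚ.Positive (fromℕ n)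
fromℕ-pos {suc n} _ = ℚ.normalize-pos (suc n) 1

fromℕ-nonNeg : ∀ n → ℚ.NonNegative (fromℕ n)
fromℕ-nonNeg n = ℚ.normalize-nonNeg n 1

≤-fromℕ : ∀ p → ∃[ n ] p ℚ.≤ fromℕ n
≤-fromℕ p@(mkℚ n d _) = ℤ.∣ n ∣ , ℚ.toℚᵘ-cancel-≤ (ℚᵘ.≤-respʳ-≃ (ℚᵘ.≃-sym (toℚᵘ-/ ℤ.∣ n ∣ 1))
  (ℚᵘ.*≤* (subst (ℤ._≤ + ℤ.∣ n ∣ ℤ.* + suc d) (sym (ℤ.*-identityʳ n))
    (ℤ.≤-trans (bound n) (subst (+ ℤ.∣ n ∣ ℤ.≤_) (ℤ.pos-* ℤ.∣ n ∣ (suc d)) (ℤ.+≤+ (m≤m*n ℤ.∣ n ∣ (suc d))))))))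
  where
  bound : ∀ z → z ℤ.≤ + ℤ.∣ z ∣
  bound (+ _)      = ℤ.≤-refl
  bound ℤ.-[1+ _ ] = ℤ.-≤+

+-cancelʳ-≤ℚ : ∀ c {a b} → a ℚ.+ c ℚ.≤ b ℚ.+ c → a ℚ.≤ b
+-cancelʳ-≤ℚ c {a} {b} h = subst₂ ℚ._≤_ (cancel a c) (cancel b c) (ℚ.+-monoˡ-≤ (ℚ.- c) h)
  where
  cancel : ∀ a c → (a ℚ.+ c) ℚ.+ ℚ.- c ≡ a
  cancel = let open +-*-Solver in solve 2 (λ a c → (a :+ c) :+ :- c := a) refl

+-cancelʳ-<ℚ : ∀ c {a b} → a ℚ.+ c ℚ.< b ℚ.+ c → a ℚ.< b
+-cancelʳ-<ℚ c {a} {b} h = subst₂ ℚ._<_ (cancel a c) (cancel b c) (ℚ.+-monoˡ-< (ℚ.- c) h)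
  where
  cancel : ∀ a c → (a ℚ.+ c) ℚ.+ ℚ.- c ≡ a
  cancel = let open +-*-Solver in solve 2 (λ a c → (a :+ c) :+ :- c := a) refl

p-q+q : ∀ p q → (p ℚ.- q) ℚ.+ q ≡ p
p-q+q = let open +-*-Solver in solve 2 (λ p q → (p :- q) :+ q := p) refl

neg-p-q : ∀ p q → ℚ.- (p ℚ.- q) ≡ q ℚ.- p
neg-p-q = let open +-*-Solver in solve 2 (λ p q → :- (p :- q) := q :- p) refl

≤-minus : ∀ {p q δ} → p ℚ.≤ q ℚ.+ δ → p ℚ.- q ℚ.≤ δ
≤-minus {p} {q} {δ} h = +-cancelʳ-≤ℚ q (subst₂ ℚ._≤_ (sym (p-q+q p q)) (ℚ.+-comm q δ) h)

∣p-q∣≤ : ∀ {p q δ} → p ℚ.≤ q ℚ.+ δ → q ℚ.≤ p ℚ.+ δ → ℚ.∣ p ℚ.- q ∣ ℚ.≤ δ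
∣p-q∣≤ {p} {q} {δ} h h′ with ℚ.∣p∣≡p∨∣p∣≡-p (p ℚ.- q)
... | inj₁ eq = subst (ℚ._≤ δ) (sym eq) (≤-minus h)
... | inj₂ eq = subst (ℚ._≤ δ) (sym (trans eq (neg-p-q p q))) (≤-minus h′)

∣p-q∣-sym : ∀ p q → ℚ.∣ p ℚ.- q ∣ ≡ ℚ.∣ q ℚ.- p ∣
∣p-q∣-sym p q = trans (sym (ℚ.∣-p∣≡∣p∣ (p ℚ.- q))) (cong ℚ.∣_∣ (neg-p-q p q))

p≤∣p∣ : ∀ p → p ℚ.≤ ℚ.∣ p ∣
p≤∣p∣ p with ℚ.≤-total 0ℚ p
... | inj₁ 0≤p = ℚ.≤-reflexive (sym (ℚ.0≤p⇒∣p∣≡p 0≤p))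
... | inj₂ p≤0 = ℚ.≤-trans p≤0 (ℚ.0≤∣p∣ p)

∣p-q∣<⇒p< : ∀ {p q ε} → ℚ.∣ p ℚ.- q ∣ ℚ.< ε → p ℚ.< q ℚ.+ ε
∣p-q∣<⇒p< {p} {q} {ε} h = subst₂ ℚ._<_ (p-q+q p q) (ℚ.+-comm ε q)
  (ℚ.+-monoˡ-< q (ℚ.≤-<-trans (p≤∣p∣ (p ℚ.- q)) h))

∣p-q∣<⇒q< : ∀ {p q ε} → ℚ.∣ p ℚ.- q ∣ ℚ.< ε → q ℚ.< p ℚ.+ ε
∣p-q∣<⇒q< {p} {q} {ε} h = ∣p-q∣<⇒p< (subst (ℚ._< ε) (∣p-q∣-sym p q) h)

÷-* : ∀ p q .{{_ : ℚ.NonZero q}} → (p ℚ.÷ q) ℚ.* q ≡ p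
÷-* p q = trans (ℚ.*-assoc p (ℚ.1/ q) q) (trans (cong (p ℚ.*_) (ℚ.*-inverseˡ q)) (ℚ.*-identityʳ p))

fromℕ-÷ : ∀ a b .{{_ : NonZero b}} .{{_ : ℚ.NonZero (fromℕ b)}} → fromℕ a ℚ.÷ fromℕ b ≡ + a ℚ./ b
fromℕ-÷ a b = begin
  fromℕ a ℚ.* 1/b                        ≡⟨ cong (ℚ._* 1/b) (/-*-cancel a b) ⟨
  fromℕ b ℚ.* (+ a ℚ./ b) ℚ.* 1/b        ≡⟨ cong (ℚ._* 1/b) (ℚ.*-comm (fromℕ b) (+ a ℚ./ b)) ⟩
  (+ a ℚ./ b) ℚ.* fromℕ b ℚ.* 1/b        ≡⟨ ℚ.*-assoc (+ a ℚ./ b) (fromℕ b) 1/b ⟩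
  (+ a ℚ./ b) ℚ.* (fromℕ b ℚ.* 1/b)      ≡⟨ cong ((+ a ℚ./ b) ℚ.*_) (ℚ.*-inverseʳ (fromℕ b)) ⟩
  (+ a ℚ./ b) ℚ.* 1ℚ                     ≡⟨ ℚ.*-identityʳ (+ a ℚ./ b) ⟩
  + a ℚ./ b ∎
  where
  open ≡-Reasoning
  1/b = ℚ.1/ fromℕ b

-- The two hypotheses are taken at K + 1 and at K, so that f/g ≤ (K+2)/(K+1) and f/g ≥ K/(K+1) lie
-- at the same distance 1/(K+1) from 1.
Ratio→1-fromℕ : ∀ (f g : ℕ → ℕ) → Eventually (λ n → 1 ≤ g n) →
  (∀ M → Eventually (λ n → M * f n ≤ suc M * g n)) → (∀ M → Eventually (λ n → M * g n ≤ suc M * f n)) →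
  Ratio→1 (λ n → fromℕ (f n)) (λ n → fromℕ (g n))
Ratio→1-fromℕ f g g>0 f≲g g≲f ε 0<ε =
  ev-map₂ conclude g>0 (ev-map₂ (λ _ → _,_) (f≲g (suc K)) (g≲f K))
  where
  K = proj₁ (archimedean ε 0<ε)
  conclude : ∀ n → 1 ≤ g n → suc K * f n ≤ suc (suc K) * g n × K * g n ≤ suc K * f n →
    Σ[ v≢0 ∈ ℚ.NonZero (fromℕ (g n)) ] ℚ.∣ (fromℕ (f n) ℚ.÷ fromℕ (g n)) {{v≢0}} ℚ.- 1ℚ ∣ ℚ.< ε
  conclude n 1≤g (upper , lower) = v≢0 , ℚ.≤-<-trans close (proj₂ (archimedean ε 0<ε))
    where
    instance
      g≢0 : NonZero (g n)
      g≢0 = >-nonZero 1≤g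
      v≢0 : ℚ.NonZero (fromℕ (g n))
      v≢0 = ℚ.pos⇒nonZero (fromℕ (g n)) {{fromℕ-pos 1≤g}}
    δ = + 1 ℚ./ suc K
    1+δ : 1ℚ ℚ.+ δ ≡ + suc (suc K) ℚ./ suc K
    1+δ = trans (cong (ℚ._+ δ) (/-≡ {1} {suc K} {1} {suc K} (trans (*-identityˡ (suc K)) (sym (*-identityʳ (suc K))))))
      (trans (/-+ (suc K) 1 (suc K)) (cong (λ z → + z ℚ./ suc K) (+-comm (suc K) 1)))
    above : + f n ℚ./ g n ℚ.≤ 1ℚ ℚ.+ δ
    above = subst (+ f n ℚ./ g n ℚ.≤_) (sym 1+δ)
      (/-≤ {f n} {suc (suc K)} {g n} {suc K} (≤-trans (≤-reflexive (*-comm (f n) (suc K))) upper))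
    below : 1ℚ ℚ.≤ + f n ℚ./ g n ℚ.+ δ
    below = subst (ℚ._≤ + f n ℚ./ g n ℚ.+ δ)
      (trans (/-+ K 1 (suc K)) (/-≡ {K + 1} {1} {suc K} {1} (trans (*-identityʳ (K + 1)) (trans (+-comm K 1) (sym (*-identityˡ (suc K)))))))
      (ℚ.+-monoˡ-≤ δ (/-≤ {K} {f n} {suc K} {g n} (≤-trans lower (≤-reflexive (*-comm (suc K) (f n))))))
    close : ℚ.∣ fromℕ (f n) ℚ.÷ fromℕ (g n) ℚ.- 1ℚ ∣ ℚ.≤ δ
    close = subst (λ z → ℚ.∣ z ℚ.- 1ℚ ∣ ℚ.≤ δ) (sym (fromℕ-÷ (f n) (g n))) (∣p-q∣≤ above below)

sumℚ-≥ : ∀ (u : ℕ → ℚ) x n l → (∀ t → t < l → x ℚ.≤ u (n + t)) → sumℚ u n ℚ.+ fromℕ l ℚ.* x ℚ.≤ sumℚ u (n + l)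
sumℚ-≥ u x n zero    h = ℚ.≤-reflexive (trans (cong (sumℚ u n ℚ.+_) (ℚ.*-zeroˡ x))
  (trans (ℚ.+-identityʳ (sumℚ u n)) (cong (sumℚ u) (sym (+-identityʳ n)))))
sumℚ-≥ u x n (suc l) h = subst₂ ℚ._≤_ split (cong (sumℚ u) (sym (+-suc n l)))
  (ℚ.+-mono-≤ (sumℚ-≥ u x n l (λ t t<l → h t (m<n⇒m<1+n t<l))) (h l ≤-refl))
  where
  distribute : ∀ s l x → (s ℚ.+ l ℚ.* x) ℚ.+ x ≡ s ℚ.+ (l ℚ.+ 1ℚ) ℚ.* x
  distribute = let open +-*-Solver in solve 3 (λ s l x → (s :+ l :* x) :+ x := s :+ (l :+ con 1ℚ) :* x) refl
  split : (sumℚ u n ℚ.+ fromℕ l ℚ.* x) ℚ.+ x ≡ sumℚ u n ℚ.+ fromℕ (suc l) ℚ.* x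
  split = trans (distribute (sumℚ u n) (fromℕ l) x)
    (cong (λ z → sumℚ u n ℚ.+ z ℚ.* x) (trans (sym (fromℕ-+ l 1)) (cong fromℕ (+-comm l 1))))

sumℚ-mono : ∀ (u : ℕ → ℚ) → (∀ j → 0ℚ ℚ.≤ u j) → ∀ {m n} → m ≤ n → sumℚ u m ℚ.≤ sumℚ u n
sumℚ-mono u u≥0 {m} {n} m≤n = subst₂ ℚ._≤_ (trans (cong (sumℚ u m ℚ.+_) (ℚ.*-zeroʳ (fromℕ (n ∸ m)))) (ℚ.+-identityʳ (sumℚ u m)))
  (cong (sumℚ u) (m+[n∸m]≡n m≤n)) (sumℚ-≥ u 0ℚ m (n ∸ m) (λ t _ → u≥0 (m + t)))

over-≥ : ∀ Q X j κ .{{_ : NonZero X}} → ∏[ base Q from j , κ ] ≤ X → + 1 ℚ./ X ℚ.≤ (1 over Q from j , κ)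
over-≥ Q X j κ le = /-≤ {1} {1} {X} {∏[ base Q from j , κ ]} {{it}} {{∏-nonZero Q j κ}} (*-monoʳ-≤ 1 le)

over-nonNeg : ∀ Q j κ → 0ℚ ℚ.≤ (1 over Q from j , κ)
over-nonNeg Q j κ = ℚ.nonNegative⁻¹ (1 over Q from j , κ) {{ℚ.normalize-nonNeg 1 ∏[ base Q from j , κ ] {{∏-nonZero Q j κ}}}}

∏-≤ : ∀ u X j κ → (∀ t → t < κ → u (j + t) ≤ X) → ∏[ u from j , κ ] ≤ X ^ κ
∏-≤ u X j zero    h = ≤-refl
∏-≤ u X j (suc κ) h = ≤-trans (*-mono-≤ (∏-≤ u X j κ (λ t t<κ → h t (m<n⇒m<1+n t<κ))) (h κ ≤-refl))
  (≤-reflexive (*-comm (X ^ κ) X))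

-- Floors and uniqueness of Cantor series expansions

fromℤ-cancel-< : ∀ {y z} → y ℚ./ 1 ℚ.< z ℚ./ 1 → y ℤ.< z
fromℤ-cancel-< {y} {z} h = subst₂ ℤ._<_ (ℤ.*-identityʳ y) (ℤ.*-identityʳ z)
  (ℚᵘ.drop-*<* (ℚᵘ.<-respˡ-≃ (ℚ.toℚᵘ-fromℚᵘ (ℚᵘ.mkℚᵘ y 0))
    (ℚᵘ.<-respʳ-≃ (ℚ.toℚᵘ-fromℚᵘ (ℚᵘ.mkℚᵘ z 0)) (ℚ.toℚᵘ-mono-< h))))

fromℤ-suc : ∀ z → z ℚ./ 1 ℚ.+ 1ℚ ≡ ℤ.suc z ℚ./ 1
fromℤ-suc z = ℚ.toℚᵘ-injective (ℚᵘ.≃-trans (ℚ.toℚᵘ-homo-+ (z ℚ./ 1) 1ℚ)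
  (ℚᵘ.≃-trans (ℚᵘ.+-cong (ℚ.toℚᵘ-fromℚᵘ (ℚᵘ.mkℚᵘ z 0)) (ℚᵘ.≃-refl {ℚᵘ.1ℚᵘ}))
  (ℚᵘ.≃-trans (ℚᵘ.*≡* (cong (ℤ._* + 1) (trans (cong₂ ℤ._+_ (ℤ.*-identityʳ z) refl) (ℤ.+-comm z (+ 1)))))
    (ℚᵘ.≃-sym (ℚ.toℚᵘ-fromℚᵘ (ℚᵘ.mkℚᵘ (ℤ.suc z) 0))))))

-- One index of the approximations decides: y ≤ x is read with tolerance ε/2, and the strict bound x
-- < z + 1 has a margin ε, so y < z + 1 already among the rationals.
IsFloor-≤ : ∀ {x y z} → IsFloor x y → IsFloor x z → y ℤ.≤ z
IsFloor-≤ {x} {y} {z} (y≤x , _) (_ , ε , 0<ε , x<z+1) =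
  subst (y ℤ.≤_) (ℤ.pred-suc z) (ℤ.i<j⇒i≤pred[j] {y} {ℤ.suc z} (fromℤ-cancel-< (subst (y ℚ./ 1 ℚ.<_) (fromℤ-suc z) y<z+1)))
  where
  open ℚ.≤-Reasoning
  n = proj₁ (ev-map₂ (λ _ → _,_) (y≤x (ℚ.½ ℚ.* ε) (half ε 0<ε)) x<z+1)
  both = proj₂ (ev-map₂ (λ _ → _,_) (y≤x (ℚ.½ ℚ.* ε) (half ε 0<ε)) x<z+1) n ≤-refl
  y<z+1 : y ℚ./ 1 ℚ.< z ℚ./ 1 ℚ.+ 1ℚ
  y<z+1 = begin-strict
    y ℚ./ 1                                         ≤⟨ proj₁ both ⟩
    approx x n ℚ.+ ℚ.½ ℚ.* ε                        <⟨ ℚ.+-monoʳ-< (approx x n) (subst (ℚ._< ℚ.½ ℚ.* ε ℚ.+ ℚ.½ ℚ.* ε) (ℚ.+-identityˡ _) (ℚ.+-monoˡ-< (ℚ.½ ℚ.* ε) (half ε 0<ε))) ⟩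
    approx x n ℚ.+ (ℚ.½ ℚ.* ε ℚ.+ ℚ.½ ℚ.* ε)        ≡⟨ cong (approx x n ℚ.+_) (half+half ε) ⟩
    approx x n ℚ.+ ε                                ≤⟨ proj₂ both ⟩
    z ℚ./ 1 ℚ.+ 1ℚ ∎

IsFloor-unique : ∀ {x y z} → IsFloor x y → IsFloor x z → y ≡ z
IsFloor-unique {x} h h′ = ℤ.≤-antisym (IsFloor-≤ {x} h h′) (IsFloor-≤ {x} h′ h)

InfOften : BasicSequence → (ℕ → ℕ) → Set
InfOften Q a = ∀ n → ∃[ m ] n ≤ m × a m ≢ base Q m ∸ 1

module _ (Q : BasicSequence) where

  private
    Π : ℕ → ℕ
    Π n = ∏[ base Q from 0 , n ]

    Π≢0 : ∀ {n} → NonZero (Π n)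
    Π≢0 {n} = ∏-nonZero Q 0 n

    instance
      q≢0 : ∀ {n} → NonZero (base Q n)
      q≢0 {n} = base-nonZero Q n

  -- The numerator of the n-th partial sum over q_1 ⋯ q_n, by Horner's rule; for an admissible digit
  -- sequence it is the integer part of q_1 ⋯ q_n x.
  prefixInt : (ℕ → ℕ) → ℕ → ℕ
  prefixInt a zero    = 0
  prefixInt a (suc n) = prefixInt a n * base Q n + a n

  partialSum≡ : ∀ a n → partialSum Q a n ≡ (prefixInt a n over Q from 0 , n)
  partialSum≡ a zero    = refl
  partialSum≡ a (suc n) = trans (cong (ℚ._+ (a n over Q from 0 , suc n))
      (trans (partialSum≡ a n) (/-≡ {prefixInt a n} {prefixInt a n * base Q n} {Π n} {Π (suc n)} {{Π≢0 {n}}} {{Π≢0 {suc n}}} (shuffle (prefixInt a n) (Π n) (base Q n)))))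
    (/-+ (prefixInt a n * base Q n) (a n) (Π (suc n)) {{Π≢0 {suc n}}})
    where
    shuffle : ∀ k p q → k * (p * q) ≡ k * q * p
    shuffle = solve-∀

  module _ (a : ℕ → ℕ) (a<q : ∀ n → a n < base Q n) (inf : InfOften Q a) where

    private module S = SeriesBounds Q a a<q

    -- A digit at most q - 2 at some m ≥ n keeps all later partial sums away from their trivial
    -- upper bound by the fixed amount 1/(q_1 ⋯ q_(m+1)). Strictness of the floor and uniqueness of
    -- the digits both rest on this gap.
    strictly-below : ∀ n → ∃[ m ] n ≤ m × Eventually (λ l →
      partialSum Q a l ℚ.+ (1 over Q from 0 , suc m) ℚ.≤ partialSum Q a n ℚ.+ (1 over Q from 0 , n))
    strictly-below n with inf n
    ... | m , n≤m , a≢ = m , n≤m , suc m , λ l le → begin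
      partialSum Q a l ℚ.+ δ                                    ≤⟨ ℚ.+-monoˡ-≤ δ (ℚ.≤-trans (S.sum≤upper l) (S.upper-anti le)) ⟩
      partialSum Q a (suc m) ℚ.+ δ ℚ.+ δ                        ≡⟨ ℚ.+-assoc (partialSum Q a (suc m)) δ δ ⟩
      partialSum Q a (suc m) ℚ.+ (δ ℚ.+ δ)                      ≡⟨ cong (partialSum Q a (suc m) ℚ.+_) (/-+ 1 1 (Π (suc m)) {{Π≢0 {suc m}}}) ⟩
      partialSum Q a (suc m) ℚ.+ (2 over Q from 0 , suc m)      ≤⟨ S.step m 2 a+2≤q ⟩
      partialSum Q a m ℚ.+ (1 over Q from 0 , m)                ≤⟨ S.upper-anti n≤m ⟩
      partialSum Q a n ℚ.+ (1 over Q from 0 , n) ∎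
      where
      open ℚ.≤-Reasoning
      δ = 1 over Q from 0 , suc m
      a+2≤q : a m + 2 ≤ base Q m
      a+2≤q = subst (_≤ base Q m) (+-comm 2 (a m)) (≤∧≢⇒< (a<q m) λ eq → a≢ (cong (_∸ 1) eq))

    private
      scaled : ∀ n b → fromℕ (Π n) ℚ.* (b over Q from 0 , suc n) ≡ + b ℚ./ base Q n
      scaled n b = trans (/-*-≡ (Π n) b 1 (Π (suc n)) (Π (suc n)) {{_}} {{Π≢0 {suc n}}} {{Π≢0 {suc n}}} (*-identityˡ _))
        (/-≡ {Π n * b} {b} {Π (suc n)} {base Q n} {{Π≢0 {suc n}}} (shuffle (Π n) b (base Q n)))
        where
        shuffle : ∀ p b q → p * b * q ≡ b * (p * q)
        shuffle = solve-∀

      scaled-sum : ∀ n → fromℕ (Π n) ℚ.* partialSum Q a n ≡ fromℕ (prefixInt a n)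
      scaled-sum n = trans (cong (fromℕ (Π n) ℚ.*_) (partialSum≡ a n)) (/-*-cancel (prefixInt a n) (Π n) {{Π≢0 {n}}})

      scaled-≤ : ∀ n {x y} → x ℚ.≤ y → fromℕ (Π n) ℚ.* x ℚ.≤ fromℕ (Π n) ℚ.* y
      scaled-≤ n = ℚ.*-monoˡ-≤-nonNeg (fromℕ (Π n)) {{fromℕ-nonNeg (Π n)}}

      scaled-+ : ∀ n x b → fromℕ (Π n) ℚ.* (x ℚ.+ (b over Q from 0 , suc n)) ≡ fromℕ (Π n) ℚ.* x ℚ.+ + b ℚ./ base Q n
      scaled-+ n x b = trans (ℚ.*-distribˡ-+ (fromℕ (Π n)) x _) (cong (fromℕ (Π n) ℚ.* x ℚ.+_) (scaled n b))

    -- After multiplication by q_1 ⋯ q_n the terms before a_n form an integer, and a_n contributes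
    -- a_n/q_n. With the upper counterpart this confines the fractional part to
    -- [a_n/q_n , (a_n + 1)/q_n].
    shifted-lower : ∀ n l → suc n ≤ l →
      fromℕ (prefixInt a n) ℚ.+ + a n ℚ./ base Q n ℚ.≤ fromℕ (Π n) ℚ.* partialSum Q a l
    shifted-lower n l le = subst (ℚ._≤ fromℕ (Π n) ℚ.* partialSum Q a l)
      (trans (scaled-+ n (partialSum Q a n) (a n)) (cong (ℚ._+ + a n ℚ./ base Q n) (scaled-sum n)))
      (scaled-≤ n (S.sum-mono le))

    shifted-upper : ∀ n l → suc n ≤ l →
      fromℕ (Π n) ℚ.* partialSum Q a l ℚ.≤ fromℕ (prefixInt a n) ℚ.+ + suc (a n) ℚ./ base Q n
    shifted-upper n l le = subst (fromℕ (Π n) ℚ.* partialSum Q a l ℚ.≤_)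
      (trans (cong (fromℕ (Π n) ℚ.*_) (trans (ℚ.+-assoc (partialSum Q a n) _ _) (cong (partialSum Q a n ℚ.+_)
          (trans (/-+ (a n) 1 (Π (suc n)) {{Π≢0 {suc n}}}) (cong (λ z → z over Q from 0 , suc n) (+-comm (a n) 1))))))
        (trans (scaled-+ n (partialSum Q a n) (suc (a n))) (cong (ℚ._+ + suc (a n) ℚ./ base Q n) (scaled-sum n))))
      (scaled-≤ n (ℚ.≤-trans (S.sum≤upper l) (S.upper-anti le)))

    shifted-floor : ∀ n → IsFloor (Π n · series Q a a<q) (+ prefixInt a n)
    shifted-floor n =
      (λ ε 0<ε → n , λ l le → ℚ.≤-trans
        (subst (ℚ._≤ fromℕ (Π n) ℚ.* partialSum Q a l) (scaled-sum n) (scaled-≤ n (S.sum-mono le)))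
        (p≤p+q _ ε (ℚ.<⇒≤ 0<ε))) ,
      δ , 0<δ , proj₁ room , λ l le → subst₂ ℚ._≤_ (ℚ.*-distribˡ-+ (fromℕ (Π n)) _ _)
        (trans (ℚ.*-distribˡ-+ (fromℕ (Π n)) _ _) (cong₂ ℚ._+_ (scaled-sum n) (/-*-cancel 1 (Π n) {{Π≢0 {n}}})))
        (scaled-≤ n (proj₂ room l le))
      where
      m = proj₁ (strictly-below n)
      room = proj₂ (proj₂ (strictly-below n))
      δ′ = 1 over Q from 0 , suc m
      δ = fromℕ (Π n) ℚ.* δ′
      0<δ : 0ℚ ℚ.< δ
      0<δ = subst (ℚ._< δ) (ℚ.*-zeroʳ (fromℕ (Π n))) (ℚ.*-monoʳ-<-pos (fromℕ (Π n)) {{fromℕ-pos (>-nonZero⁻¹ (Π n) {{Π≢0 {n}}})}}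
        (ℚ.positive⁻¹ δ′ {{ℚ.normalize-pos 1 (Π (suc m)) {{Π≢0 {suc m}}}}}))

  -- A smaller prefix of `a` is smaller by at least one unit 1/(q_1 ⋯ q_n), which is all that the
  -- tail of `a` could make up; by `strictly-below` it falls short by a fixed gap, so the two series
  -- cannot agree.
  prefixInt-≮ : ∀ a b (a<q : ∀ n → a n < base Q n) (b<q : ∀ n → b n < base Q n) → InfOften Q a →
    series Q a a<q ≃ series Q b b<q → ∀ n → ¬ prefixInt a n < prefixInt b n
  prefixInt-≮ a b a<q b<q inf a≃b n lt = ℚ.<-irrefl refl (begin-strict
    partialSum Q b l                              <⟨ ∣p-q∣<⇒q< {partialSum Q a l} close ⟩
    partialSum Q a l ℚ.+ δ                        ≤⟨ below ⟩
    partialSum Q a n ℚ.+ (1 over Q from 0 , n)    ≡⟨ cong (ℚ._+ (1 over Q from 0 , n)) (partialSum≡ a n) ⟩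
    (prefixInt a n over Q from 0 , n) ℚ.+ (1 over Q from 0 , n) ≡⟨ /-+ (prefixInt a n) 1 (Π n) {{Π≢0 {n}}} ⟩
    ((prefixInt a n + 1) over Q from 0 , n)
      ≤⟨ /-≤ {prefixInt a n + 1} {prefixInt b n} {Π n} {Π n} {{Π≢0 {n}}} {{Π≢0 {n}}} (*-monoˡ-≤ (Π n) (subst (_≤ prefixInt b n) (+-comm 1 (prefixInt a n)) lt)) ⟩
    (prefixInt b n over Q from 0 , n)             ≡⟨ partialSum≡ b n ⟨
    partialSum Q b n                              ≤⟨ SeriesBounds.sum-mono Q b b<q n≤l ⟩
    partialSum Q b l ∎)
    where
    open ℚ.≤-Reasoning
    m = proj₁ (strictly-below a a<q inf n)
    room = proj₂ (proj₂ (strictly-below a a<q inf n))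
    δ = 1 over Q from 0 , suc m
    0<δ : 0ℚ ℚ.< δ
    0<δ = ℚ.positive⁻¹ δ {{ℚ.normalize-pos 1 (Π (suc m)) {{Π≢0 {suc m}}}}}
    found = ev-map₂ (λ _ → _,_) (ev-map₂ (λ _ → _,_) room (a≃b δ 0<δ)) (ev-≥ n)
    l = proj₁ found
    n≤l = proj₂ (proj₂ found l ≤-refl)
    below = proj₁ (proj₁ (proj₂ found l ≤-refl))
    close = proj₂ (proj₁ (proj₂ found l ≤-refl))

  ≃-sym : ∀ {x y} → x ≃ y → y ≃ x
  ≃-sym {x} {y} h ε 0<ε = ev-map (λ n → subst (ℚ._< ε) (∣p-q∣-sym (approx x n) (approx y n))) (h ε 0<ε)

  prefixInt-unique : ∀ a b (a<q : ∀ n → a n < base Q n) (b<q : ∀ n → b n < base Q n) → InfOften Q a → InfOften Q b →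
    series Q a a<q ≃ series Q b b<q → ∀ n → prefixInt a n ≡ prefixInt b n
  prefixInt-unique a b a<q b<q inf inf′ a≃b n with <-cmp (prefixInt a n) (prefixInt b n)
  ... | tri< lt _ _ = contradiction lt (prefixInt-≮ a b a<q b<q inf a≃b n)
  ... | tri≈ _ eq _ = eq
  ... | tri> _ _ gt = contradiction gt (prefixInt-≮ b a b<q a<q inf′ (≃-sym {series Q a a<q} {series Q b b<q} a≃b) n)

  digits-unique : ∀ a b (a<q : ∀ n → a n < base Q n) (b<q : ∀ n → b n < base Q n) → InfOften Q a → InfOften Q b →
    series Q a a<q ≃ series Q b b<q → a ≗ b
  digits-unique a b a<q b<q inf inf′ a≃b n = +-cancelˡ-≡ (prefixInt a n * base Q n) (a n) (b n)
    (trans (prefixInt-unique a b a<q b<q inf inf′ a≃b (suc n))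
      (cong (λ z → z * base Q n + b n) (sym (prefixInt-unique a b a<q b<q inf inf′ a≃b n))))

  -- Needed to refute membership in `N`, where the expansion comes from the opponent. Its integer
  -- part is first identified as 0, which leaves two series to compare.
  expansion-unique : ∀ a (a<q : ∀ n → a n < base Q n) → InfOften Q a → (e : Expansion Q (series Q a a<q)) → digit e ≗ a
  expansion-unique a a<q inf e n = sym (digits-unique a (digit e) a<q (digit<base e) inf (infOften e) series≃ n)
    where
    x = series Q a a<q
    int≡0 : intPart e ≡ + 0
    int≡0 = IsFloor-unique {x} (intPart-⌊⌋ e) (intPart-⌊⌋ (seriesExpansion Q a a<q inf))
    series≃ : x ≃ series Q (digit e) (digit<base e)
    series≃ ε 0<ε = ev-map (λ n → subst (λ z → ℚ.∣ partialSum Q a n ℚ.- z ∣ ℚ.< ε)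
      (trans (cong (λ z → z ℚ./ 1 ℚ.+ partialSum Q (digit e) n) int≡0) (ℚ.+-identityˡ _))) (expands e ε 0<ε)

-- Divergence, and failure of normality

occurrences-cong : ∀ {κ} (B : Vec ℕ κ) {d e : ℕ → ℕ} → d ≗ e → ∀ n → occurrences B d n ≡ occurrences B e n
occurrences-cong B {d} {e} d≗e n = trans (occurrences≡ B d n)
  (trans (sumℕ-cong n λ j _ → match-cong B λ t → d≗e (j + t)) (sym (occurrences≡ B e n)))

-- Each stage has at least one position, so a window of length d runs into at most d further stages.
stageStart-+ : ∀ k d → stageStart k + d ≤ stageStart (d + k)
stageStart-+ k zero    = ≤-reflexive (+-identityʳ (stageStart k))
stageStart-+ k (suc d) = ≤-trans (≤-reflexive (trans (+-suc (stageStart k) d) (+-comm 1 (stageStart k + d))))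
  (+-mono-≤ (stageStart-+ k d) (*-mono-≤ (m^n>0 2 (4 * (6 + (d + k)) ^ 2)) (len>0 (d + k))))

module Growth (Q : BasicSequence) (base≥ : ∀ {n} (p : Position n) → 6 + stage p ≤ base Q n)
              (base≤ : ∀ {n} (p : Position n) → base Q n ≤ (6 + stage p) ^ 3) where

  infiniteInLimit : InfiniteInLimit Q
  infiniteInLimit M = ev-stages (ev-map large (ev-≥ (proj₁ (≤-fromℕ M))))
    where
    large : ∀ k → proj₁ (≤-fromℕ M) ≤ k → ∀ {n} (p : Position n) → stage p ≡ k → M ℚ.≤ fromℕ (base Q n)
    large k le p refl = ℚ.≤-trans (proj₂ (≤-fromℕ M)) (fromℕ-mono (≤-trans le (≤-trans (m≤n+m k 6) (base≥ p))))

  -- The sum up to the end of one suitable stage, i = 6 + k, exceeds M: every window there has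
  -- product at most (i+κ)^(3κ), and there are at least |W_i| windows. Later terms are non-negative.
  fullyDivergent : FullyDivergent Q
  fullyDivergent κ _ M = stageStart (suc k) , λ n le → ℚ.≤-trans large
    (sumℚ-mono (λ j → 1 over Q from j , κ) (λ j → over-nonNeg Q j κ) le)
    where
    M′ = proj₁ (≤-fromℕ M)
    growth = ev-shift 6 (poly≤length M′ κ (3 * κ))
    k = proj₁ growth
    Y = (6 + k + κ) ^ (3 * κ)
    instance
      Y≢0 : NonZero Y
      Y≢0 = m^n≢0 (6 + k + κ) (3 * κ)
    l = stageStart (suc k)
    window≤ : ∀ j → j < l → ∏[ base Q from j , κ ] ≤ Y
    window≤ j j< = ≤-trans (∏-≤ (base Q) ((6 + k + κ) ^ 3) j κ bound) (≤-reflexive (^-*-assoc (6 + k + κ) 3 κ))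
      where
      bound : ∀ t → t < κ → base Q (j + t) ≤ (6 + k + κ) ^ 3
      bound t t<κ = ≤-trans (base≤ (locate (j + t))) (^-monoˡ-≤ 3 (≤-trans (+-monoʳ-≤ 6 stage≤) (≤-reflexive (sym (+-assoc 6 k κ)))))
        where
        stage≤ : stage (locate (j + t)) ≤ k + κ
        stage≤ = s≤s⁻¹ (subst (stage (locate (j + t)) <_) (+-comm κ (suc k))
          (stage< (locate (j + t)) (<-≤-trans (+-mono-< j< t<κ) (stageStart-+ (suc k) κ))))
    M′Y≤l : M′ * Y ≤ l
    M′Y≤l = ≤-trans (proj₂ growth k ≤-refl) (≤-trans (≤-reflexive (sym (len≡ k)))
      (≤-trans (m≤n*m (len k) (rep k) {{m^n≢0 2 (4 * (6 + k) ^ 2)}}) (m≤n+m _ (stageStart k))))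
    large : M ℚ.≤ expected Q κ l
    large = begin
      M                                          ≤⟨ proj₂ (≤-fromℕ M) ⟩
      fromℕ M′                                   ≤⟨ /-≤ {M′} {l * 1} {1} {Y} (≤-trans M′Y≤l (≤-reflexive (sym (trans (*-identityʳ (l * 1)) (*-identityʳ l))))) ⟩
      + (l * 1) ℚ./ Y                            ≡⟨ /-*-≡ l 1 1 Y Y (*-identityˡ Y) ⟨
      fromℕ l ℚ.* (+ 1 ℚ./ Y)                    ≡⟨ ℚ.+-identityˡ _ ⟨
      0ℚ ℚ.+ fromℕ l ℚ.* (+ 1 ℚ./ Y)             ≤⟨ sumℚ-≥ (λ j → 1 over Q from j , κ) (+ 1 ℚ./ Y) 0 l (λ j j< → over-≥ Q Y j κ (window≤ j j<)) ⟩
      expected Q κ l ∎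
      where open ℚ.≤-Reasoning

  zeros : ℕ → ℕ
  zeros = matchAt (0 ∷ []) digits

  -- Opaque, since otherwise stageStart would be computed at the threshold.
  opaque
    zeros-few : Eventually (λ k → ∀ m → m < rep k → 4 * (6 + k) ^ 3 * copySum zeros k m ≤ len k)
    -- A copy contains at most 2 |W_i| / 2^i zeros, and 8 i³ ≤ 2^i turns this into |W_i| / (4 i³).
    zeros-few = ev-map₂ conclude (ev-shift 6 (poly≤2^ 8 3)) (copySum-mean (0 ∷ []) 1)
      where
      arithmetic : ∀ x s c l → 8 * x ≤ s → 1 * (s * c) ≤ 2 * l → 4 * x * c ≤ l
      arithmetic x s c l h h′ = *-cancelˡ-≤ 2 (begin
        2 * (4 * x * c)    ≡⟨ regroup x c ⟩
        8 * x * c          ≤⟨ *-monoˡ-≤ c h ⟩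
        s * c              ≡⟨ *-identityˡ (s * c) ⟨
        1 * (s * c)        ≤⟨ h′ ⟩
        2 * l ∎)
        where
        open ≤-Reasoning
        regroup : ∀ x c → 2 * (4 * x * c) ≡ 8 * x * c
        regroup = solve-∀
      conclude : ∀ k → 8 * (6 + k) ^ 3 ≤ 2 ^ (6 + k) →
        (∀ m → m < rep k → 1 * (scale 1 k * copySum zeros k m) ≤ 2 * len k × 1 * len k ≤ 2 * (scale 1 k * copySum zeros k m)) →
        ∀ m → m < rep k → 4 * (6 + k) ^ 3 * copySum zeros k m ≤ len k
      conclude k h mean m m< = arithmetic ((6 + k) ^ 3) (scale 1 k) (copySum zeros k m) (len k)
        (subst (8 * (6 + k) ^ 3 ≤_) (cong (2 ^_) (sym (*-identityʳ (6 + k)))) h) (proj₁ (mean m m<))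

  private
    K = proj₁ zeros-few
    C = 4 * sumℕ zeros (stageStart K)

    1/q : ℕ → ℚ
    1/q j = 1 over Q from j , 1

  -- From stage K on, a copy adds at least |W_i| / i³ to the expected number, hence at least four
  -- times its number of zeros; C accounts for the earlier stages.
  zeros≤expected : ∀ k → K ≤ k → fromℕ (4 * sumℕ zeros (stageStart k)) ℚ.≤ fromℕ C ℚ.+ expected Q 1 (stageStart k)
  zeros≤expected k K≤k = subst X (+-identityʳ (stageStart k)) (copies-induction X K
    (p≤p+q (fromℕ C) _ (sumℚ-mono 1/q (λ j → over-nonNeg Q j 1) {0} {stageStart K} z≤n)) step k 0 K≤k z≤n)
    where
    X : ℕ → Set
    X n = fromℕ (4 * sumℕ zeros n) ℚ.≤ fromℕ C ℚ.+ expected Q 1 n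
    step : ∀ k m → K ≤ k → m < rep k → X (pos k m) → X (pos k (suc m))
    step k m K≤k m< x = begin
      fromℕ (4 * sumℕ zeros (pos k (suc m)))                     ≡⟨ cong (λ z → fromℕ (4 * z)) (sumℕ-pos zeros k m) ⟩
      fromℕ (4 * (sumℕ zeros (pos k m) + c))                     ≡⟨ trans (cong fromℕ (*-distribˡ-+ 4 (sumℕ zeros (pos k m)) c)) (fromℕ-+ (4 * sumℕ zeros (pos k m)) (4 * c)) ⟩
      fromℕ (4 * sumℕ zeros (pos k m)) ℚ.+ fromℕ (4 * c)         ≤⟨ ℚ.+-mono-≤ x few ⟩
      fromℕ C ℚ.+ expected Q 1 (pos k m) ℚ.+ fromℕ (len k) ℚ.* (+ 1 ℚ./ I)   ≡⟨ ℚ.+-assoc (fromℕ C) _ _ ⟩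
      fromℕ C ℚ.+ (expected Q 1 (pos k m) ℚ.+ fromℕ (len k) ℚ.* (+ 1 ℚ./ I)) ≤⟨ ℚ.+-monoʳ-≤ (fromℕ C) (sumℚ-≥ 1/q (+ 1 ℚ./ I) (pos k m) (len k) large) ⟩
      fromℕ C ℚ.+ expected Q 1 (pos k m + len k)                 ≡⟨ cong (λ z → fromℕ C ℚ.+ expected Q 1 z) (pos-suc k m) ⟨
      fromℕ C ℚ.+ expected Q 1 (pos k (suc m)) ∎
      where
      open ℚ.≤-Reasoning
      I = (6 + k) ^ 3
      instance
        I≢0 : NonZero I
        I≢0 = m^n≢0 (6 + k) 3
      c = copySum zeros k m
      swap : ∀ x y → 4 * x * y ≡ 4 * y * x
      swap = solve-∀
      few : fromℕ (4 * c) ℚ.≤ fromℕ (len k) ℚ.* (+ 1 ℚ./ I)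
      few = subst (fromℕ (4 * c) ℚ.≤_) (sym (/-*-≡ (len k) 1 1 I I (*-identityˡ I)))
        (/-≤ {4 * c} {len k * 1} {1} {I} (≤-trans (≤-reflexive (swap c I))
          (≤-trans (proj₂ zeros-few k K≤k m m<) (≤-reflexive (sym (trans (*-identityʳ (len k * 1)) (*-identityʳ (len k))))))))
      large : ∀ t → t < len k → + 1 ℚ./ I ℚ.≤ 1/q (pos k m + t)
      large t t< = over-≥ Q I (pos k m + t) 1 (subst (_≤ I)
        (sym (trans (*-identityˡ _) (cong (base Q) (+-identityʳ (pos k m + t))))) (base≤ (position m< t< refl)))

  -- A ratio near 1 would give u > v/2, hence 4u > 2v, whereas 4u ≤ C + v ≤ 2v as soon as v ≥ C.
  zeros-not-normal : ∀ d → d ≗ digits → ¬ Ratio→1 (λ n → fromℕ (occurrences (0 ∷ []) d n)) (expected Q 1)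
  zeros-not-normal d d≗ ratio = ℚ.<-irrefl refl (begin-strict
    z₂ ℚ.* v                     ≡⟨ doubled v ⟩
    v ℚ.+ v                      ≡⟨ cong₂ ℚ._+_ (sym (half·2 v)) (sym (half·2 v)) ⟩
    z₂ ℚ.* (ℚ.½ ℚ.* v) ℚ.+ z₂ ℚ.* (ℚ.½ ℚ.* v)  <⟨ ℚ.+-mono-< 2half 2half ⟩
    z₂ ℚ.* u ℚ.+ z₂ ℚ.* u        ≡⟨ quadruple u ⟩
    fromℕ 4 ℚ.* u                ≡⟨ 4u ⟩
    fromℕ (4 * sumℕ zeros n)     ≤⟨ zeros≤expected k (≤-trans (m≤m⊔n K L) (m≤m⊔n (K ⊔ L) (L′ ⊔ 1))) ⟩
    fromℕ C ℚ.+ v                ≤⟨ ℚ.+-monoˡ-≤ v C≤v ⟩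
    v ℚ.+ v                      ≡⟨ doubled v ⟨
    z₂ ℚ.* v ∎)
    where
    open ℚ.≤-Reasoning
    z₂ = fromℕ 2
    0<½ : 0ℚ ℚ.< ℚ.½
    0<½ = ℚ.positive⁻¹ ℚ.½
    L = proj₁ (ratio ℚ.½ 0<½)
    -- The bound C + 1 makes v positive even when C = 0.
    L′ = proj₁ (fullyDivergent 1 ≤-refl (fromℕ (suc C)))
    k = K ⊔ L ⊔ (L′ ⊔ 1)
    n = stageStart k
    u = fromℕ (occurrences (0 ∷ []) d n)
    v = expected Q 1 n
    v≥ : fromℕ (suc C) ℚ.≤ v
    v≥ = proj₂ (fullyDivergent 1 ≤-refl (fromℕ (suc C))) n
      (≤-trans (≤-trans (m≤m⊔n L′ 1) (m≤n⊔m (K ⊔ L) (L′ ⊔ 1))) (k≤stageStart k))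
    C≤v : fromℕ C ℚ.≤ v
    C≤v = ℚ.≤-trans (fromℕ-mono (n≤1+n C)) v≥
    near = proj₂ (ratio ℚ.½ 0<½) n (≤-trans (≤-trans (m≤n⊔m K L) (m≤m⊔n (K ⊔ L) (L′ ⊔ 1))) (k≤stageStart k))
    instance
      v≢0 : ℚ.NonZero v
      v≢0 = proj₁ near
      v>0 : ℚ.Positive v
      v>0 = ℚ.positive (ℚ.<-≤-trans (ℚ.positive⁻¹ (fromℕ (suc C)) {{fromℕ-pos {suc C} (s≤s z≤n)}}) v≥)
    ½<ratio : ℚ.½ ℚ.< u ℚ.÷ v
    ½<ratio = +-cancelʳ-<ℚ ℚ.½ (∣p-q∣<⇒q< {u ℚ.÷ v} {1ℚ} (proj₂ near))
    half< : ℚ.½ ℚ.* v ℚ.< u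
    half< = subst (ℚ.½ ℚ.* v ℚ.<_) (÷-* u v) (ℚ.*-monoˡ-<-pos v ½<ratio)
    2half : z₂ ℚ.* (ℚ.½ ℚ.* v) ℚ.< z₂ ℚ.* u
    2half = ℚ.*-monoʳ-<-pos z₂ half<
    half·2 : ∀ v → z₂ ℚ.* (ℚ.½ ℚ.* v) ≡ v
    half·2 v = trans (sym (ℚ.*-assoc z₂ ℚ.½ v)) (ℚ.*-identityˡ v)
    doubled : ∀ v → z₂ ℚ.* v ≡ v ℚ.+ v
    doubled v = trans (ℚ.*-distribʳ-+ v 1ℚ 1ℚ) (cong₂ ℚ._+_ (ℚ.*-identityˡ v) (ℚ.*-identityˡ v))
    quadruple : ∀ u → z₂ ℚ.* u ℚ.+ z₂ ℚ.* u ≡ fromℕ 4 ℚ.* u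
    quadruple u = sym (ℚ.*-distribʳ-+ u z₂ z₂)
    4u : fromℕ 4 ℚ.* u ≡ fromℕ (4 * sumℕ zeros n)
    4u = trans (sym (fromℕ-* 4 (occurrences (0 ∷ []) d n))) (cong (λ z → fromℕ (4 * z)) (trans (occurrences-cong (0 ∷ []) d≗ n) (occurrences≡ (0 ∷ []) digits n)))

-- Equidistribution of the orbit

/-≤⁻¹ : ∀ a b d e .{{_ : NonZero d}} .{{_ : NonZero e}} → + a ℚ./ d ℚ.≤ + b ℚ./ e → a * e ≤ b * d
/-≤⁻¹ a b d@(suc _) e@(suc _) h = ℤ.drop‿+≤+ (subst₂ ℤ._≤_ (sym (ℤ.pos-* a e)) (sym (ℤ.pos-* b d))
  (ℚᵘ.drop-*≤* (ℚᵘ.≤-respˡ-≃ (toℚᵘ-/ a d) (ℚᵘ.≤-respʳ-≃ (toℚᵘ-/ b e) (ℚ.toℚᵘ-mono-≤ h)))))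

module _ (m d : ℕ) .{{_ : NonZero m}} .{{_ : NonZero d}} where

  private
    instance
      m*d≢0 : NonZero (m * d)
      m*d≢0 = m*n≢0 m d

    common : ∀ s c → + s ℚ./ m ℚ.+ + c ℚ./ d ≡ + (d * s + c * m) ℚ./ (m * d)
    common s c = trans (cong₂ ℚ._+_ (/-≡ {s} {d * s} {m} {m * d} (e₁ s m d)) (/-≡ {c} {c * m} {d} {m * d} (e₂ c m d)))
      (/-+ (d * s) (c * m) (m * d))
      where
      e₁ : ∀ s m d → s * (m * d) ≡ d * s * m
      e₁ = solve-∀
      e₂ : ∀ c m d → c * (m * d) ≡ c * m * d
      e₂ = solve-∀

    e₃ : ∀ x m d → x * m * d ≡ x * (m * d)
    e₃ = solve-∀

  sum≤/ : ∀ s c g → d * s + c * m ≤ g * m → + s ℚ./ m ℚ.+ + c ℚ./ d ℚ.≤ + g ℚ./ d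
  sum≤/ s c g h = subst (ℚ._≤ + g ℚ./ d) (sym (common s c))
    (/-≤ {d * s + c * m} {g} {m * d} {d} (≤-trans (*-monoˡ-≤ d h) (≤-reflexive (e₃ g m d))))

  /≤sum : ∀ s c g → g * m ≤ d * s + c * m → + g ℚ./ d ℚ.≤ + s ℚ./ m ℚ.+ + c ℚ./ d
  /≤sum s c g h = subst (+ g ℚ./ d ℚ.≤_) (sym (common s c))
    (/-≤ {g} {d * s + c * m} {d} {m * d} (≤-trans (≤-reflexive (sym (e₃ g m d))) (*-monoˡ-≤ d h)))

  /≤sum⁻¹ : ∀ s c g → + g ℚ./ d ℚ.≤ + s ℚ./ m ℚ.+ + c ℚ./ d → g * m ≤ d * s + c * m
  /≤sum⁻¹ s c g h = *-cancelʳ-≤ (g * m) (d * s + c * m) d (≤-trans (≤-reflexive (e₃ g m d))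
    (/-≤⁻¹ g (d * s + c * m) d (m * d) (subst (+ g ℚ./ d ℚ.≤_) (common s c) h)))

-- Reals located on a grid of mesh 1/D.

module Grid (D : ℕ) .{{_ : NonZero D}} where

  grid : ℕ → ℚ
  grid n = + n ℚ./ D

  grid-+ : ∀ a b → grid (a + b) ≡ grid a ℚ.+ grid b
  grid-+ a b = sym (/-+ a b D)

  grid-mono : ∀ {a b} → a ≤ b → grid a ℚ.≤ grid b
  grid-mono {a} {b} a≤b = /-≤ {a} {b} {D} {D} (*-monoˡ-≤ D a≤b)

  grid-pos : ∀ n → 0ℚ ℚ.< grid (suc n)
  grid-pos n = ℚ.positive⁻¹ (grid (suc n)) {{ℚ.normalize-pos (suc n) D}}

  grid-D : grid D ≡ 1ℚ
  grid-D = /-≡ {D} {1} {D} {1} (trans (*-identityʳ D) (sym (*-identityˡ D)))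

  locate-in-grid : ∀ n r → 0ℚ ℚ.≤ r → r ℚ.< grid (suc n) → ∃[ α ] α ≤ n × grid α ℚ.≤ r × r ℚ.< grid (suc α)
  locate-in-grid zero    r 0≤r r< = 0 , z≤n , subst (ℚ._≤ r) (/-≡ {0} {0} {1} {D} refl) 0≤r , r<
  locate-in-grid (suc n) r 0≤r r< with r ℚ.<? grid (suc n)
  ... | yes lt = let (α , α≤n , rest) = locate-in-grid n r 0≤r lt in α , m≤n⇒m≤1+n α≤n , rest
  ... | no  ge = suc n , ≤-refl , ℚ.≮⇒≥ ge , r<

  -- Real comparison being undecidable, x is placed only in [(α-2)/D , (α+1)/D], three mesh widths
  -- instead of one.
  Near : ℝ → ℕ → Set
  Near x α = Eventually (λ n → grid α ℚ.≤ approx x n ℚ.+ grid 2 × approx x n ℚ.≤ grid (α + 1))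

  near : ∀ x → fromℚ 0ℚ ≤ᴿ x → x ≤ᴿ fromℚ 1ℚ → ∃[ α ] α ≤ D + 2 × Near x α
  near x 0≤x x≤1 = α , proj₁ (proj₂ found) , n₀ , λ n le →
      ℚ.≤-trans (proj₁ (proj₂ (proj₂ found))) (subst₂ ℚ._≤_ refl (regroup (approx x n)) (ℚ.+-monoˡ-≤ δ (ℚ.<⇒≤ (∣p-q∣<⇒q< {approx x n} {x₀} {δ} (close n le))))) ,
      ℚ.<⇒≤ (ℚ.<-trans (∣p-q∣<⇒p< {approx x n} {x₀} {δ} (close n le)) (subst (λ z → r ℚ.< grid z) (+-comm 1 α) (proj₂ (proj₂ (proj₂ found)))))
    where
    δ = grid 1
    ready = ev-map₂ (λ _ → _,_) (0≤x δ (grid-pos 0)) (x≤1 δ (grid-pos 0))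
    n₀ = proj₁ ready ⊔ proj₁ (cauchy x δ (grid-pos 0))
    x₀ = approx x n₀
    -- The approximation `x₀` may be slightly negative; only `x₀ ℚ.+ δ` is known to be at least 0,
    -- so the grid cell of the latter is taken.
    r = x₀ ℚ.+ δ
    0≤r = proj₁ (proj₂ ready n₀ (m≤m⊔n _ _))
    x₀≤ = proj₂ (proj₂ ready n₀ (m≤m⊔n _ _))
    close : ∀ n → n₀ ≤ n → ℚ.∣ approx x n ℚ.- x₀ ∣ ℚ.< δ
    close n le = proj₂ (cauchy x δ (grid-pos 0)) n n₀ (≤-trans (m≤n⊔m (proj₁ ready) _) le) (m≤n⊔m (proj₁ ready) _)
    regroup : ∀ z → z ℚ.+ δ ℚ.+ δ ≡ z ℚ.+ grid 2
    regroup z = trans (ℚ.+-assoc z δ δ) (cong (z ℚ.+_) (sym (grid-+ 1 1)))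
    r< : r ℚ.< grid (suc (D + 2))
    r< = ℚ.≤-<-trans (ℚ.≤-trans (ℚ.+-monoˡ-≤ δ x₀≤) (ℚ.≤-reflexive
        (trans (regroup 1ℚ) (trans (cong (ℚ._+ grid 2) (sym grid-D)) (sym (grid-+ D 2))))))
      (subst₂ ℚ._<_ (ℚ.+-identityʳ (grid (D + 2))) (trans (sym (grid-+ (D + 2) 1)) (cong grid (+-comm (D + 2) 1)))
        (ℚ.+-monoʳ-< (grid (D + 2)) (grid-pos 0)))
    found = locate-in-grid (D + 2) r 0≤r r<
    α = proj₁ found

∣S∣≤sumℕ : ∀ {m} (S : Subset m) (f : ℕ → ℕ) → (∀ n → n Subset.∈ S → 1 ≤ f (toℕ n)) → Subset.∣ S ∣ ≤ sumℕ f m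
∣S∣≤sumℕ []                    f h = z≤n
∣S∣≤sumℕ {suc m} (inside  ∷ S) f h = ≤-trans (+-mono-≤ (h Fin.zero Vec.here) (∣S∣≤sumℕ S (f ∘ suc) λ n n∈ → h (Fin.suc n) (Vec.there n∈)))
  (≤-reflexive (sym (sumℕ-head f m)))
∣S∣≤sumℕ {suc m} (outside ∷ S) f h = ≤-trans (≤-trans (∣S∣≤sumℕ S (f ∘ suc) λ n n∈ → h (Fin.suc n) (Vec.there n∈)) (m≤n+m _ (f 0)))
  (≤-reflexive (sym (sumℕ-head f m)))

-- The n-th orbit point has fractional part in [j/i , (j+2)/i], and j/i is
-- equidistributed in the sense of density; tally D α β counts at least
-- those n for which [j/i , (j+2)/i] meets [α/D , β/D].
module Equidistribution
  (Q : BasicSequence) (a : ℕ → ℕ) (a<q : ∀ n → a n < base Q n) (inf : InfOften Q a)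
  (tally : (D α β n : ℕ) → ℕ)
  -- The first alternative is for orbit points without a known cell: they enter every tally, which
  -- keeps each tally an upper bound.
  (cell : ∀ n → (∀ D α β → 1 ≤ tally D α β n) ⊎
    (∃[ i ] ∃[ j ] NonZero i × j ≤ i × j * base Q n ≤ a n * i × suc (a n) * i ≤ (j + 2) * base Q n ×
      (∀ D α β → α * i ≤ D * (j + 2) → D * j ≤ β * i → 1 ≤ tally D α β n)))
  (density : ∀ D α β → α ≤ β → Eventually (λ m → D * sumℕ (tally D α β) m + α * m ≤ (β + 2) * m))
  where

  orbit : ℕ → ℝ
  orbit n = ∏[ base Q from 0 , n ] · series Q a a<q

  private
    ⌊orbit⌋ : ℕ → ℚ
    ⌊orbit⌋ n = fromℕ (prefixInt Q a n)

    instance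
      q≢0 : ∀ {n} → NonZero (base Q n)
      q≢0 {n} = base-nonZero Q n

  module _ (n i j : ℕ) .{{_ : NonZero i}}
           (lower : j * base Q n ≤ a n * i) (upper : suc (a n) * i ≤ (j + 2) * base Q n) where

    orbit-≥ : ∀ l → suc n ≤ l → ⌊orbit⌋ n ℚ.+ + j ℚ./ i ℚ.≤ approx (orbit n) l
    orbit-≥ l le = ℚ.≤-trans (ℚ.+-monoʳ-≤ (⌊orbit⌋ n) (/-≤ {j} {a n} {i} {base Q n} lower)) (shifted-lower Q a a<q inf n l le)

    orbit-≤ : ∀ l → suc n ≤ l → approx (orbit n) l ℚ.≤ ⌊orbit⌋ n ℚ.+ + (j + 2) ℚ./ i
    orbit-≤ l le = ℚ.≤-trans (shifted-upper Q a a<q inf n l le) (ℚ.+-monoʳ-≤ (⌊orbit⌋ n) (/-≤ {suc (a n)} {j + 2} {base Q n} {i} upper))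

  frac-≥ : ∀ {K x y} → K ℚ.+ x ℚ.≤ y → x ℚ.≤ y ℚ.- K
  frac-≥ {K} {x} {y} h = +-cancelʳ-≤ℚ K (subst₂ ℚ._≤_ (ℚ.+-comm K x) (sym (p-q+q y K)) h)

  frac-≤ : ∀ {K x y} → y ℚ.≤ K ℚ.+ x → y ℚ.- K ℚ.≤ x
  frac-≤ {K} {x} {y} = ≤-minus {y} {K} {x}

  module _ (x y : ℝ) (D α β : ℕ) .{{_ : NonZero D}} 
           (near-x : Grid.Near D x α) (near-y : Grid.Near D y β) where

    open Grid D

    module _ (n i j : ℕ) .{{_ : NonZero i}}
             (lower : j * base Q n ≤ a n * i) (upper : suc (a n) * i ≤ (j + 2) * base Q n) where

      -- Uniqueness of the floor identifies the fractional part. On the left 3 = 2 + 1, from `Near`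
      -- and from the tolerance in `≤ᴿ`; on the right `Near` costs 1.
      inside-cell : orbit n ∈ FracIn[ x , y ⟩ → (α ∸ 3) * i ≤ D * (j + 2) × D * j ≤ (β + 1) * i
      inside-cell (z , floor , x≤z , ε , 0<ε , <yz) = left , right
        where
        z≡ : z ≡ + prefixInt Q a n
        z≡ = IsFloor-unique {orbit n} floor (shifted-floor Q a a<q inf n)
        x≤ : x ≤ᴿ orbit n -ᴿ fromℤ (+ prefixInt Q a n)
        x≤ = subst (λ z → x ≤ᴿ orbit n -ᴿ fromℤ z) z≡ x≤z
        <y : Eventually (λ l → approx (orbit n -ᴿ fromℤ (+ prefixInt Q a n)) l ℚ.+ ε ℚ.≤ approx y l)
        <y = subst (λ z → Eventually (λ l → approx (orbit n -ᴿ fromℤ z) l ℚ.+ ε ℚ.≤ approx y l)) z≡ <yz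
        ready = ev-map₂ (λ _ → _,_) (ev-map₂ (λ _ → _,_) near-x near-y)
          (ev-map₂ (λ _ → _,_) (ev-map₂ (λ _ → _,_) (x≤ (grid 1) (grid-pos 0)) <y) (ev-≥ (suc n)))
        l = proj₁ ready
        at-l = proj₂ ready l ≤-refl
        n<l = proj₂ (proj₂ at-l)
        α≤ : grid α ℚ.≤ + (j + 2) ℚ./ i ℚ.+ grid 3
        α≤ = begin
          grid α                                              ≤⟨ proj₁ (proj₁ (proj₁ at-l)) ⟩
          approx x l ℚ.+ grid 2                               ≤⟨ ℚ.+-monoˡ-≤ (grid 2) (proj₁ (proj₁ (proj₂ at-l))) ⟩
          approx (orbit n) l ℚ.- ⌊orbit⌋ n ℚ.+ grid 1 ℚ.+ grid 2
            ≤⟨ ℚ.+-monoˡ-≤ (grid 2) (ℚ.+-monoˡ-≤ (grid 1) (frac-≤ {⌊orbit⌋ n} {+ (j + 2) ℚ./ i} {approx (orbit n) l} (orbit-≤ n i j lower upper l n<l))) ⟩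
          + (j + 2) ℚ./ i ℚ.+ grid 1 ℚ.+ grid 2               ≡⟨ trans (ℚ.+-assoc (+ (j + 2) ℚ./ i) (grid 1) (grid 2)) (cong (+ (j + 2) ℚ./ i ℚ.+_) (sym (grid-+ 1 2))) ⟩
          + (j + 2) ℚ./ i ℚ.+ grid 3 ∎
          where open ℚ.≤-Reasoning
        left : (α ∸ 3) * i ≤ D * (j + 2)
        left = ≤-trans (≤-reflexive (*-distribʳ-∸ i α 3)) (≤-trans (∸-monoˡ-≤ (3 * i) (/≤sum⁻¹ i D (j + 2) 3 α α≤))
          (≤-reflexive (m+n∸n≡m (D * (j + 2)) (3 * i))))
        ≤β : + j ℚ./ i ℚ.≤ grid (β + 1)
        ≤β = begin
          + j ℚ./ i                                   ≤⟨ frac-≥ {⌊orbit⌋ n} {+ j ℚ./ i} {approx (orbit n) l} (orbit-≥ n i j lower upper l n<l) ⟩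
          approx (orbit n) l ℚ.- ⌊orbit⌋ n            ≤⟨ p≤p+q (approx (orbit n) l ℚ.- ⌊orbit⌋ n) ε (ℚ.<⇒≤ 0<ε) ⟩
          approx (orbit n) l ℚ.- ⌊orbit⌋ n ℚ.+ ε      ≤⟨ proj₂ (proj₁ (proj₂ at-l)) ⟩
          approx y l                                  ≤⟨ proj₂ (proj₂ (proj₁ at-l)) ⟩
          grid (β + 1) ∎
          where open ℚ.≤-Reasoning
        right : D * j ≤ (β + 1) * i
        right = ≤-trans (≤-reflexive (*-comm D j)) (/-≤⁻¹ j (β + 1) i D ≤β)

      -- Of the three grid steps kept free on the right, two make up for the inexactness of `Near`
      -- and one is the margin that the strict inequality `<ᴿ` demands.
      cell-inside : (α + 1) * i ≤ D * j → D * (j + 2) + 3 * i ≤ β * i → orbit n ∈ FracIn[ x , y ⟩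
      cell-inside α≤j j≤β = + prefixInt Q a n , shifted-floor Q a a<q inf n ,
        (λ ε 0<ε → ev-map₂ (λ l nx n<l → ℚ.≤-trans (x≤ l nx n<l) (p≤p+q (approx (orbit n) l ℚ.- ⌊orbit⌋ n) ε (ℚ.<⇒≤ 0<ε))) near-x (ev-≥ (suc n))) ,
        grid 1 , grid-pos 0 , ev-map₂ <y near-y (ev-≥ (suc n))
        where
        open ℚ.≤-Reasoning
        x≤ : ∀ l → grid α ℚ.≤ approx x l ℚ.+ grid 2 × approx x l ℚ.≤ grid (α + 1) → suc n ≤ l →
             approx x l ℚ.≤ approx (orbit n) l ℚ.- ⌊orbit⌋ n
        x≤ l nx n<l = begin
          approx x l                            ≤⟨ proj₂ nx ⟩
          grid (α + 1)                          ≤⟨ /-≤ {α + 1} {j} {D} {i} (≤-trans α≤j (≤-reflexive (*-comm D j))) ⟩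
          + j ℚ./ i                             ≤⟨ frac-≥ {⌊orbit⌋ n} {+ j ℚ./ i} {approx (orbit n) l} (orbit-≥ n i j lower upper l n<l) ⟩
          approx (orbit n) l ℚ.- ⌊orbit⌋ n ∎
        <y : ∀ l → grid β ℚ.≤ approx y l ℚ.+ grid 2 × approx y l ℚ.≤ grid (β + 1) → suc n ≤ l →
             approx (orbit n) l ℚ.- ⌊orbit⌋ n ℚ.+ grid 1 ℚ.≤ approx y l
        <y l ny n<l = +-cancelʳ-≤ℚ (grid 2) (begin
          approx (orbit n) l ℚ.- ⌊orbit⌋ n ℚ.+ grid 1 ℚ.+ grid 2
            ≡⟨ trans (ℚ.+-assoc (approx (orbit n) l ℚ.- ⌊orbit⌋ n) (grid 1) (grid 2)) (cong (approx (orbit n) l ℚ.- ⌊orbit⌋ n ℚ.+_) (sym (grid-+ 1 2))) ⟩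
          approx (orbit n) l ℚ.- ⌊orbit⌋ n ℚ.+ grid 3  ≤⟨ ℚ.+-monoˡ-≤ (grid 3) (frac-≤ {⌊orbit⌋ n} {+ (j + 2) ℚ./ i} {approx (orbit n) l} (orbit-≤ n i j lower upper l n<l)) ⟩
          + (j + 2) ℚ./ i ℚ.+ grid 3                   ≤⟨ sum≤/ i D (j + 2) 3 β j≤β ⟩
          grid β                                       ≤⟨ proj₁ ny ⟩
          approx y l ℚ.+ grid 2 ∎)

    tally-inside : ∀ n → orbit n ∈ FracIn[ x , y ⟩ → 1 ≤ tally D (α ∸ 3) (β + 1) n
    tally-inside n u∈ = [ (λ always → always D (α ∸ 3) (β + 1)) ,
      (λ (i , j , i≢0 , _ , lower , upper , counted) →
        let (left , right) = inside-cell n i j {{i≢0}} lower upper u∈ in counted D (α ∸ 3) (β + 1) left right) ]′ (cell n)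

    -- The two integer conditions of `cell-inside` are decidable although membership is not. They
    -- cannot both hold; the failure of one puts the cell in contact with [0 , (α+1)/D], that of the
    -- other with [(β-3)/D , 1].
    tally-outside : ∀ n → ¬ orbit n ∈ FracIn[ x , y ⟩ → 1 ≤ tally D 0 (α + 1) n + tally D (β ∸ 3) D n
    tally-outside n u∉ = [ (λ always → ≤-trans (always D 0 (α + 1)) (m≤m+n (tally D 0 (α + 1) n) (tally D (β ∸ 3) D n))) ,
      (λ (i , j , i≢0 , j≤i , lower , upper , counted) →
        outside-cell i j j≤i counted (λ α≤j j≤β → u∉ (cell-inside n i j {{i≢0}} lower upper α≤j j≤β))
          ((α + 1) * i ≤? D * j) (D * (j + 2) + 3 * i ≤? β * i)) ]′ (cell n)
      where
      outside-cell : ∀ i j → j ≤ i → (∀ D α β → α * i ≤ D * (j + 2) → D * j ≤ β * i → 1 ≤ tally D α β n) →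
        ((α + 1) * i ≤ D * j → D * (j + 2) + 3 * i ≤ β * i → ⊥) →
        Dec ((α + 1) * i ≤ D * j) → Dec (D * (j + 2) + 3 * i ≤ β * i) → 1 ≤ tally D 0 (α + 1) n + tally D (β ∸ 3) D n
      outside-cell i j j≤i counted absurd (no j<α) _ =
        ≤-trans (counted D 0 (α + 1) z≤n (<⇒≤ (≰⇒> j<α))) (m≤m+n (tally D 0 (α + 1) n) (tally D (β ∸ 3) D n))
      outside-cell i j j≤i counted absurd (yes α≤j) (yes j≤β) = contradiction j≤β (absurd α≤j)
      outside-cell i j j≤i counted absurd (yes _) (no β<j) =
        ≤-trans (counted D (β ∸ 3) D left (*-monoʳ-≤ D j≤i)) (m≤n+m (tally D (β ∸ 3) D n) (tally D 0 (α + 1) n))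
        where
        left : (β ∸ 3) * i ≤ D * (j + 2)
        left = ≤-trans (≤-reflexive (*-distribʳ-∸ i β 3)) (≤-trans (∸-monoˡ-≤ (3 * i) (<⇒≤ (≰⇒> β<j)))
          (≤-reflexive (m+n∸n≡m (D * (j + 2)) (3 * i))))

    -- The grid indices may be out of order by the errors of `Near`. This bound gives
    -- `α ∸ 3 ≤ β + 1`, the order that `density` asks for.
    α≤β+3 : x <ᴿ y → α ≤ β + 3
    α≤β+3 (ε , 0<ε , x<y) = *-cancelʳ-≤ α (β + 3) D (/-≤⁻¹ α (β + 3) D D (begin
      grid α                      ≤⟨ proj₁ (proj₁ (proj₁ at-l)) ⟩
      approx x l ℚ.+ grid 2       ≤⟨ ℚ.+-monoˡ-≤ (grid 2) (ℚ.≤-trans (p≤p+q (approx x l) ε (ℚ.<⇒≤ 0<ε)) (proj₂ at-l)) ⟩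
      approx y l ℚ.+ grid 2       ≤⟨ ℚ.+-monoˡ-≤ (grid 2) (proj₂ (proj₂ (proj₁ at-l))) ⟩
      grid (β + 1) ℚ.+ grid 2     ≡⟨ trans (sym (grid-+ (β + 1) 2)) (cong grid (+-assoc β 1 2)) ⟩
      grid (β + 3) ∎))
      where
      open ℚ.≤-Reasoning
      ready = ev-map₂ (λ _ → _,_) (ev-map₂ (λ _ → _,_) near-x near-y) x<y
      l = proj₁ ready
      at-l = proj₂ ready l ≤-refl

    -- Replacing α/D and β/D by x and y costs 1 + 2 further grid steps in each direction, so that 6
    -- and 8 become 9 and 11.
    discrepancy : ∀ w → w ℚ.+ grid α ℚ.≤ grid (β + 6) → grid β ℚ.≤ w ℚ.+ grid (α + 8) →
      Eventually (λ n → ℚ.∣ w ℚ.- (approx y n ℚ.- approx x n) ∣ ℚ.≤ grid 11)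
    discrepancy w w≤ w≥ = ev-map₂ close near-x near-y
      where
      open ℚ.≤-Reasoning
      open +-*-Solver using (solve; _:+_; _:-_; _:=_)
      r₁ : ∀ w A t → w ℚ.+ (A ℚ.+ t) ≡ (w ℚ.+ A) ℚ.+ t
      r₁ = solve 3 (λ w A t → w :+ (A :+ t) := (w :+ A) :+ t) refl
      r₂ : ∀ r l t → r ℚ.+ t ≡ ((r ℚ.- l) ℚ.+ t) ℚ.+ l
      r₂ = solve 3 (λ r l t → r :+ t := ((r :- l) :+ t) :+ l) refl
      r₃ : ∀ w l s t → w ℚ.+ (l ℚ.+ s) ℚ.+ t ≡ (w ℚ.+ (s ℚ.+ t)) ℚ.+ l
      r₃ = solve 4 (λ w l s t → w :+ (l :+ s) :+ t := (w :+ (s :+ t)) :+ l) refl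
      close : ∀ n → grid α ℚ.≤ approx x n ℚ.+ grid 2 × approx x n ℚ.≤ grid (α + 1) →
        grid β ℚ.≤ approx y n ℚ.+ grid 2 × approx y n ℚ.≤ grid (β + 1) →
        ℚ.∣ w ℚ.- (approx y n ℚ.- approx x n) ∣ ℚ.≤ grid 11
      close n (α≤x , x≤α) (β≤y , y≤β) = ∣p-q∣≤ {w} {approx y n ℚ.- approx x n} {grid 11}
        (+-cancelʳ-≤ℚ (approx x n) (begin
          w ℚ.+ approx x n                       ≤⟨ ℚ.+-monoʳ-≤ w x≤α ⟩
          w ℚ.+ grid (α + 1)                     ≡⟨ trans (cong (w ℚ.+_) (grid-+ α 1)) (r₁ w (grid α) (grid 1)) ⟩
          w ℚ.+ grid α ℚ.+ grid 1                ≤⟨ ℚ.+-monoˡ-≤ (grid 1) w≤ ⟩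
          grid (β + 6) ℚ.+ grid 1                ≡⟨ trans (sym (grid-+ (β + 6) 1)) (trans (cong grid (+-assoc β 6 1)) (grid-+ β 7)) ⟩
          grid β ℚ.+ grid 7                      ≤⟨ ℚ.+-monoˡ-≤ (grid 7) β≤y ⟩
          approx y n ℚ.+ grid 2 ℚ.+ grid 7       ≡⟨ trans (ℚ.+-assoc (approx y n) (grid 2) (grid 7)) (cong (approx y n ℚ.+_) (sym (grid-+ 2 7))) ⟩
          approx y n ℚ.+ grid 9                  ≤⟨ ℚ.+-monoʳ-≤ (approx y n) (grid-mono {9} {11} (m≤m+n 9 2)) ⟩
          approx y n ℚ.+ grid 11                 ≡⟨ r₂ (approx y n) (approx x n) (grid 11) ⟩
          ((approx y n ℚ.- approx x n) ℚ.+ grid 11) ℚ.+ approx x n ∎))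
        (+-cancelʳ-≤ℚ (approx x n) (begin
          (approx y n ℚ.- approx x n) ℚ.+ approx x n  ≡⟨ p-q+q (approx y n) (approx x n) ⟩
          approx y n                             ≤⟨ y≤β ⟩
          grid (β + 1)                           ≡⟨ grid-+ β 1 ⟩
          grid β ℚ.+ grid 1                      ≤⟨ ℚ.+-monoˡ-≤ (grid 1) w≥ ⟩
          w ℚ.+ grid (α + 8) ℚ.+ grid 1          ≡⟨ trans (sym (r₁ w (grid (α + 8)) (grid 1))) (cong (w ℚ.+_) (trans (sym (grid-+ (α + 8) 1)) (trans (cong grid (+-assoc α 8 1)) (grid-+ α 9)))) ⟩
          w ℚ.+ (grid α ℚ.+ grid 9)              ≤⟨ ℚ.+-monoʳ-≤ w (ℚ.+-monoˡ-≤ (grid 9) α≤x) ⟩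
          w ℚ.+ (approx x n ℚ.+ grid 2 ℚ.+ grid 9) ≡⟨ r₁ w (approx x n ℚ.+ grid 2) (grid 9) ⟩
          w ℚ.+ (approx x n ℚ.+ grid 2) ℚ.+ grid 9 ≡⟨ r₃ w (approx x n) (grid 2) (grid 9) ⟩
          w ℚ.+ (grid 2 ℚ.+ grid 9) ℚ.+ approx x n ≡⟨ cong (λ z → w ℚ.+ z ℚ.+ approx x n) (sym (grid-+ 2 9)) ⟩
          w ℚ.+ grid 11 ℚ.+ approx x n ∎))

    module _ (x<y : x <ᴿ y) (β≤ : β ≤ D + 2) where

      private
        T₁ T₂ T₃ : ℕ → ℕ
        T₁ = sumℕ (tally D (α ∸ 3) (β + 1))
        T₂ = sumℕ (tally D 0 (α + 1))
        T₃ = sumℕ (tally D (β ∸ 3) D)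

        -- The 6 consists of 3 for lowering α, 1 for raising β and 2 from the density bound.
        upper-bound : ∀ m s → s ≤ T₁ m → D * T₁ m + (α ∸ 3) * m ≤ (β + 1 + 2) * m → D * s + α * m ≤ (β + 6) * m
        upper-bound m s s≤ dense = begin
          D * s + α * m                       ≤⟨ +-mono-≤ (*-monoʳ-≤ D s≤) (*-monoˡ-≤ m (m≤n+m∸n α 3)) ⟩
          D * T₁ m + (3 + (α ∸ 3)) * m        ≡⟨ regroup (D * T₁ m) (α ∸ 3) m ⟩
          D * T₁ m + (α ∸ 3) * m + 3 * m      ≤⟨ +-monoˡ-≤ (3 * m) dense ⟩
          (β + 1 + 2) * m + 3 * m             ≡⟨ collect β m ⟩
          (β + 6) * m ∎
          where
          open ≤-Reasoning
          regroup : ∀ t a m → t + (3 + a) * m ≡ t + a * m + 3 * m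
          regroup = solve-∀
          collect : ∀ b m → (b + 1 + 2) * m + 3 * m ≡ (b + 6) * m
          collect = solve-∀

        -- Few points outside mean many inside: [0 , (α+1)/D] and [(β-3)/D , 1] are estimated from
        -- above. The 8 is 1 + 2 from the first interval and 3 + 2 from the second.
        lower-bound : ∀ m s → m ∸ s ≤ T₂ m + T₃ m → D * T₂ m + 0 * m ≤ (α + 1 + 2) * m →
          D * T₃ m + (β ∸ 3) * m ≤ (D + 2) * m → β * m ≤ D * s + (α + 8) * m
        lower-bound m s few dense₂ dense₃ = +-cancelˡ-≤ (D * m) _ _ (begin
          D * m + β * m
            ≤⟨ +-mono-≤ (*-monoʳ-≤ D (≤-trans (m≤n+m∸n m s) (+-monoʳ-≤ s few))) (*-monoˡ-≤ m (m≤n+m∸n β 3)) ⟩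
          D * (s + (T₂ m + T₃ m)) + (3 + (β ∸ 3)) * m
            ≡⟨ regroup D s (T₂ m) (T₃ m) (β ∸ 3) m ⟩
          D * s + 3 * m + ((D * T₂ m + 0 * m) + (D * T₃ m + (β ∸ 3) * m))
            ≤⟨ +-monoʳ-≤ (D * s + 3 * m) (+-mono-≤ dense₂ dense₃) ⟩
          D * s + 3 * m + ((α + 1 + 2) * m + (D + 2) * m)
            ≡⟨ collect D s α m ⟩
          D * m + (D * s + (α + 8) * m) ∎)
          where
          open ≤-Reasoning
          regroup : ∀ D s t u b m → D * (s + (t + u)) + (3 + b) * m ≡ D * s + 3 * m + ((D * t + 0 * m) + (D * u + b * m))
          regroup = solve-∀
          collect : ∀ D s a m → D * s + 3 * m + ((a + 1 + 2) * m + (D + 2) * m) ≡ D * m + (D * s + (a + 8) * m)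
          collect = solve-∀

      equidistributed : Eventually (λ m → .{{_ : NonZero m}} → (S : Subset m) →
        (∀ n → (n Subset.∈ S) ⇔ (orbit (toℕ n) ∈ FracIn[ x , y ⟩)) →
        Eventually (λ n → ℚ.∣ + Subset.∣ S ∣ ℚ./ m ℚ.- (approx y n ℚ.- approx x n) ∣ ℚ.≤ grid 11))
      equidistributed = ev-map₂ conclude (density D (α ∸ 3) (β + 1) α∸3≤β+1)
        (ev-map₂ (λ _ → _,_) (density D 0 (α + 1) z≤n) (density D (β ∸ 3) D β∸3≤D))
        where
        α∸3≤β+1 : α ∸ 3 ≤ β + 1
        α∸3≤β+1 = ≤-trans (∸-monoˡ-≤ 3 (α≤β+3 x<y)) (≤-trans (≤-reflexive (m+n∸n≡m β 3)) (m≤m+n β 1))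
        β∸3≤D : β ∸ 3 ≤ D
        β∸3≤D = ≤-trans (∸-monoˡ-≤ 3 (≤-trans β≤ (+-monoʳ-≤ D (n≤1+n 2)))) (≤-reflexive (m+n∸n≡m D 3))
        conclude : ∀ m → D * T₁ m + (α ∸ 3) * m ≤ (β + 1 + 2) * m →
          (D * T₂ m + 0 * m ≤ (α + 1 + 2) * m) × (D * T₃ m + (β ∸ 3) * m ≤ (D + 2) * m) →
          .{{_ : NonZero m}} → (S : Subset m) → (∀ n → (n Subset.∈ S) ⇔ (orbit (toℕ n) ∈ FracIn[ x , y ⟩)) →
          Eventually (λ n → ℚ.∣ + Subset.∣ S ∣ ℚ./ m ℚ.- (approx y n ℚ.- approx x n) ∣ ℚ.≤ grid 11)
        conclude m dense₁ (dense₂ , dense₃) S S⇔ = discrepancy (+ Subset.∣ S ∣ ℚ./ m)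
          (sum≤/ m D Subset.∣ S ∣ α (β + 6) (upper-bound m Subset.∣ S ∣ inside≤ dense₁))
          (/≤sum m D Subset.∣ S ∣ (α + 8) β (lower-bound m Subset.∣ S ∣ outside≤ dense₂ dense₃))
          where
          inside≤ : Subset.∣ S ∣ ≤ T₁ m
          inside≤ = ∣S∣≤sumℕ S _ (λ n n∈ → tally-inside (toℕ n) (Equivalence.to (S⇔ n) n∈))
          outside≤ : m ∸ Subset.∣ S ∣ ≤ T₂ m + T₃ m
          outside≤ = subst₂ _≤_ (Subset.∣∁p∣≡n∸∣p∣ S) (sumℕ-+ (tally D 0 (α + 1)) (tally D (β ∸ 3) D) m)
            (∣S∣≤sumℕ (∁ S) _ (λ n n∈ → tally-outside (toℕ n) (λ u∈ → Subset.x∈∁p⇒x∉p n∈ (Equivalence.from (S⇔ n) u∈))))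

  <ᴿ⇒≤ᴿ : ∀ {x y} → x <ᴿ y → x ≤ᴿ y
  <ᴿ⇒≤ᴿ {x} {y} (δ , 0<δ , K , h) ε 0<ε = K , λ n le → ℚ.≤-trans (p≤p+q (approx x n) δ (ℚ.<⇒≤ 0<δ))
    (ℚ.≤-trans (h n le) (p≤p+q (approx y n) ε (ℚ.<⇒≤ 0<ε)))

  ≤ᴿ-trans : ∀ {x y z} → x ≤ᴿ y → y ≤ᴿ z → x ≤ᴿ z
  ≤ᴿ-trans {x} {y} {z} h h′ ε 0<ε = ev-map₂ (λ n p p′ → ℚ.≤-trans p (ℚ.≤-trans (ℚ.+-monoˡ-≤ (ℚ.½ ℚ.* ε) p′)
      (ℚ.≤-reflexive (trans (ℚ.+-assoc (approx z n) _ _) (cong (approx z n ℚ.+_) (half+half ε))))))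
    (h (ℚ.½ ℚ.* ε) (half ε 0<ε)) (h′ (ℚ.½ ℚ.* ε) (half ε 0<ε))

  uniformlyDistributed : UniformlyDistributedMod1 orbit
  uniformlyDistributed x y 0≤x x<y y≤1 ε 0<ε = proj₁ eventual , λ m le S S⇔ →
    grid 1 , grid-pos 0 , ev-map (λ n close → begin
        ℚ.∣ + Subset.∣ S ∣ ℚ./ m ℚ.- (approx y n ℚ.- approx x n) ∣ ℚ.+ grid 1   ≤⟨ ℚ.+-monoˡ-≤ (grid 1) close ⟩
        grid 11 ℚ.+ grid 1    ≡⟨ grid-+ 11 1 ⟨
        grid 12               ≡⟨ /-≡ {12} {1} {D} {suc K} (sym (*-identityˡ D)) ⟩
        + 1 ℚ./ suc K         <⟨ proj₂ (archimedean ε 0<ε) ⟩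
        ε ∎ ) (proj₂ eventual m le S S⇔)
    where
    open ℚ.≤-Reasoning
    K = proj₁ (archimedean ε 0<ε)
    -- Eleven grid steps of discrepancy and one as the margin of `<ᴿ`: 12/D = 1/(K+1), which is
    -- below ε.
    D = 12 * suc K
    open Grid D
    near-x = near x 0≤x (≤ᴿ-trans {x} {y} {fromℚ 1ℚ} (<ᴿ⇒≤ᴿ {x} {y} x<y) y≤1)
    near-y = near y (≤ᴿ-trans {fromℚ 0ℚ} {x} {y} 0≤x (<ᴿ⇒≤ᴿ {x} {y} x<y)) y≤1
    eventual = equidistributed x y D (proj₁ near-x) (proj₁ near-y) (proj₂ (proj₂ near-x)) (proj₂ (proj₂ near-y))
      x<y (proj₁ (proj₂ near-y))

-- The classes of the bases

𝟙-× : ∀ {A B : Set} (a : Dec A) (b : Dec B) → 𝟙 (a ×-dec b) ≡ 𝟙 a * 𝟙 b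
𝟙-× a b with does a
... | true  = sym (*-identityˡ (𝟙 b))
... | false = refl

𝟙-⇔ : ∀ {A B : Set} (a : Dec A) (b : Dec B) → (A → B) → (B → A) → 𝟙 a ≡ 𝟙 b
𝟙-⇔ (yes a) b f g = sym (𝟙-yes b (f a))
𝟙-⇔ (no ¬a) b f g = sym (𝟙-no b (¬a ∘ g))

sumFin : ∀ n → (Fin n → ℕ) → ℕ
sumFin zero    F = 0
sumFin (suc n) F = F Fin.zero + sumFin n (F ∘ Fin.suc)

sumℕ≡sumFin : ∀ n {f : ℕ → ℕ} {F : Fin n → ℕ} → (∀ t → f (toℕ t) ≡ F t) → sumℕ f n ≡ sumFin n F
sumℕ≡sumFin zero    h = refl
sumℕ≡sumFin (suc n) {f} h = trans (sumℕ-head f n) (cong₂ _+_ (h Fin.zero) (sumℕ≡sumFin n (h ∘ Fin.suc)))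

sumFin-cong : ∀ n {F G : Fin n → ℕ} → F ≗ G → sumFin n F ≡ sumFin n G
sumFin-cong zero    h = refl
sumFin-cong (suc n) h = cong₂ _+_ (h Fin.zero) (sumFin-cong n (h ∘ Fin.suc))

sumFin-+ : ∀ n (F G : Fin n → ℕ) → sumFin n (λ t → F t + G t) ≡ sumFin n F + sumFin n G
sumFin-+ zero    F G = refl
sumFin-+ (suc n) F G = trans (cong (λ z → F Fin.zero + G Fin.zero + z) (sumFin-+ n (F ∘ Fin.suc) (G ∘ Fin.suc)))
  (shuffle (F Fin.zero) (G Fin.zero) _ _)
  where
  shuffle : ∀ a b c d → (a + b) + (c + d) ≡ (a + c) + (b + d)
  shuffle = solve-∀

sumFin-* : ∀ n c (F : Fin n → ℕ) → sumFin n (λ t → c * F t) ≡ c * sumFin n F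
sumFin-* zero    c F = sym (*-zeroʳ c)
sumFin-* (suc n) c F = trans (cong (λ z → c * F Fin.zero + z) (sumFin-* n c (F ∘ Fin.suc))) (sym (*-distribˡ-+ c (F Fin.zero) _))

sumFin-1 : ∀ n → sumFin n (λ _ → 1) ≡ n
sumFin-1 zero    = refl
sumFin-1 (suc n) = cong suc (sumFin-1 n)

sumFin-sumℕ : ∀ n (F : ℕ → Fin n → ℕ) m → sumFin n (λ t → sumℕ (λ d → F d t) m) ≡ sumℕ (λ d → sumFin n (F d)) m
sumFin-sumℕ n F zero    = sumFin-* n 0 (λ _ → 0)
sumFin-sumℕ n F (suc m) = trans (sumFin-+ n _ (F m)) (cong (_+ sumFin n (F m)) (sumFin-sumℕ n F m))

length-filter-tabulate : ∀ {A : Set} {R : A → Set} (R? : ∀ x → Dec (R x)) n (g : Fin n → A) →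
  List.length (List.filter R? (List.tabulate g)) ≡ sumFin n (λ t → 𝟙 (R? (g t)))
length-filter-tabulate R? zero    g = refl
length-filter-tabulate R? (suc n) g with does (R? (g Fin.zero))
... | true  = cong suc (length-filter-tabulate R? n (g ∘ Fin.suc))
... | false = length-filter-tabulate R? n (g ∘ Fin.suc)

-- Whether [j/i , (j+2)/i] and [α/D , β/D] meet, with denominators cleared.
inRange : (i D α β j : ℕ) → ℕ
inRange i D α β j = 𝟙 (α * i ≤? D * (j + 2)) * 𝟙 (D * j ≤? β * i)

inRange-yes : ∀ i D α β j → α * i ≤ D * (j + 2) → D * j ≤ β * i → inRange i D α β j ≡ 1
inRange-yes i D α β j h h′ = cong₂ _*_ (𝟙-yes (α * i ≤? D * (j + 2)) h) (𝟙-yes (D * j ≤? β * i) h′)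

inRange-cases : ∀ i D α β j → inRange i D α β j ≡ 0 ⊎ (inRange i D α β j ≡ 1 × α * i ≤ D * (j + 2) × D * j ≤ β * i)
inRange-cases i D α β j with α * i ≤? D * (j + 2) | D * j ≤? β * i
... | no h  | _     = inj₁ (cong (_* 𝟙 (D * j ≤? β * i)) (𝟙-no (α * i ≤? D * (j + 2)) h))
... | yes h | no h′ = inj₁ (trans (cong (𝟙 (α * i ≤? D * (j + 2)) *_) (𝟙-no (D * j ≤? β * i) h′)) (*-zeroʳ (𝟙 (α * i ≤? D * (j + 2)))))
... | yes h | yes h′ = inj₂ (inRange-yes i D α β j h h′ , h , h′)

-- Until the first j in range the sum is 0; from then on it is at most n − j.
sum-inRange : ∀ i D α β → α ≤ β → ∀ n → D * sumℕ (inRange i D α β) n + α * i ≤ β * i + 3 * D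
sum-inRange i D α β α≤β n = proj₂ (both n)
  where
  open ≤-Reasoning
  I = inRange i D α β
  grow : ∀ D s a → D * (s + 1) + a ≡ D * s + a + D
  grow = solve-∀
  none : ∀ D s → D * (s + 0) ≡ D * s
  none = solve-∀
  next : ∀ D n → D * (n + 2) + D ≡ D * (suc n + 2)
  next = solve-∀
  end : ∀ D n → D * (n + 2) + D ≡ D * n + 3 * D
  end = solve-∀
  both : ∀ n → (sumℕ I n ≡ 0 ⊎ D * sumℕ I n + α * i ≤ D * (n + 2)) × D * sumℕ I n + α * i ≤ β * i + 3 * D
  both zero    = inj₁ refl , ≤-trans (≤-reflexive (cong (_+ α * i) (*-zeroʳ D))) (≤-trans (*-monoˡ-≤ i α≤β) (m≤m+n (β * i) (3 * D)))
  both (suc n) with inRange-cases i D α β n | both n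
  ... | inj₁ zero-term | (first , total) = first′ first , subst (λ z → D * (sumℕ I n + z) + α * i ≤ β * i + 3 * D) (sym zero-term)
      (≤-trans (≤-reflexive (cong (_+ α * i) (none D (sumℕ I n)))) total)
    where
    first′ : sumℕ I n ≡ 0 ⊎ D * sumℕ I n + α * i ≤ D * (n + 2) → sumℕ I n + I n ≡ 0 ⊎ D * (sumℕ I n + I n) + α * i ≤ D * (suc n + 2)
    first′ (inj₁ eq) = inj₁ (cong₂ _+_ eq zero-term)
    first′ (inj₂ le) = inj₂ (subst (λ z → D * (sumℕ I n + z) + α * i ≤ D * (suc n + 2)) (sym zero-term)
      (≤-trans (≤-reflexive (cong (_+ α * i) (none D (sumℕ I n)))) (≤-trans le (≤-trans (m≤m+n _ D) (≤-reflexive (next D n))))))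
  ... | inj₂ (one-term , α≤ , ≤β) | (first , _) =
    inj₂ (subst (λ z → D * (sumℕ I n + z) + α * i ≤ D * (suc n + 2)) (sym one-term)
      (≤-trans (≤-reflexive (grow D (sumℕ I n) (α * i))) (≤-trans (+-monoˡ-≤ D (so-far first)) (≤-reflexive (next D n))))) ,
    subst (λ z → D * (sumℕ I n + z) + α * i ≤ β * i + 3 * D) (sym one-term) (begin
      D * (sumℕ I n + 1) + α * i      ≡⟨ grow D (sumℕ I n) (α * i) ⟩
      D * sumℕ I n + α * i + D        ≤⟨ +-monoˡ-≤ D (so-far first) ⟩
      D * (n + 2) + D                 ≡⟨ end D n ⟩
      D * n + 3 * D                   ≤⟨ +-monoˡ-≤ (3 * D) ≤β ⟩
      β * i + 3 * D ∎)
    where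
    so-far : sumℕ I n ≡ 0 ⊎ D * sumℕ I n + α * i ≤ D * (n + 2) → D * sumℕ I n + α * i ≤ D * (n + 2)
    so-far (inj₁ eq) = subst (λ z → D * z + α * i ≤ D * (n + 2)) (sym eq) (≤-trans (≤-reflexive (cong (_+ α * i) (*-zeroʳ D))) α≤)
    so-far (inj₂ le) = le

-- With digit i and base q this reads j/i ≤ i/q, the left end of the cell. Numbering the classes
-- from 0 makes j the divisor in ⌊i²/j⌋, and for the class with base i³ the claim is trivial.
classBase-lower : ∀ {i} (j : Fin i) → toℕ j * classBase j ≤ i * i
classBase-lower {i@(suc _)} Fin.zero    = z≤n
classBase-lower {i@(suc _)} (Fin.suc j) = ≤-trans (≤-reflexive (*-comm (suc (toℕ j)) _))
  (≤-trans (m/n*n≤m (i ^ 2) (suc (toℕ j))) (≤-reflexive (cong (i *_) (*-identityʳ i))))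

-- The right end of the cell, (i+1)/q ≤ (j+2)/i. The floor in q = ⌊i²/j⌋ loses a remainder below j ≤
-- i ≤ q, so i² ≤ (j+1) q; the extra digit unit adds i ≤ q once more.
classBase-upper : ∀ {i} (j : Fin i) → suc i * i ≤ (toℕ j + 2) * classBase j
classBase-upper {i@(suc _)} j = begin
  i + i * i                          ≤⟨ +-mono-≤ (classBase≥ j) (square j) ⟩
  classBase j + (toℕ j + 1) * classBase j ≡⟨ collect (toℕ j) (classBase j) ⟩
  (toℕ j + 2) * classBase j ∎
  where
  open ≤-Reasoning
  collect : ∀ j q → q + (j + 1) * q ≡ (j + 2) * q
  collect = solve-∀
  square : ∀ (j : Fin i) → i * i ≤ (toℕ j + 1) * classBase j
  square Fin.zero    = ≤-trans (*-monoʳ-≤ i (m≤m*n i (i * 1) {{m*n≢0 i 1}})) (≤-reflexive (sym (*-identityˡ (i ^ 3))))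
  square j′@(Fin.suc j) = begin
    i * i                                ≡⟨ cong (i *_) (*-identityʳ i) ⟨
    i ^ 2                                ≡⟨ m≡m%n+[m/n]*n (i ^ 2) s ⟩
    i ^ 2 % s + i ^ 2 / s * s            ≤⟨ +-monoˡ-≤ (i ^ 2 / s * s) (≤-trans (<⇒≤ (m%n<n (i ^ 2) s)) (≤-trans (<⇒≤ (Fin.toℕ<n j′)) (classBase≥ j′))) ⟩
    i ^ 2 / s + i ^ 2 / s * s            ≡⟨ flip-order (i ^ 2 / s) s ⟩
    (s + 1) * (i ^ 2 / s) ∎
    where
    s = suc (toℕ j)
    flip-order : ∀ q s → q + q * s ≡ (s + 1) * q
    flip-order = solve-∀

-- The divisors stop at i - 1, and (i+1)(i-1) = i² - 1 ≤ i². Hence the digit i is admissible in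
-- every class.
classBase> : ∀ {i} → 2 ≤ i → (j : Fin i) → i < classBase j
classBase> {i@(suc i′)} 2≤i Fin.zero = ≤-trans (+-monoˡ-≤ i (<⇒≤ 2≤i)) (≤-trans (≤-trans (≤-reflexive (double i)) (*-monoʳ-≤ i 2≤i))
  (*-monoʳ-≤ i (m≤m*n i (i * 1) {{m*n≢0 i 1}})))
  where
  double : ∀ i → i + i ≡ i * 2
  double = solve-∀
classBase> {i@(suc i′)} 2≤i (Fin.suc j) = ≤-trans (≤-reflexive (sym (m*n/n≡m (suc i) s))) (/-monoˡ-≤ s (begin
  suc i * s        ≤⟨ *-monoʳ-≤ (suc i) (Fin.toℕ<n j) ⟩
  suc i * i′       ≤⟨ n≤1+n _ ⟩
  suc (suc i * i′) ≡⟨ square i′ ⟩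
  i ^ 2 ∎))
  where
  open ≤-Reasoning
  s = suc (toℕ j)
  square : ∀ n → suc (suc (suc n) * n) ≡ suc n * (suc n * 1)
  square = solve-∀

classBase≤ : ∀ {i} (j : Fin i) → classBase j ≤ i ^ 3
classBase≤ {i@(suc _)} Fin.zero    = ≤-refl
classBase≤ {i@(suc _)} (Fin.suc j) = ≤-trans (m/n≤m (i ^ 2) (suc (toℕ j))) (m≤n*m (i ^ 2) i)

module _ (i : ℕ) .{{_ : NonZero i}} (cd : ClassDivision i) where

  private
    L = ∣W∣ i
    C = i * 2 ^ (i ^ 3) ∸ i ^ 2 * 2 ^ (i ^ 3 ∸ i)

    low : Fin L → ℕ
    low t = 𝟙 (letter i t <? i)

    top : Fin L → ℕ
    top t = 𝟙 (letter i t ≟ i)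

    lows = sumFin L low

  q-low : ∀ t → letter i t < i → q i cd t ≡ i
  q-low t lt = cong (λ b → if b then i else classBase (class cd t)) (dec-true (letter i t <? i) lt)

  q-top : ∀ t → letter i t ≡ i → q i cd t ≡ classBase (class cd t)
  q-top t eq = cong (λ b → if b then i else classBase (class cd t)) (dec-false (letter i t <? i) (<-irrefl eq))

  letter-cases : ∀ t → letter i t < i ⊎ letter i t ≡ i
  letter-cases t with letter i t ≟ i
  ... | yes eq = inj₂ eq
  ... | no  ne = inj₁ (≤∧≢⇒< (letter≤ i t) ne)

  letter<q : 2 ≤ i → ∀ t → letter i t < q i cd t
  letter<q 2≤i t with letter-cases t
  ... | inj₁ lt = subst (letter i t <_) (sym (q-low t lt)) lt
  ... | inj₂ eq = subst₂ _<_ (sym eq) (sym (q-top t eq)) (classBase> 2≤i (class cd t))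

  q≤i³ : ∀ t → q i cd t ≤ i ^ 3
  q≤i³ t with letter-cases t
  ... | inj₁ lt = subst (_≤ i ^ 3) (sym (q-low t lt)) (m≤m*n i (i ^ 2) {{m^n≢0 i 2}})
  ... | inj₂ eq = subst (_≤ i ^ 3) (sym (q-top t eq)) (classBase≤ (class cd t))

  private
    class-sum : ∀ d → d < i → sumFin L (λ t → top t * 𝟙 (d ≟ toℕ (class cd t))) ≡ C
    class-sum d d<i = trans (sumFin-cong L λ t → trans
        (cong (top t *_) (𝟙-⇔ (d ≟ toℕ (class cd t)) (class cd t Fin.≟ j) (λ eq → Fin.toℕ-injective (sym (trans (Fin.toℕ-fromℕ< d<i) eq)))
          (λ eq → sym (trans (cong toℕ eq) (Fin.toℕ-fromℕ< d<i)))))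
        (sym (𝟙-× (letter i t ≟ i) (class cd t Fin.≟ j))))
      (trans (sym (length-filter-tabulate (λ t → (letter i t ≟ i) ×-dec (class cd t Fin.≟ j)) L (λ t → t))) (class-size cd j))
      where j = Fin.fromℕ< d<i

    -- Equal class sizes enter here: an average over the positions with letter i becomes an average
    -- over j, wherever the classes lie in the word.
    class-weighted : ∀ (I : ℕ → ℕ) → sumFin L (λ t → low t + top t * I (toℕ (class cd t))) ≡ lows + C * sumℕ I i
    class-weighted I = trans (sumFin-+ L low (λ t → top t * I (toℕ (class cd t)))) (cong (λ z → lows + z) (begin
      sumFin L (λ t → top t * I (toℕ (class cd t)))
        ≡⟨ sumFin-cong L (λ t → trans (cong (top t *_) (sym (sumℕ-pick I (toℕ (class cd t)) i (Fin.toℕ<n (class cd t)))))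
             (trans (sym (sumℕ-* (top t) _ i)) (sumℕ-cong i λ d _ → exchange (top t) (I d) _))) ⟩
      sumFin L (λ t → sumℕ (λ d → I d * (top t * 𝟙 (d ≟ toℕ (class cd t)))) i)
        ≡⟨ sumFin-sumℕ L (λ d t → I d * (top t * 𝟙 (d ≟ toℕ (class cd t)))) i ⟩
      sumℕ (λ d → sumFin L (λ t → I d * (top t * 𝟙 (d ≟ toℕ (class cd t))))) i
        ≡⟨ sumℕ-cong i (λ d d<i → trans (sumFin-* L (I d) (λ t → top t * 𝟙 (d ≟ toℕ (class cd t)))) (trans (cong (I d *_) (class-sum d d<i)) (*-comm (I d) C))) ⟩
      sumℕ (λ d → C * I d) i
        ≡⟨ sumℕ-* C I i ⟩
      C * sumℕ I i ∎))
      where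
      open ≡-Reasoning
      exchange : ∀ x y z → x * (y * z) ≡ y * (x * z)
      exchange = solve-∀

    partition : L ≡ lows + C * i
    partition = begin
      L                                       ≡⟨ sumFin-1 L ⟨
      sumFin L (λ _ → 1)                      ≡⟨ sumFin-cong L one ⟩
      sumFin L (λ t → low t + top t * 1)      ≡⟨ class-weighted (λ _ → 1) ⟩
      lows + C * sumℕ (λ _ → 1) i             ≡⟨ cong (λ z → lows + C * z) (trans (sumℕ-const 1 i) (*-identityʳ i)) ⟩
      lows + C * i ∎
      where
      open ≡-Reasoning
      one : ∀ t → 1 ≡ low t + top t * 1
      one t with letter-cases t
      ... | inj₁ lt = sym (cong₂ (λ a b → a + b * 1) (𝟙-yes (letter i t <? i) lt) (𝟙-no (letter i t ≟ i) (<⇒≢ lt)))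
      ... | inj₂ eq = sym (cong₂ (λ a b → a + b * 1) (𝟙-no (letter i t <? i) (<-irrefl eq)) (𝟙-yes (letter i t ≟ i) eq))

    -- Read off from the class sizes: the i classes fill all but at most i³ 2^(i³-i) of the i²
    -- 2^(i³) positions, so letters below i have density at most i/2^i.
    lows-few : 2 ^ i * lows ≤ i * L
    lows-few = begin
      2 ^ i * lows                                        ≤⟨ *-monoʳ-≤ (2 ^ i) lows≤ ⟩
      2 ^ i * (i * (i ^ 2 * 2 ^ (i ^ 3 ∸ i)))             ≡⟨ regroup (2 ^ i) i (i ^ 2) (2 ^ (i ^ 3 ∸ i)) ⟩
      i * (i ^ 2 * (2 ^ i * 2 ^ (i ^ 3 ∸ i)))             ≡⟨ cong (λ z → i * (i ^ 2 * z)) (trans (2^-+ i (i ^ 3 ∸ i)) (cong (2 ^_) (m+[n∸m]≡n (m≤m*n i (i ^ 2) {{m^n≢0 i 2}})))) ⟩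
      i * (i ^ 2 * 2 ^ (i ^ 3))                           ≡⟨ cong (i *_) (length-W i) ⟨
      i * L ∎
      where
      open ≤-Reasoning
      regroup : ∀ p i s r → p * (i * (s * r)) ≡ i * (s * (p * r))
      regroup = solve-∀
      split : ∀ i p → i * (i * 1) * p ≡ i * (i * p)
      split = solve-∀
      lows≤ : lows ≤ i * (i ^ 2 * 2 ^ (i ^ 3 ∸ i))
      lows≤ = +-cancelʳ-≤ (C * i) lows _ (begin
        lows + C * i                                      ≡⟨ partition ⟨
        L                                                 ≡⟨ length-W i ⟩
        i ^ 2 * 2 ^ (i ^ 3)                               ≡⟨ split i (2 ^ (i ^ 3)) ⟩
        i * (i * 2 ^ (i ^ 3))                             ≤⟨ *-monoʳ-≤ i (m≤n+m∸n (i * 2 ^ (i ^ 3)) (i ^ 2 * 2 ^ (i ^ 3 ∸ i))) ⟩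
        i * (i ^ 2 * 2 ^ (i ^ 3 ∸ i) + C)                 ≡⟨ *-distribˡ-+ i (i ^ 2 * 2 ^ (i ^ 3 ∸ i)) C ⟩
        i * (i ^ 2 * 2 ^ (i ^ 3 ∸ i)) + i * C             ≡⟨ cong (λ z → i * (i ^ 2 * 2 ^ (i ^ 3 ∸ i)) + z) (*-comm i C) ⟩
        i * (i ^ 2 * 2 ^ (i ^ 3 ∸ i)) + C * i ∎)

  -- Letters below i give no control over the fractional part; being rare, they are counted for
  -- every interval.
  cellTally : (D α β : ℕ) → Fin (∣W∣ i) → ℕ
  cellTally D α β t = 𝟙 (letter i t <? i) + 𝟙 (letter i t ≟ i) * inRange i D α β (toℕ (class cd t))

  cellTally≤2 : ∀ D α β t → cellTally D α β t ≤ 2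
  cellTally≤2 D α β t = +-mono-≤ (𝟙≤1 (letter i t <? i)) (*-mono-≤ (𝟙≤1 (letter i t ≟ i))
    (*-mono-≤ (𝟙≤1 (α * i ≤? D * (toℕ (class cd t) + 2))) (𝟙≤1 (D * toℕ (class cd t) ≤? β * i))))

  cellTally-low : ∀ D α β t → letter i t < i → 1 ≤ cellTally D α β t
  cellTally-low D α β t lt = ≤-trans (≤-reflexive (sym (𝟙-yes (letter i t <? i) lt))) (m≤m+n (𝟙 (letter i t <? i)) _)

  cellTally-top : ∀ D α β t → letter i t ≡ i → let j = toℕ (class cd t) in
    α * i ≤ D * (j + 2) → D * j ≤ β * i → 1 ≤ cellTally D α β t
  cellTally-top D α β t eq h h′ = ≤-trans (≤-reflexive (sym (cong₂ _*_ (𝟙-yes (letter i t ≟ i) eq)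
    (inRange-yes i D α β (toℕ (class cd t)) h h′)))) (m≤n+m _ (𝟙 (letter i t <? i)))

  -- The slack of one grid step is shared equally by two errors: the letters below i, (D+α) · lows ≤
  -- L/2, and the boundary term of `sum-inRange`, 3DC ≤ L/2.
  cellTally-density : ∀ D α β → α ≤ β → 6 * D ≤ i → 2 * (D + α) * i ≤ 2 ^ i →
    D * sumFin (∣W∣ i) (cellTally D α β) + α * ∣W∣ i ≤ (β + 1) * ∣W∣ i
  cellTally-density D α β α≤β 6D≤i small = begin
    D * sumFin L (cellTally D α β) + α * L
      ≡⟨ cong₂ (λ a b → D * a + α * b) (class-weighted (inRange i D α β)) partition ⟩
    D * (lows + C * I) + α * (lows + C * i)
      ≡⟨ regroup D lows C I α i ⟩
    (D + α) * lows + C * (D * I + α * i)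
      ≤⟨ +-monoʳ-≤ ((D + α) * lows) (*-monoʳ-≤ C (sum-inRange i D α β α≤β i)) ⟩
    (D + α) * lows + C * (β * i + 3 * D)
      ≡⟨ regroup′ D lows C α β i ⟩
    ((D + α) * lows + 3 * D * C) + β * (C * i)
      ≤⟨ +-mono-≤ (*-cancelˡ-≤ 2 error) (*-monoʳ-≤ β Ci≤L) ⟩
    L + β * L
      ≡⟨ cong (_* L) (+-comm 1 β) ⟩
    (β + 1) * L ∎
    where
    open ≤-Reasoning
    I = sumℕ (inRange i D α β) i
    Ci≤L : C * i ≤ L
    Ci≤L = ≤-trans (m≤n+m (C * i) lows) (≤-reflexive (sym partition))
    regroup : ∀ D z C I α i → D * (z + C * I) + α * (z + C * i) ≡ (D + α) * z + C * (D * I + α * i)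
    regroup = solve-∀
    regroup′ : ∀ D z C α β i → (D + α) * z + C * (β * i + 3 * D) ≡ ((D + α) * z + 3 * D * C) + β * (C * i)
    regroup′ = solve-∀
    e₁ : ∀ D α z C → 2 * ((D + α) * z + 3 * D * C) ≡ 2 * (D + α) * z + C * (6 * D)
    e₁ = solve-∀
    e₂ : ∀ i x z → i * (x * z) ≡ x * i * z
    e₂ = solve-∀
    lows≤L : 2 * (D + α) * lows ≤ L
    lows≤L = *-cancelˡ-≤ i (begin
      i * (2 * (D + α) * lows)     ≡⟨ e₂ i (2 * (D + α)) lows ⟩
      2 * (D + α) * i * lows       ≤⟨ *-monoˡ-≤ lows small ⟩
      2 ^ i * lows                 ≤⟨ lows-few ⟩
      i * L ∎)
    error : 2 * ((D + α) * lows + 3 * D * C) ≤ 2 * L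
    error = begin
      2 * ((D + α) * lows + 3 * D * C)       ≡⟨ e₁ D α lows C ⟩
      2 * (D + α) * lows + C * (6 * D)       ≤⟨ +-mono-≤ lows≤L (≤-trans (*-monoʳ-≤ C 6D≤i) Ci≤L) ⟩
      L + L                                  ≡⟨ cong (λ z → L + z) (+-identityʳ L) ⟨
      2 * L ∎

-- The theorem

-- If `f` vanished from n on, its sums would not exceed n.
sumℕ-unbounded : ∀ (f : ℕ → ℕ) → (∀ n → f n ≤ 1) → ∀ l {n} → n < sumℕ f l → ∃[ m ] n ≤ m × 1 ≤ f m
sumℕ-unbounded f f≤1 (suc l) {n} h with n <? sumℕ f l
... | yes lt = sumℕ-unbounded f f≤1 l lt
... | no  ge with f l in eq
...   | zero  = contradiction (subst (n <_) (+-identityʳ (sumℕ f l)) h) ge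
...   | suc _ = l , s≤s⁻¹ (≤-trans h (≤-trans (+-mono-≤ (sum≤ l) (subst (_≤ 1) eq (f≤1 l))) (≤-reflexive (+-comm l 1)))) ,
                subst (1 ≤_) (sym eq) (s≤s z≤n)
  where
  sum≤ : ∀ l → sumℕ f l ≤ l
  sum≤ l = ≤-trans (sumℕ-mono l (λ j _ → f≤1 j)) (≤-reflexive (trans (sumℕ-const 1 l) (*-identityʳ l)))

placeAt-position : ∀ {n} (p : Position n) → ∃[ t ] placeAt n ≡ (stage p , t)
placeAt-position (position {k} {m} {o} m< o< eq) = Fin.fromℕ< o<′ , trans (cong placeAt (trans eq
    (cong (λ z → pos k m + z) (sym (Fin.toℕ-fromℕ< o<′))))) (placeAt-pos k m (Fin.fromℕ< o<′) m<)
  where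
  o<′ : o < ∣W∣ (6 + k)
  o<′ = subst (o <_) (len≡∣W∣ k) o<

copySum-place : ∀ (F : Place → ℕ) k m → m < rep k →
                copySum (F ∘ placeAt) k m ≡ sumFin (∣W∣ (6 + k)) (λ t → F (k , t))
copySum-place F k m m< = trans (cong (sumℕ (λ t → F (placeAt (pos k m + t)))) (len≡∣W∣ k))
  (sumℕ≡sumFin (∣W∣ (6 + k)) (λ t → cong F (placeAt-pos k m t m<)))

module _ (c : (k : ℕ) → ClassDivision (6 + k)) where

  opaque
    baseOf : Place → ℕ
    baseOf (k , t) = q (6 + k) (c k) t

    baseOf≡ : ∀ k t → baseOf (k , t) ≡ q (6 + k) (c k) t
    baseOf≡ k t = refl

    base≡ : ∀ n → base Q[ c ] n ≡ baseOf (placeAt n)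
    base≡ n = sym (cong baseOf (placeAt≡ n))

    tallyOf : (D α β : ℕ) → Place → ℕ
    tallyOf D α β (k , t) = cellTally (6 + k) (c k) D α β t

    tallyOf≡ : ∀ D α β k t → tallyOf D α β (k , t) ≡ cellTally (6 + k) (c k) D α β t
    tallyOf≡ D α β k t = refl

  tally : (D α β n : ℕ) → ℕ
  tally D α β n = tallyOf D α β (placeAt n)

  module At {n} (p : Position n) where
    t : Fin (∣W∣ (6 + stage p))
    t = proj₁ (placeAt-position p)

    base-at : base Q[ c ] n ≡ q (6 + stage p) (c (stage p)) t
    base-at = trans (base≡ n) (trans (cong baseOf (proj₂ (placeAt-position p))) (baseOf≡ (stage p) t))

    digit-at : digits n ≡ letter (6 + stage p) t
    digit-at = trans (cong letterAt (proj₂ (placeAt-position p))) (letterAt≡ (stage p) t)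

    tally-at : ∀ D α β → tally D α β n ≡ cellTally (6 + stage p) (c (stage p)) D α β t
    tally-at D α β = trans (cong (tallyOf D α β) (proj₂ (placeAt-position p))) (tallyOf≡ D α β (stage p) t)

  base≥ : ∀ {n} (p : Position n) → 6 + stage p ≤ base Q[ c ] n
  base≥ p = subst (6 + stage p ≤_) (sym (At.base-at p)) (q≥i (6 + stage p) (c (stage p)) (At.t p))

  base≤ : ∀ {n} (p : Position n) → base Q[ c ] n ≤ (6 + stage p) ^ 3
  base≤ p = subst (_≤ (6 + stage p) ^ 3) (sym (At.base-at p)) (q≤i³ (6 + stage p) (c (stage p)) (At.t p))

  digits<base : ∀ n → digits n < base Q[ c ] n
  digits<base n = subst₂ _<_ (sym (At.digit-at p)) (sym (At.base-at p))
    (letter<q (6 + stage p) (c (stage p)) (s≤s (s≤s z≤n)) (At.t p))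
    where p = locate n

  tally≤2 : ∀ D α β n → tally D α β n ≤ 2
  tally≤2 D α β n = subst (_≤ 2) (sym (At.tally-at p D α β)) (cellTally≤2 (6 + stage p) (c (stage p)) D α β (At.t p))
    where p = locate n

  -- Copy by copy D · tally + α is compared with the constant β + 1. Choosing N = β + 1 in
  -- `≲-from-copies` costs the factor (β+2)/(β+1), that is, exactly one more grid step.
  tally-density : ∀ D α β → α ≤ β → Eventually (λ m → D * sumℕ (tally D α β) m + α * m ≤ (β + 2) * m)
  tally-density D α β α≤β = ev-map conclude (≲-from-copies f g (D * 2 + α)
    (λ n → +-monoˡ-≤ α (*-monoʳ-≤ D (tally≤2 D α β n)))
    (λ K → ev-map (λ k h m m< → *-mono-≤ (n≤1+n K) (h m m<)) copies≤) growth (β + 1))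
    where
    open ≤-Reasoning
    f g : ℕ → ℕ
    f n = D * tally D α β n + α
    g _ = β + 1
    sum-f : ∀ l (u : ℕ → ℕ) → sumℕ (λ n → D * u n + α) l ≡ D * sumℕ u l + α * l
    sum-f l u = trans (sumℕ-+ (λ n → D * u n) (λ _ → α) l) (cong₂ _+_ (sumℕ-* D u l) (trans (sumℕ-const α l) (*-comm l α)))
    sum-g : ∀ l → sumℕ g l ≡ (β + 1) * l
    sum-g l = trans (sumℕ-const (β + 1) l) (*-comm l (β + 1))
    copies≤ : Eventually (λ k → ∀ m → m < rep k → copySum f k m ≤ copySum g k m)
    copies≤ = ev-map₂ step (ev-≥ (6 * D)) (ev-shift 6 (poly≤2^ (2 * (D + α)) 1))
      where
      step : ∀ k → 6 * D ≤ k → 2 * (D + α) * (6 + k) ^ 1 ≤ 2 ^ (6 + k) → ∀ m → m < rep k → copySum f k m ≤ copySum g k m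
      step k 6D≤k small m m< = begin
        copySum f k m
          ≡⟨ sum-f (len k) (λ t → tally D α β (pos k m + t)) ⟩
        D * copySum (tally D α β) k m + α * len k
          ≡⟨ cong₂ (λ a b → D * a + α * b) (trans (copySum-place (tallyOf D α β) k m m<) (sumFin-cong (∣W∣ (6 + k)) (tallyOf≡ D α β k))) (len≡∣W∣ k) ⟩
        D * sumFin (∣W∣ (6 + k)) (cellTally (6 + k) (c k) D α β) + α * ∣W∣ (6 + k)
          ≤⟨ cellTally-density (6 + k) (c k) D α β α≤β (≤-trans 6D≤k (m≤n+m k 6))
               (subst (λ z → 2 * (D + α) * z ≤ 2 ^ (6 + k)) (*-identityʳ (6 + k)) small) ⟩
        (β + 1) * ∣W∣ (6 + k)
          ≡⟨ cong ((β + 1) *_) (len≡∣W∣ k) ⟨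
        (β + 1) * len k
          ≡⟨ sum-g (len k) ⟨
        copySum g k m ∎
    growth : ∀ M → Eventually (λ k → M * len (suc k) ≤ sumℕ g (stageStart (suc k)))
    growth M = ev-map grow (length≪sum 0 M)
      where
      grow : ∀ k → M * (scale 0 k * len (suc k)) ≤ rep k * len k → M * len (suc k) ≤ sumℕ g (stageStart (suc k))
      grow k h = begin
        M * len (suc k)                   ≡⟨ cong (M *_) (trans (cong (λ z → 2 ^ z * len (suc k)) (*-zeroʳ (6 + k))) (*-identityˡ (len (suc k)))) ⟨
        M * (scale 0 k * len (suc k))     ≤⟨ h ⟩
        rep k * len k                     ≤⟨ m≤n+m (rep k * len k) (stageStart k) ⟩
        stageStart (suc k)                ≤⟨ m≤n*m (stageStart (suc k)) (β + 1) {{>-nonZero (m≤n+m 1 β)}} ⟩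
        (β + 1) * stageStart (suc k)      ≡⟨ sum-g (stageStart (suc k)) ⟨
        sumℕ g (stageStart (suc k)) ∎
    conclude : ∀ m → (β + 1) * sumℕ f m ≤ suc (β + 1) * sumℕ g m → D * sumℕ (tally D α β) m + α * m ≤ (β + 2) * m
    conclude m h = *-cancelˡ-≤ (β + 1) {{>-nonZero (m≤n+m 1 β)}} (begin
      (β + 1) * (D * sumℕ (tally D α β) m + α * m)     ≡⟨ cong ((β + 1) *_) (sum-f m (tally D α β)) ⟨
      (β + 1) * sumℕ f m                               ≤⟨ h ⟩
      suc (β + 1) * sumℕ g m                           ≡⟨ cong (suc (β + 1) *_) (sum-g m) ⟩
      suc (β + 1) * ((β + 1) * m)                      ≡⟨ swap β m ⟩
      (β + 1) * ((β + 2) * m) ∎)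
      where
      swap : ∀ b m → suc (b + 1) * ((b + 1) * m) ≡ (b + 1) * ((b + 2) * m)
      swap = solve-∀

  opaque
    ψdigit : ℕ → ℕ
    ψdigit n = digit ζ-expansion n ⊓ (base Q[ c ] n ∸ 1)

    ψdigit≡ : (λ n → digit ζ-expansion n ⊓ (base Q[ c ] n ∸ 1)) ≡ ψdigit
    ψdigit≡ = refl

  digit-ζ : digit ζ-expansion ≡ E
  digit-ζ = refl

  ψdigit≡digits : ∀ n → ψdigit n ≡ digits n
  ψdigit≡digits n = begin
    ψdigit n                                          ≡⟨ cong-app ψdigit≡ n ⟨
    digit ζ-expansion n ⊓ (base Q[ c ] n ∸ 1)         ≡⟨ cong (λ d → d n ⊓ (base Q[ c ] n ∸ 1)) digit-ζ ⟩
    E n ⊓ (base Q[ c ] n ∸ 1)                         ≡⟨ cong (_⊓ (base Q[ c ] n ∸ 1)) (digits≡E n) ⟨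
    digits n ⊓ (base Q[ c ] n ∸ 1)                    ≡⟨ m≤n⇒m⊓n≡m (∸-monoˡ-≤ 1 (digits<base n)) ⟩
    digits n ∎
    where open ≡-Reasoning

  cell : ∀ n → (∀ D α β → 1 ≤ tally D α β n) ⊎
    (∃[ i ] ∃[ j ] NonZero i × j ≤ i × j * base Q[ c ] n ≤ ψdigit n * i × suc (ψdigit n) * i ≤ (j + 2) * base Q[ c ] n ×
      (∀ D α β → α * i ≤ D * (j + 2) → D * j ≤ β * i → 1 ≤ tally D α β n))
  cell n = by-letter (letter-cases i (c (stage p)) t)
    where
    p = locate n
    i = 6 + stage p
    t = At.t p
    j = toℕ (class (c (stage p)) t)
    by-letter : letter i t < i ⊎ letter i t ≡ i → (∀ D α β → 1 ≤ tally D α β n) ⊎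
      (∃[ i ] ∃[ j ] NonZero i × j ≤ i × j * base Q[ c ] n ≤ ψdigit n * i × suc (ψdigit n) * i ≤ (j + 2) * base Q[ c ] n ×
        (∀ D α β → α * i ≤ D * (j + 2) → D * j ≤ β * i → 1 ≤ tally D α β n))
    by-letter (inj₁ lt) = inj₁ λ D α β → subst (1 ≤_) (sym (At.tally-at p D α β)) (cellTally-low i (c (stage p)) D α β t lt)
    by-letter (inj₂ eq) = inj₂ (i , j , _ , <⇒≤ (Fin.toℕ<n (class (c (stage p)) t)) ,
      subst₂ (λ b d → j * b ≤ d * i) (sym base≡class) (sym digit≡i) (classBase-lower (class (c (stage p)) t)) ,
      subst₂ (λ b d → suc d * i ≤ (j + 2) * b) (sym base≡class) (sym digit≡i) (classBase-upper (class (c (stage p)) t)) ,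
      λ D α β h h′ → subst (1 ≤_) (sym (At.tally-at p D α β)) (cellTally-top i (c (stage p)) D α β t eq h h′))
      where
      base≡class : base Q[ c ] n ≡ classBase (class (c (stage p)) t)
      base≡class = trans (At.base-at p) (q-top i (c (stage p)) t eq)
      digit≡i : ψdigit n ≡ i
      digit≡i = trans (ψdigit≡digits n) (trans (At.digit-at p) eq)

  -- The digit 0 occurs arbitrarily late, and 0 ≠ q - 1 because q ≥ 2.
  ψdigit-infOften : InfOften Q[ c ] ψdigit
  ψdigit-infOften n = beyond (length≪occurrences (0 ∷ []) (suc n))
    where
    zeros : ℕ → ℕ
    zeros = matchAt (0 ∷ []) digits
    zero-digit : ∀ m → 1 ≤ zeros m → ψdigit m ≡ 0
    zero-digit m one with digits (m + 0) ≟ 0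
    ... | yes eq = trans (ψdigit≡digits m) (trans (cong digits (sym (+-identityʳ m))) eq)
    ... | no  ne = contradiction (subst (1 ≤_) (cong (_* 1) (𝟙-no (digits (m + 0) ≟ 0) ne)) one) λ ()
    at : ∃[ m ] n ≤ m × 1 ≤ zeros m → ∃[ m ] n ≤ m × ψdigit m ≢ base Q[ c ] m ∸ 1
    at (m , n≤m , one) = m , n≤m , λ eq →
      contradiction (trans (sym (zero-digit m one)) eq) (<⇒≢ (∸-monoˡ-≤ 1 (base≥2 Q[ c ] m)))
    beyond : Eventually (λ k → suc n * len (suc k) ≤ sumℕ zeros (stageStart (suc k))) →
      ∃[ m ] n ≤ m × ψdigit m ≢ base Q[ c ] m ∸ 1
    beyond (k , growth) = at (sumℕ-unbounded zeros (λ m → match≤1 (0 ∷ []) (λ t → digits (m + t))) (stageStart (suc k))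
      (≤-trans (m≤m*n (suc n) (len (suc k)) {{>-nonZero (len>0 (suc k))}}) (growth k ≤-refl)))

  occurrences-ψdigit : ∀ {κ} (B : Vec ℕ κ) n → occurrences B ψdigit n ≡ sumℕ (matchAt B digits) n
  occurrences-ψdigit B n = trans (occurrences-cong B ψdigit≡digits n) (occurrences≡ B digits n)

  ratio-normal : ∀ κ → 1 ≤ κ → (B₁ B₂ : Vec ℕ κ) →
    Ratio→1 (λ n → fromℕ (occurrences B₁ ψdigit n)) (λ n → fromℕ (occurrences B₂ ψdigit n))
  ratio-normal κ _ B₁ B₂ = Ratio→1-fromℕ (occurrences B₁ ψdigit) (occurrences B₂ ψdigit)
    (ev-map (λ n → subst (1 ≤_) (sym (occurrences-ψdigit B₂ n))) (occurrences→∞ B₂))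
    (λ M → ev-map (λ n → subst₂ (λ a b → M * a ≤ suc M * b) (sym (occurrences-ψdigit B₁ n)) (sym (occurrences-ψdigit B₂ n)))
      (occurrences-≲ B₁ B₂ M))
    (λ M → ev-map (λ n → subst₂ (λ a b → M * a ≤ suc M * b) (sym (occurrences-ψdigit B₂ n)) (sym (occurrences-ψdigit B₁ n)))
      (occurrences-≲ B₂ B₁ M))

  open Growth Q[ c ] base≥ base≤ using (infiniteInLimit; fullyDivergent; zeros-not-normal)

  series-ψdigit : (ψdigit<base : ∀ n → ψdigit n < base Q[ c ] n) →
                  series Q[ c ] ψdigit ψdigit<base ∈ (RN Q[ c ] ∩ DN Q[ c ]) ∖ N Q[ c ]
  series-ψdigit ψdigit<base =
    ((seriesExpansion Q[ c ] ψdigit ψdigit<base ψdigit-infOften , ratio-normal) ,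
     Equidistribution.uniformlyDistributed Q[ c ] ψdigit ψdigit<base ψdigit-infOften tally cell tally-density) ,
    λ (e , normal) → zeros-not-normal (digit e)
      (λ n → trans (expansion-unique Q[ c ] ψdigit ψdigit<base ψdigit-infOften e n) (ψdigit≡digits n))
      (normal 1 ≤-refl (0 ∷ []))

  -- The series in `ψ` carries its own proof that the digits are below the bases; with that proof as
  -- a parameter, only the digit sequences have to be identified.
  series-ψ : ∀ d (d<base : ∀ n → d n < base Q[ c ] n) → d ≡ ψdigit →
             series Q[ c ] d d<base ∈ (RN Q[ c ] ∩ DN Q[ c ]) ∖ N Q[ c ]
  series-ψ _ d<base refl = series-ψdigit d<base

theorem3p11 : (c : (k : ℕ) → ClassDivision (6 + k)) →
    InfiniteInLimit Q[ c ] × FullyDivergent Q[ c ] ×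
    ψ P Q[ c ] ζ ζ-expansion ∈ (RN Q[ c ] ∩ DN Q[ c ]) ∖ N Q[ c ]
theorem3p11 c = infiniteInLimit , fullyDivergent , series-ψ c _ _ (ψdigit≡ c)
  where open Growth Q[ c ] (base≥ c) (base≤ c) using (infiniteInLimit; fullyDivergent)
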